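{- Let $q>2$ be a prime power. Then $\zeta_A(1,q(q-1),q^3-q^2+q-1)$ is zeta-like; more precisely, $$\zeta_A(1,q(q-1),q^3-q^2+q-1)=\frac{[3]-1}{[3]\,[2]\,[1]^{q^2-q+1}}\,\zeta_A(q^3).$$
   Context: $A=\mathbb{F}_q[\theta]$, $A_+$ the monic polynomials, $K=\mathbb{F}_q(\theta)$, $[k]=\theta^{q^k}-\theta$. For $s\in\mathbb{Z}$, $d\ge0$ let $S_d(s)=\sum_{a\in A_+,\deg a=d}a^{ -s}$. For positive integers $s_1,\dots,s_r$, $\zeta_A(s_1,\dots,s_r)=\sum_{d_1>\cdots>d_r\ge0}S_{d_1}(s_1)\cdots S_{d_r}(s_r)$, and $\zeta_A(k)=\sum_{a\in A_+}a^{ -k}$. A multizeta value of weight $w=\sum s_i$ is zeta-like if $\zeta_A(s_1,\dots,s_r)/\zeta_A(w)\in K$. -}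

module Defs where

open import Level using (0ℓ)
open import Data.Nat as ℕ using (ℕ; zero; suc; _∸_)
open import Data.List using (List; []; _∷_; map; concatMap; foldr; length)
open import Data.List.Relation.Unary.Any using (Any)
open import Data.List.Relation.Unary.AllPairs using (AllPairs)
open import Data.Product using (∃)
open import Relation.Binary.PropositionalEquality using (_≡_)
open import Relation.Nullary using (¬_)
open import Algebra.Bundles using (CommutativeRing)

record FiniteField (F : CommutativeRing 0ℓ 0ℓ) (q : ℕ) : Set where
  open CommutativeRing F
  field
    nontrivial : ¬ (1# ≈ 0#)
    inverse    : ∀ x → ¬ (x ≈ 0#) → ∃ λ y → x * y ≈ 1#
    elems      : List Carrier
    complete   : ∀ x → Any (x ≈_) elems
    distinct   : AllPairs (λ a b → ¬ (a ≈ b)) elems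
    card       : length elems ≡ q

-- Arithmetic in K_∞ = F_q((1/θ)).  We write x = 1/θ.
-- A power series in x is a coefficient function ℕ → F.
-- A Laurent series is a pair (k , f) standing for x^(-k) · f = θ^k · f.

module Series (F : CommutativeRing 0ℓ 0ℓ) (elems : List (CommutativeRing.Carrier F)) where
  open CommutativeRing F

  PS : Set
  PS = ℕ → Carrier

  sumTo : ℕ → (ℕ → Carrier) → Carrier
  sumTo zero    f = 0#
  sumTo (suc n) f = sumTo n f + f n

  zeroPS onePS : PS
  zeroPS _ = 0#
  onePS zero    = 1#
  onePS (suc _) = 0#

  _⊕_ _⊖_ _⊛_ : PS → PS → PS
  (f ⊕ g) n = f n + g n
  (f ⊖ g) n = f n + - g n
  (f ⊛ g) n = sumTo (suc n) (λ i → f i * g (n ∸ i))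

  powPS : PS → ℕ → PS
  powPS f zero    = onePS
  powPS f (suc k) = f ⊛ powPS f k

  shift : ℕ → PS → PS
  shift zero    f n       = f n
  shift (suc k) f zero    = 0#
  shift (suc k) f (suc n) = shift k f n

  -- inverse of a power series u with u 0 = 1:  u⁻¹ = Σ_k (1 - u)^k,
  -- the n-th coefficient only involving k ≤ n.
  invPS : PS → PS
  invPS u n = sumTo (suc n) (λ k → powPS (onePS ⊖ u) k n)

  sumPS : List PS → PS
  sumPS = foldr _⊕_ zeroPS

  listPS : List Carrier → PS
  listPS []       _       = 0#
  listPS (c ∷ cs) zero    = c
  listPS (c ∷ cs) (suc i) = listPS cs i

  tuples : ℕ → List (List Carrier)
  tuples zero    = [] ∷ []
  tuples (suc d) = concatMap (λ c → map (c ∷_) (tuples d)) elems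

  -- The monic a = θ^d + c_{d-1} θ^{d-1} + … + c_0, encoded by
  -- cs = c_{d-1} ∷ … ∷ c_0, equals θ^d · u_a with
  -- u_a = 1 + c_{d-1} x + … + c_0 x^d.  Hence a^{-s} = x^{ds} (u_a⁻¹)^s and
  -- S_d(s) = Σ_{a ∈ A+, deg a = d} a^{-s} = x^{ds} Σ_cs (u_a⁻¹)^s.
  S : ℕ → ℕ → PS
  S d s = shift (d ℕ.* s) (sumPS (map (λ cs → powPS (invPS (listPS (1# ∷ cs))) s) (tuples d)))

  Zpart : List ℕ → ℕ → PS
  Zpart []       b = onePS
  Zpart (s ∷ ss) b = λ n → sumTo b (λ d → (S d s ⊛ Zpart ss d) n) 

  -- ζ_A(s_1,…,s_r) as the x-adic limit of the partial sums: for s_1 ≥ 1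
  -- the terms with d_1 > n have x-valuation > n, so the n-th coefficient
  -- of ζ_A is that of the partial sum with bound n + 1.
  zetaPS : List ℕ → PS
  zetaPS ss n = Zpart ss (suc n) n

  -- Laurent series x^(-k) f
  record Laurent : Set where
    constructor ⟨_,_⟩
    field
      expo : ℕ
      ser  : PS

  xpow : ℕ → PS
  xpow k = shift k onePS

  _≈L_ : Laurent → Laurent → Set
  ⟨ k , f ⟩ ≈L ⟨ l , g ⟩ = ∀ n → (xpow l ⊛ f) n ≈ (xpow k ⊛ g) n

  _*L_ _-L_ : Laurent → Laurent → Laurent
  ⟨ k , f ⟩ *L ⟨ l , g ⟩ = ⟨ k ℕ.+ l , f ⊛ g ⟩
  ⟨ k , f ⟩ -L ⟨ l , g ⟩ = ⟨ k ℕ.+ l , (xpow l ⊛ f) ⊖ (xpow k ⊛ g) ⟩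

  oneL θL : Laurent
  oneL = ⟨ 0 , onePS ⟩
  θL   = ⟨ 1 , onePS ⟩

  _^L_ : Laurent → ℕ → Laurent
  z ^L zero  = oneL
  z ^L suc k = z *L (z ^L k)

  bracket : ℕ → ℕ → Laurent
  bracket q k = (θL ^L (q ℕ.^ k)) -L θL

  ζA : List ℕ → Laurent
  ζA ss = ⟨ 0 , zetaPS ss ⟩

{-# OPTIONS --safe #-}

-- Let [k] = θ^{q^k} - θ, ℓ_d = (-1)^d [1]⋯[d] and D_d = [d] D_{d-1}^q, and let e_d(z) be the product of
-- z - a over all a of degree < d, so that e_{d+1} = e_d^q - D_d^{q-1} e_d and e_d(θ^d) = D_d.  If ε_d is the
-- linear coefficient of e_d, then ∑ 1/(a - z) = ε_d / (D_d - e_d(z)) over monic a of degree d.  This gives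
-- S_d(k) = ℓ_d^{-k} for 1 ≤ k ≤ q.  Summing over the multiples c a as well, the series
-- 1 + ∑ S_{<d}(k) z^k over the positive multiples k of q - 1 equals ε_d z / e_d(z).
-- Write e_d(z)/ε_d = z + B z^q + Γ z^{q²} + ⋯.  Comparing coefficients and using S(qk) = S(k)^q,
-- S_{<d}((q-1)(q²+1)) = B^{q(q-1)} (B^{q+1} - Γ), and for d = e + 1 this turns S_d(q(q-1)) S_{<d}(q³-q²+q-1)
-- into ℓ_{e+2} / (ℓ_e^{q³} [2] [1]^{q²-q+1}).  The sum of ℓ_{e+2} / ℓ_e^{q³} telescopes after multiplication
-- by [3], and so does the outer sum, because [d+3] = [d]^{q³} + [3] and [d] / ℓ_d = -1 / ℓ_{d-1}.
-- Truncated at d < N + 3, the identity holds up to the single term S_N(q³), which tends to 0.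

module Submission where

open import Defs
open import Level using (0ℓ)
open import Data.Nat as ℕ using (ℕ; zero; suc; z≤n; s≤s)
import Data.Nat.Properties as ℕₚ
import Data.Nat.Solver as ℕSolver
open import Data.Nat.Combinatorics using (_C_; nCn≡1)
open import Data.Integer as ℤ using (ℤ; -[1+_]) renaming (+_ to pos)
import Data.Integer.Properties as ℤₚ
import Data.Sign as Sign
open import Data.Fin as Fin using (Fin; toℕ; inject₁; fromℕ)
import Data.Fin.Properties as Finₚ
open import Data.List using (List; []; _∷_; map; concatMap; _++_; length)
import Data.List.Properties as Listₚ
open import Data.List.Relation.Unary.Any using (Any; here; there)
open import Data.List.Relation.Unary.All as All using (All; []; _∷_)
import Data.List.Relation.Unary.All.Properties as Allₚ
open import Data.List.Relation.Unary.AllPairs as AllPairs using (AllPairs; []; _∷_)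
open import Data.List.Relation.Binary.Pointwise using (Pointwise; []; _∷_)
open import Data.Maybe using (Maybe; just; nothing)
open import Data.Product using (∃; _×_; _,_; proj₁; proj₂)
open import Data.Sum using (inj₁; inj₂; [_,_]′)
open import Data.Empty using (⊥-elim)
open import Function using (_∘_)
open import Relation.Nullary using (Dec; yes; no)
open import Relation.Binary.PropositionalEquality as ≡ using (_≡_)
open import Algebra.Bundles using (CommutativeRing; CommutativeMonoid)
open import Algebra.Morphism.Structures using (module RingMorphisms)
import Algebra.Morphism.Construct.Composition as Composition
open import Algebra.Solver.Ring.AlmostCommutativeRing using (fromCommutativeRing; _-Raw-AlmostCommutative⟶_)

-- `FiniteField` gives a field with q elements but not that q is a prime power, so additivity of z ↦
-- z^q comes from interpolation: a polynomial of degree below q that vanishes on the field has zero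
-- coefficients. The fractions ε_d / e_d(z) and ∑ 1/(a - z) are both instances of one fact: e_d is
-- additive, so its derivative is the constant ε_d, and its logarithmic derivative is ε_d / e_d. The
-- exponents fit together as follows. The last one is (q-1)(q²+1), a multiple of q-1 as the
-- generating series demands, and small enough that e_d enters only through its coefficients at z,
-- z^q and z^{q²}. The middle one, q(q-1), cancels the power of ℓ_d contained in B^{q(q-1)}. The
-- algebra takes place in any algebra R over the field with an element θ and inverses of [k] for k ≥
-- 1 and of the monic polynomials; the generating series are power series over this R. The result
-- there is an exact identity between finite sums, and a limit is taken only once, at the end.

module IntegerSolver (R : CommutativeRing 0ℓ 0ℓ) where
  open CommutativeRing R
  open import Algebra.Properties.Ring ring
  open import Algebra.Properties.AbelianGroup +-abelianGroup using (⁻¹-∙-comm)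
  open import Algebra.Properties.Semiring.Mult.TCOptimised semiring using ()
    renaming (_×_ to _·_; ×-homo-+ to ·-homo-+; ×1-homo-* to ·1-homo-*)
  open import Relation.Binary.Reasoning.Setoid setoid

  -- Coefficients of the solver are integers because equality in the ring need not be decidable.
  -- With the `TCOptimised` multiple, `fromℤ` of one is `1#` by computation, which is why `1-homo`
  -- below is `refl`.
  fromℤ : ℤ → Carrier
  fromℤ (pos n)    = n · 1#
  fromℤ -[1+ n ] = - (suc n · 1#)

  fromℤ-⊖ : ∀ m n → fromℤ (m ℤ.⊖ n) ≈ m · 1# - n · 1#
  fromℤ-⊖ m zero = begin
    fromℤ (m ℤ.⊖ 0)  ≡⟨ ≡.cong fromℤ (ℤₚ.⊖-≥ {m} {0} ℕ.z≤n) ⟩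
    m · 1#           ≈⟨ +-identityʳ _ ⟨
    m · 1# + 0#      ≈⟨ +-congˡ -0#≈0# ⟨
    m · 1# - 0#      ∎
  fromℤ-⊖ zero (suc n) = sym (+-identityˡ _)
  fromℤ-⊖ (suc m) (suc n) = begin
    fromℤ (suc m ℤ.⊖ suc n)            ≡⟨ ≡.cong fromℤ (ℤₚ.[1+m]⊖[1+n]≡m⊖n m n) ⟩
    fromℤ (m ℤ.⊖ n)                    ≈⟨ fromℤ-⊖ m n ⟩
    m · 1# - n · 1#                    ≈⟨ +-congʳ (+-identityˡ _) ⟨
    (0# + m · 1#) - n · 1#             ≈⟨ +-congʳ (+-congʳ (-‿inverseʳ 1#)) ⟨
    (1# - 1# + m · 1#) - n · 1#        ≈⟨ +-congʳ (+-assoc _ _ _) ⟩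
    (1# + (- 1# + m · 1#)) - n · 1#    ≈⟨ +-congʳ (+-congˡ (+-comm _ _)) ⟩
    (1# + (m · 1# - 1#)) - n · 1#      ≈⟨ +-congʳ (+-assoc _ _ _) ⟨
    (1# + m · 1# - 1#) - n · 1#        ≈⟨ +-assoc _ _ _ ⟩
    1# + m · 1# + (- 1# - n · 1#)      ≈⟨ +-congˡ (⁻¹-∙-comm _ _) ⟩
    1# + m · 1# - (1# + n · 1#)        ≈⟨ +-cong (·-homo-+ 1# 1 m) (-‿cong (·-homo-+ 1# 1 n)) ⟨
    suc m · 1# - suc n · 1#            ∎

  fromℤ-+ : ∀ i j → fromℤ (i ℤ.+ j) ≈ fromℤ i + fromℤ j
  fromℤ-+ (pos m)    (pos n)    = ·-homo-+ 1# m n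
  fromℤ-+ (pos m)    -[1+ n ] = fromℤ-⊖ m (suc n)
  fromℤ-+ -[1+ m ] (pos n)    = trans (fromℤ-⊖ n (suc m)) (+-comm _ _)
  fromℤ-+ -[1+ m ] -[1+ n ] = begin
    - (suc (suc (m ℕ.+ n)) · 1#)       ≡⟨ ≡.cong (λ k → - (k · 1#)) (≡.sym (ℕₚ.+-suc (suc m) n)) ⟩
    - ((suc m ℕ.+ suc n) · 1#)         ≈⟨ -‿cong (·-homo-+ 1# (suc m) (suc n)) ⟩
    - (suc m · 1# + suc n · 1#)        ≈⟨ ⁻¹-∙-comm _ _ ⟨
    - (suc m · 1#) - suc n · 1#        ∎

  fromℤ-neg : ∀ i → fromℤ (ℤ.- i) ≈ - fromℤ i
  fromℤ-neg (pos zero)  = sym -0#≈0#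
  fromℤ-neg (pos (suc n)) = refl
  fromℤ-neg -[1+ n ]  = sym (-‿involutive _)

  fromℤ-◃ : ∀ n → fromℤ (Sign.- ℤ.◃ n) ≈ - (n · 1#)
  fromℤ-◃ zero    = sym -0#≈0#
  fromℤ-◃ (suc n) = refl

  fromℤ-◃⁺ : ∀ n → fromℤ (Sign.+ ℤ.◃ n) ≈ n · 1#
  fromℤ-◃⁺ zero    = refl
  fromℤ-◃⁺ (suc n) = refl

  fromℤ-* : ∀ i j → fromℤ (i ℤ.* j) ≈ fromℤ i * fromℤ j
  fromℤ-* (pos m)    (pos n)    = trans (fromℤ-◃⁺ (m ℕ.* n)) (·1-homo-* m n)
  fromℤ-* (pos m)    -[1+ n ] = trans (fromℤ-◃ (m ℕ.* suc n))
    (trans (-‿cong (·1-homo-* m (suc n))) (-‿distribʳ-* _ _))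
  fromℤ-* -[1+ m ] (pos n)    = trans (fromℤ-◃ (suc m ℕ.* n))
    (trans (-‿cong (·1-homo-* (suc m) n)) (-‿distribˡ-* _ _))
  fromℤ-* -[1+ m ] -[1+ n ] = trans (fromℤ-◃⁺ (suc m ℕ.* suc n))
    (trans (·1-homo-* (suc m) (suc n)) (sym (trans (sym (-‿distribˡ-* _ _))
      (trans (-‿cong (sym (-‿distribʳ-* _ _))) (-‿involutive _)))))

  fromℤ-homomorphism : CommutativeRing.rawRing ℤₚ.+-*-commutativeRing -Raw-AlmostCommutative⟶ fromCommutativeRing R
  fromℤ-homomorphism = record
    { ⟦_⟧    = fromℤ
    ; +-homo = fromℤ-+
    ; *-homo = fromℤ-*
    ; -‿homo = fromℤ-neg
    ; 0-homo = refl
    ; 1-homo = refl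
    }

  fromℤ-≟ : ∀ i j → Maybe (fromℤ i ≈ fromℤ j)
  fromℤ-≟ i j with i ℤ.≟ j
  ... | yes ≡.refl = just refl
  ... | no _       = nothing

  open import Algebra.Solver.Ring _ (fromCommutativeRing R) fromℤ-homomorphism fromℤ-≟ public
    using (solve; _:=_; _:+_; _:*_; _:-_; :-_; con)

module RingProperties (R : CommutativeRing 0ℓ 0ℓ) where
  open CommutativeRing R
  open IntegerSolver R
  open import Algebra.Properties.Semiring.Exp semiring
  open import Relation.Binary.Reasoning.Setoid setoid

  1^n≈1 : ∀ n → 1# ^ n ≈ 1#
  1^n≈1 zero    = refl
  1^n≈1 (suc n) = trans (*-identityˡ _) (1^n≈1 n)

  unit-cancelˡ : ∀ {u u⁻¹ a b} → u * u⁻¹ ≈ 1# → u * a ≈ u * b → a ≈ b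
  unit-cancelˡ {u} {u⁻¹} {a} {b} uu⁻¹≈1 eq = begin
    a                ≈⟨ trans (*-congʳ uu⁻¹≈1) (*-identityˡ a) ⟨
    u * u⁻¹ * a      ≈⟨ solve 3 (λ u i a → u :* i :* a := i :* (u :* a)) refl u u⁻¹ a ⟩
    u⁻¹ * (u * a)    ≈⟨ *-congˡ eq ⟩
    u⁻¹ * (u * b)    ≈⟨ solve 3 (λ u i a → i :* (u :* a) := u :* i :* a) refl u u⁻¹ b ⟩
    u * u⁻¹ * b      ≈⟨ trans (*-congʳ uu⁻¹≈1) (*-identityˡ b) ⟩
    b                ∎

-- Sums and products over lists, homomorphisms, binomial expansion

module ListFold (M : CommutativeMonoid 0ℓ 0ℓ) where
  open CommutativeMonoid M
  open import Relation.Binary.Reasoning.Setoid setoid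

  fold : {A : Set} → List A → (A → Carrier) → Carrier
  fold []       f = ε
  fold (x ∷ xs) f = f x ∙ fold xs f

  fold-cong : {A : Set} (xs : List A) {f g : A → Carrier} → (∀ a → f a ≈ g a) → fold xs f ≈ fold xs g
  fold-cong []       eq = refl
  fold-cong (x ∷ xs) eq = ∙-cong (eq x) (fold-cong xs eq)

  fold-cong-All : {A : Set} (xs : List A) {f g : A → Carrier} → All (λ a → f a ≈ g a) xs → fold xs f ≈ fold xs g
  fold-cong-All []       []         = refl
  fold-cong-All (x ∷ xs) (eq ∷ eqs) = ∙-cong eq (fold-cong-All xs eqs)

  fold-++ : {A : Set} (xs ys : List A) (f : A → Carrier) → fold (xs ++ ys) f ≈ fold xs f ∙ fold ys f
  fold-++ []       ys f = sym (identityˡ _)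
  fold-++ (x ∷ xs) ys f = trans (∙-congˡ (fold-++ xs ys f)) (sym (assoc _ _ _))

  fold-map : {A B : Set} (h : A → B) (xs : List A) (f : B → Carrier) → fold (map h xs) f ≡ fold xs (f ∘ h)
  fold-map h []       f = ≡.refl
  fold-map h (x ∷ xs) f = ≡.cong (f (h x) ∙_) (fold-map h xs f)

  fold-concatMap : {A B : Set} (h : A → List B) (xs : List A) (f : B → Carrier) →
    fold (concatMap h xs) f ≈ fold xs (λ a → fold (h a) f)
  fold-concatMap h []       f = refl
  fold-concatMap h (x ∷ xs) f = trans (fold-++ (h x) (concatMap h xs) f) (∙-congˡ (fold-concatMap h xs f))

  fold-∙ : {A : Set} (xs : List A) (f g : A → Carrier) → fold xs (λ a → f a ∙ g a) ≈ fold xs f ∙ fold xs g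
  fold-∙ []       f g = sym (identityˡ _)
  fold-∙ (x ∷ xs) f g = begin
    (f x ∙ g x) ∙ fold xs (λ a → f a ∙ g a)  ≈⟨ ∙-congˡ (fold-∙ xs f g) ⟩
    (f x ∙ g x) ∙ (fold xs f ∙ fold xs g)    ≈⟨ interchange _ _ _ _ ⟩
    (f x ∙ fold xs f) ∙ (g x ∙ fold xs g)    ∎
    where open import Algebra.Properties.CommutativeSemigroup commutativeSemigroup using (interchange)

module ListSum (R : CommutativeRing 0ℓ 0ℓ) where
  open CommutativeRing R
  open ListFold +-commutativeMonoid public
    renaming (fold to ∑; fold-cong to ∑-cong; fold-cong-All to ∑-cong-All; fold-map to ∑-map;
              fold-concatMap to ∑-concatMap; fold-∙ to ∑-+)
  open import Algebra.Properties.Semiring.Mult semiring using () renaming (_×_ to _·_)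

  ∑-*ˡ : {A : Set} (xs : List A) (f : A → Carrier) (c : Carrier) → c * ∑ xs f ≈ ∑ xs (λ a → c * f a)
  ∑-*ˡ []       f c = zeroʳ c
  ∑-*ˡ (x ∷ xs) f c = trans (distribˡ c _ _) (+-congˡ (∑-*ˡ xs f c))

  ∑-*ʳ : {A : Set} (xs : List A) (f : A → Carrier) (c : Carrier) → ∑ xs f * c ≈ ∑ xs (λ a → f a * c)
  ∑-*ʳ xs f c = trans (*-comm _ _) (trans (∑-*ˡ xs f c) (∑-cong xs (λ a → *-comm _ _)))

  ∑-const : {A : Set} (xs : List A) (c : Carrier) → ∑ xs (λ _ → c) ≈ length xs · c
  ∑-const []       c = refl
  ∑-const (x ∷ xs) c = +-congˡ (∑-const xs c)

IsHom : (A B : CommutativeRing 0ℓ 0ℓ) → (CommutativeRing.Carrier A → CommutativeRing.Carrier B) → Set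
IsHom A B = RingMorphisms.IsRingHomomorphism (CommutativeRing.rawRing A) (CommutativeRing.rawRing B)

module Hom (A B : CommutativeRing 0ℓ 0ℓ) {ι : CommutativeRing.Carrier A → CommutativeRing.Carrier B} (ι-hom : IsHom A B ι) where
  private
    module A = CommutativeRing A
    module B = CommutativeRing B
    module ∑A = ListSum A
    module ∑B = ListSum B
  open import Algebra.Properties.Semiring.Exp A.semiring using () renaming (_^_ to _^A_)
  open import Algebra.Properties.Semiring.Exp B.semiring using () renaming (_^_ to _^B_)
  open import Algebra.Properties.Semiring.Mult A.semiring using () renaming (_×_ to _·A_)
  open import Algebra.Properties.Semiring.Mult B.semiring using () renaming (_×_ to _·B_)
  open RingMorphisms.IsRingHomomorphism ι-hom public
    using () renaming (⟦⟧-cong to ι-cong; +-homo to ι-+; *-homo to ι-*; -‿homo to ι-neg; 0#-homo to ι-0; 1#-homo to ι-1)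

  ι-^ : ∀ x n → ι (x ^A n) B.≈ ι x ^B n
  ι-^ x zero    = ι-1
  ι-^ x (suc n) = B.trans (ι-* _ _) (B.*-congˡ (ι-^ x n))

  ι-· : ∀ n x → ι (n ·A x) B.≈ n ·B ι x
  ι-· zero    x = ι-0
  ι-· (suc n) x = B.trans (ι-+ _ _) (B.+-congˡ (ι-· n x))

  ι-∑ : {X : Set} (xs : List X) (f : X → A.Carrier) → ι (∑A.∑ xs f) B.≈ ∑B.∑ xs (ι ∘ f)
  ι-∑ []       f = ι-0
  ι-∑ (x ∷ xs) f = B.trans (ι-+ _ _) (B.+-congˡ (ι-∑ xs f))

id-hom : (A : CommutativeRing 0ℓ 0ℓ) → IsHom A A (λ x → x)
id-hom A = record
  { isSemiringHomomorphism = record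
    { isNearSemiringHomomorphism = record
      { +-isMonoidHomomorphism = record
        { isMagmaHomomorphism = record
          { isRelHomomorphism = record { cong = λ eq → eq } ; homo = λ _ _ → refl }
        ; ε-homo = refl }
      ; *-homo = λ _ _ → refl }
    ; 1#-homo = refl }
  ; -‿homo = λ _ → refl }
  where open CommutativeRing A

module BinomialExpansion (B : CommutativeRing 0ℓ 0ℓ) where
  open CommutativeRing B
  open import Algebra.Properties.CommutativeSemiring.Exp commutativeSemiring
  open import Algebra.Properties.Semiring.Mult semiring using () renaming (_×_ to _·_; ×-congˡ to ·-congˡ; ×-homo-1 to ·-homo-1)
  open import Algebra.Properties.Semiring.Sum semiring using (sum; sum-cong-≋; sum-init-last)
  import Algebra.Properties.CommutativeSemiring.Binomial commutativeSemiring as Binomial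
  open import Relation.Binary.Reasoning.Setoid setoid

  -- The outer terms are split off because for exponent q exactly the inner ones vanish.
  binomial-ends : ∀ n x y → (x + y) ^ suc n ≈
    y ^ suc n + (sum {n} (λ k → (suc n C suc (toℕ k)) · (x ^ suc (toℕ k) * y ^ (n ℕ.∸ toℕ k))) + x ^ suc n)
  binomial-ends n x y = begin
    (x + y) ^ suc n
      ≈⟨ Binomial.theorem (suc n) x y ⟩
    1 · (1# * y ^ suc n) + sum t
      ≈⟨ +-cong (trans (·-homo-1 _) (*-identityˡ _)) (sum-init-last t) ⟩
    y ^ suc n + (sum {n} (t ∘ inject₁) + t (fromℕ n))
      ≈⟨ +-congˡ (+-cong (sum-cong-≋ {n} (λ k → reflexive (≡.cong t′ (Finₚ.toℕ-inject₁ k)))) last) ⟩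
    y ^ suc n + (sum {n} (t′ ∘ toℕ) + x ^ suc n) ∎
    where
    t′ : ℕ → Carrier
    t′ k = (suc n C suc k) · (x ^ suc k * y ^ (n ℕ.∸ k))
    t : Fin (suc n) → Carrier
    t k = t′ (toℕ k)
    last : t (fromℕ n) ≈ x ^ suc n
    last = begin
      t′ (toℕ (fromℕ n))              ≡⟨ ≡.cong t′ (Finₚ.toℕ-fromℕ n) ⟩
      (suc n C suc n) · (x ^ suc n * y ^ (n ℕ.∸ n)) ≈⟨ ·-congˡ (nCn≡1 (suc n)) ⟩
      1 · (x ^ suc n * y ^ (n ℕ.∸ n))  ≈⟨ ·-homo-1 _ ⟩
      x ^ suc n * y ^ (n ℕ.∸ n)        ≡⟨ ≡.cong (λ k → x ^ suc n * y ^ k) (ℕₚ.n∸n≡0 n) ⟩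
      x ^ suc n * 1#                   ≈⟨ *-identityʳ _ ⟩
      x ^ suc n                        ∎

∘-hom : (A B E : CommutativeRing 0ℓ 0ℓ) {f : CommutativeRing.Carrier A → CommutativeRing.Carrier B}
  {g : CommutativeRing.Carrier B → CommutativeRing.Carrier E} → IsHom A B f → IsHom B E g → IsHom A E (g ∘ f)
∘-hom A B E = Composition.isRingHomomorphism (CommutativeRing.trans E)

-- Finite fields: interpolation and permutations of the elements

module FiniteFieldProperties (F : CommutativeRing 0ℓ 0ℓ) (q-1 : ℕ) (Fq : FiniteField F (suc q-1)) where
  open CommutativeRing F
  open FiniteField Fq
  open ListSum F
  open IntegerSolver F
  open RingProperties F
  open import Algebra.Properties.Ring ring
  open import Algebra.Properties.CommutativeSemiring.Exp commutativeSemiring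
  open import Algebra.Properties.Semiring.Mult semiring using () renaming (_×_ to _·_)
  open import Relation.Binary.Reasoning.Setoid setoid
  open import Data.List.Membership.Setoid setoid using (_∈_)
  open import Data.List.Membership.Setoid.Properties using (∈-∃++)
  open import Data.List.Relation.Binary.Permutation.Setoid setoid as Perm using (_↭_; ↭-refl; ↭-sym; ↭-trans; ↭-prep)
  import Data.List.Relation.Binary.Permutation.Setoid.Properties setoid as Permₚ

  private
    q : ℕ
    q = suc q-1

  -- The list positions decide: entries at different positions are distinct, so two elements are
  -- equal exactly when they are found at the same place.
  decide-≈ : ∀ {x y es} → AllPairs _≉_ es → Any (x ≈_) es → Any (y ≈_) es → Dec (x ≈ y)
  decide-≈ _        (here x≈e) (here y≈e) = yes (trans x≈e (sym y≈e))
  decide-≈ (≉s ∷ _) (here x≈e) (there y∈) = no λ x≈y →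
    All.lookupAny ≉s y∈ .proj₁ (trans (sym x≈e) (trans x≈y (All.lookupAny ≉s y∈ .proj₂)))
  decide-≈ (≉s ∷ _) (there x∈) (here y≈e) = no λ x≈y →
    All.lookupAny ≉s x∈ .proj₁ (trans (sym y≈e) (trans (sym x≈y) (All.lookupAny ≉s x∈ .proj₂)))
  decide-≈ (_ ∷ ds) (there x∈) (there y∈) = decide-≈ ds x∈ y∈

  _≟_ : ∀ x y → Dec (x ≈ y)
  x ≟ y = decide-≈ distinct (complete x) (complete y)

  cancelˡ : ∀ {a b} x → x ≉ 0# → x * a ≈ x * b → a ≈ b
  cancelˡ x x≉0 = unit-cancelˡ (proj₂ (inverse x x≉0))

  *-nonzero : ∀ {x y} → x ≉ 0# → y ≉ 0# → (x * y) ≉ 0#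
  *-nonzero {x} x≉0 y≉0 xy≈0 = y≉0 (cancelˡ x x≉0 (trans xy≈0 (sym (zeroʳ x))))

  -- Horner's rule, constant term first; the type `Fin n` of the indices encodes degree below n.
  eval : ∀ {n} → (Fin n → Carrier) → Carrier → Carrier
  eval {zero}  p x = 0#
  eval {suc n} p x = p Fin.zero + x * eval (p ∘ Fin.suc) x

  -- Synthetic division by X - r: coefficient i is the value at r of what remains after dropping the
  -- i + 1 lowest coefficients.
  quotient : ∀ {n} → (Fin (suc n) → Carrier) → Carrier → Fin n → Carrier
  quotient {suc n} p r Fin.zero    = eval (p ∘ Fin.suc) r
  quotient {suc n} p r (Fin.suc i) = quotient (p ∘ Fin.suc) r i

  eval-quotient : ∀ {n} (p : Fin (suc n) → Carrier) x r → eval p x ≈ (x - r) * eval (quotient p r) x + eval p r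
  eval-quotient {zero} p x r = solve 3 (λ a x r → a :+ x :* con (pos 0) := (x :- r) :* con (pos 0) :+ (a :+ r :* con (pos 0)))
    refl (p Fin.zero) x r
  eval-quotient {suc n} p x r = begin
    p Fin.zero + x * eval (p ∘ Fin.suc) x
      ≈⟨ +-congˡ (*-congˡ (eval-quotient (p ∘ Fin.suc) x r)) ⟩
    p Fin.zero + x * ((x - r) * eval (quotient (p ∘ Fin.suc) r) x + eval (p ∘ Fin.suc) r)
      ≈⟨ solve 5 (λ a x r Q E → a :+ x :* ((x :- r) :* Q :+ E) := (x :- r) :* (E :+ x :* Q) :+ (a :+ r :* E)) refl
           (p Fin.zero) x r (eval (quotient (p ∘ Fin.suc) r) x) (eval (p ∘ Fin.suc) r) ⟩
    (x - r) * (eval (p ∘ Fin.suc) r + x * eval (quotient (p ∘ Fin.suc) r) x) + (p Fin.zero + r * eval (p ∘ Fin.suc) r) ∎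

  quotient-zero : ∀ {n} (p : Fin (suc n) → Carrier) r → eval p r ≈ 0# → (∀ i → quotient p r i ≈ 0#) → ∀ i → p i ≈ 0#
  quotient-zero p r pr≈0 q≈0 Fin.zero = begin
    p Fin.zero                                   ≈⟨ +-identityʳ _ ⟨
    p Fin.zero + 0#                              ≈⟨ +-congˡ (zeroʳ r) ⟨
    p Fin.zero + r * 0#                          ≈⟨ +-congˡ (*-congˡ (tail≈0 p q≈0)) ⟨
    p Fin.zero + r * eval (p ∘ Fin.suc) r        ≈⟨ pr≈0 ⟩
    0#                                           ∎
    where
    tail≈0 : ∀ {n} (p : Fin (suc n) → Carrier) → (∀ i → quotient p r i ≈ 0#) → eval (p ∘ Fin.suc) r ≈ 0#
    tail≈0 {zero}  p q≈0 = refl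
    tail≈0 {suc n} p q≈0 = q≈0 Fin.zero
  quotient-zero {suc n} p r pr≈0 q≈0 (Fin.suc i) =
    quotient-zero (p ∘ Fin.suc) r (q≈0 Fin.zero) (q≈0 ∘ Fin.suc) i

  -- Dividing by X - r lowers the length by one, and every other root s stays a root of the quotient
  -- because s - r can be cancelled.
  roots⇒zero : ∀ {n} (p : Fin n → Carrier) rs → AllPairs _≉_ rs → n ℕ.≤ length rs →
    All (λ r → eval p r ≈ 0#) rs → ∀ i → p i ≈ 0#
  roots⇒zero {suc n} p (r ∷ rs) (r≉ ∷ rs≉) (s≤s n≤) (pr≈0 ∷ prs≈0) =
    quotient-zero p r pr≈0 (roots⇒zero (quotient p r) rs rs≉ n≤ (All.zipWith root (r≉ , prs≈0)))
    where
    root : ∀ {s} → (r ≉ s) × (eval p s ≈ 0#) → eval (quotient p r) s ≈ 0#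
    root {s} (r≉s , ps≈0) = cancelˡ (s - r) (λ s-r≈0 → r≉s (sym (x∙y⁻¹≈ε⇒x≈y s r s-r≈0))) (begin
      (s - r) * eval (quotient p r) s              ≈⟨ +-identityʳ _ ⟨
      (s - r) * eval (quotient p r) s + 0#         ≈⟨ +-congˡ pr≈0 ⟨
      (s - r) * eval (quotient p r) s + eval p r   ≈⟨ eval-quotient p s r ⟨
      eval p s                                     ≈⟨ ps≈0 ⟩
      0#                                           ≈⟨ zeroʳ _ ⟨
      (s - r) * 0#                                 ∎)

  vanishing⇒zero : ∀ {n} (p : Fin n → Carrier) → n ℕ.≤ q → (∀ x → eval p x ≈ 0#) → ∀ i → p i ≈ 0#
  vanishing⇒zero p n≤q p≈0 = roots⇒zero p elems distinct (≡.subst (_ ℕ.≤_) (≡.sym card) n≤q) (All.universal p≈0 elems)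

  extract : ∀ {x ys} → x ∈ ys → ∃ λ zs → ys ↭ x ∷ zs
  extract x∈ys with as , bs , w , x≈w , ys≋ ← ∈-∃++ setoid x∈ys =
    as ++ bs , Perm.trans (Perm.refl ys≋) (Permₚ.shift (sym x≈w) as bs)

  -- Pigeonhole: removing from `ys` the partner of x keeps the partners of the later entries, which
  -- differ from x, and the length bound leaves no entry of `ys` over. It turns injective maps of
  -- the field into permutations of its elements.
  distinct-⊆⇒↭ : ∀ xs ys → AllPairs _≉_ xs → All (_∈ ys) xs → length ys ℕ.≤ length xs → xs ↭ ys
  distinct-⊆⇒↭ []       []       _          _            _  = ↭-refl
  distinct-⊆⇒↭ (x ∷ xs) ys (x≉ ∷ xs≉) (x∈ys ∷ xs∈ys) le with zs , ys↭ ← extract x∈ys =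
    ↭-trans (↭-prep x (distinct-⊆⇒↭ xs zs xs≉ (All.zipWith inTail (x≉ , xs∈ys))
      (ℕ.s≤s⁻¹ (≡.subst (ℕ._≤ suc (length xs)) (Permₚ.xs↭ys⇒|xs|≡|ys| ys↭) le)))) (↭-sym ys↭)
    where
    inTail : ∀ {y} → (x ≉ y) × (y ∈ ys) → y ∈ zs
    inTail (x≉y , y∈ys) with Permₚ.∈-resp-↭ ys↭ y∈ys
    ... | here y≈x = ⊥-elim (x≉y (sym y≈x))
    ... | there y∈ = y∈

  module _ (M : CommutativeMonoid 0ℓ 0ℓ) where
    private
      module M = CommutativeMonoid M
    open ListFold M
    open import Algebra.Properties.CommutativeSemigroup M.commutativeSemigroup using () renaming (x∙yz≈y∙xz to swap-front)

    fold-≋ : (f : Carrier → M.Carrier) → (∀ {x y} → x ≈ y → f x M.≈ f y) →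
      ∀ {xs ys} → Pointwise _≈_ xs ys → fold xs f M.≈ fold ys f
    fold-≋ f f-cong []         = M.refl
    fold-≋ f f-cong (eq ∷ eqs) = M.∙-cong (f-cong eq) (fold-≋ f f-cong eqs)

    fold-↭ : (f : Carrier → M.Carrier) → (∀ {x y} → x ≈ y → f x M.≈ f y) →
      ∀ {xs ys} → xs ↭ ys → fold xs f M.≈ fold ys f
    fold-↭ f f-cong (Perm.refl eqs)    = fold-≋ f f-cong eqs
    fold-↭ f f-cong (Perm.prep eq p)   = M.∙-cong (f-cong eq) (fold-↭ f f-cong p)
    fold-↭ f f-cong (Perm.swap {xs} {ys} {x} {y} {x′} {y′} eq₁ eq₂ p) =
      M.trans (M.∙-cong (f-cong eq₁) (M.∙-cong (f-cong eq₂) (fold-↭ f f-cong p))) (swap-front _ _ _)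
    fold-↭ f f-cong (Perm.trans p₁ p₂) = M.trans (fold-↭ f f-cong p₁) (fold-↭ f f-cong p₂)

  map-↭ : (h : Carrier → Carrier) (ys : List Carrier) → AllPairs _≉_ ys → (∀ {x y} → h x ≈ h y → x ≈ y) →
    All (λ y → h y ∈ ys) ys → map h ys ↭ ys
  map-↭ h ys ys≉ h-inj h∈ = distinct-⊆⇒↭ (map h ys) ys (maps ys≉) (Allₚ.map⁺ h∈)
    (ℕₚ.≤-reflexive (≡.sym (Listₚ.length-map h ys)))
    where
    maps : ∀ {ys} → AllPairs _≉_ ys → AllPairs _≉_ (map h ys)
    maps []         = []
    maps (y≉ ∷ ys≉) = Allₚ.map⁺ (All.map (_∘ h-inj) y≉) ∷ maps ys≉

  private
    nonzero-split : ∃ λ zs → elems ↭ 0# ∷ zs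
    nonzero-split = extract (complete 0#)

    units : List Carrier
    units = proj₁ nonzero-split

    0∷units-distinct : AllPairs _≉_ (0# ∷ units)
    0∷units-distinct = Permₚ.Unique-resp-↭ (proj₂ nonzero-split) distinct

    units-length : length units ≡ q-1
    units-length = ℕₚ.suc-injective (≡.trans (≡.sym (Permₚ.xs↭ys⇒|xs|≡|ys| (proj₂ nonzero-split))) card)

    units-nonzero : All (_≉ 0#) units
    units-nonzero with 0≉ ∷ _ ← 0∷units-distinct = All.map (λ 0≉x x≈0 → 0≉x (sym x≈0)) 0≉

    units-complete : ∀ {x} → x ≉ 0# → x ∈ units
    units-complete {x} x≉0 with Permₚ.∈-resp-↭ (proj₂ nonzero-split) (complete x)
    ... | here x≈0 = ⊥-elim (x≉0 x≈0)
    ... | there x∈ = x∈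

    open ListFold *-commutativeMonoid using () renaming (fold to ∏; fold-map to ∏-map)

    ∏-nonzero : ∀ {xs} → All (_≉ 0#) xs → ∏ xs (λ x → x) ≉ 0#
    ∏-nonzero []         = nontrivial
    ∏-nonzero (x≉ ∷ xs≉) = *-nonzero x≉ (∏-nonzero xs≉)

    ∏-scale : ∀ c xs → ∏ xs (c *_) ≈ c ^ length xs * ∏ xs (λ x → x)
    ∏-scale c []       = sym (*-identityˡ 1#)
    ∏-scale c (x ∷ xs) = trans (*-congˡ (∏-scale c xs))
      (solve 4 (λ c x p r → c :* x :* (p :* r) := c :* p :* (x :* r)) refl c x _ _)

  ∑-elems-↭ : (h f : Carrier → Carrier) → (∀ {x y} → h x ≈ h y → x ≈ y) → (∀ {x y} → x ≈ y → f x ≈ f y) →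
    ∑ elems (f ∘ h) ≈ ∑ elems f
  ∑-elems-↭ h f h-inj f-cong = trans (reflexive (≡.sym (∑-map h elems f)))
    (fold-↭ +-commutativeMonoid f f-cong (map-↭ h elems distinct h-inj (All.universal (λ y → complete (h y)) elems)))

  -- Multiplication by c permutes the units, so it leaves their product unchanged while multiplying
  -- it by c^{q-1}.
  unit^[q-1]≈1 : ∀ {c} → c ≉ 0# → c ^ q-1 ≈ 1#
  unit^[q-1]≈1 {c} c≉0 = cancelˡ _ (∏-nonzero units-nonzero) (begin
    ∏ units (λ x → x) * c ^ q-1            ≈⟨ *-comm _ _ ⟩
    c ^ q-1 * ∏ units (λ x → x)            ≡⟨ ≡.cong (λ n → c ^ n * ∏ units (λ x → x)) (≡.sym units-length) ⟩
    c ^ length units * ∏ units (λ x → x)   ≈⟨ ∏-scale c units ⟨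
    ∏ units (c *_)                         ≡⟨ ≡.sym (∏-map (c *_) units (λ x → x)) ⟩
    ∏ (map (c *_) units) (λ x → x)         ≈⟨ fold-↭ *-commutativeMonoid (λ x → x) (λ eq → eq)
         (map-↭ (c *_) units (AllPairs.tail 0∷units-distinct) (cancelˡ c c≉0)
           (All.map (λ x≉0 → units-complete (*-nonzero c≉0 x≉0)) units-nonzero)) ⟩
    ∏ units (λ x → x)                      ≈⟨ *-identityʳ _ ⟨
    ∏ units (λ x → x) * 1#                 ∎)

  c^q≈c : ∀ c → c ^ q ≈ c
  c^q≈c c with c ≟ 0#
  ... | yes c≈0 = trans (*-congʳ c≈0) (trans (zeroˡ _) (sym c≈0))
  ... | no c≉0  = trans (*-congˡ (unit^[q-1]≈1 c≉0)) (*-identityʳ c)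

  -- Translation by 1 permutes the elements, so their sum does not change although every summand
  -- grows by 1.
  q·1≈0 : q · 1# ≈ 0#
  q·1≈0 = +-cancelʳ (∑ elems (λ x → x)) _ _ (begin
    q · 1# + ∑ elems (λ x → x)                ≡⟨ ≡.cong (λ n → n · 1# + ∑ elems (λ x → x)) (≡.sym card) ⟩
    length elems · 1# + ∑ elems (λ x → x)     ≈⟨ +-congʳ (∑-const elems 1#) ⟨
    ∑ elems (λ _ → 1#) + ∑ elems (λ x → x)    ≈⟨ ∑-+ elems _ _ ⟨
    ∑ elems (λ x → 1# + x)                    ≈⟨ ∑-elems-↭ (1# +_) (λ x → x) (λ {x} {y} → +-cancelˡ 1# x y) (λ eq → eq) ⟩
    ∑ elems (λ x → x)                         ≈⟨ +-identityˡ _ ⟨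
    0# + ∑ elems (λ x → x)                    ∎)

  [q-1]·1≈-1 : q-1 · 1# ≈ - 1#
  [q-1]·1≈-1 = begin
    q-1 · 1#                  ≈⟨ solve 2 (λ a b → a := :- b :+ (b :+ a)) refl _ _ ⟩
    - 1# + (1# + q-1 · 1#)    ≈⟨ +-congˡ q·1≈0 ⟩
    - 1# + 0#                 ≈⟨ +-identityʳ _ ⟩
    - 1#                      ∎

  -- Each of the q-1 units contributes 1; positivity of the exponent makes the summand of zero
  -- vanish.
  ∑c^[q-1] : 0 ℕ.< q-1 → ∑ elems (_^ q-1) ≈ - 1#
  ∑c^[q-1] (s≤s {n = q-2} _) = begin
    ∑ elems (_^ q-1)                   ≈⟨ fold-↭ +-commutativeMonoid (_^ q-1) (^-congˡ q-1) (proj₂ nonzero-split) ⟩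
    0# ^ q-1 + ∑ units (_^ q-1)        ≈⟨ +-cong (zeroˡ _) (∑-cong-All units (All.map unit^[q-1]≈1 units-nonzero)) ⟩
    0# + ∑ units (λ _ → 1#)            ≈⟨ +-identityˡ _ ⟩
    ∑ units (λ _ → 1#)                 ≈⟨ ∑-const units 1# ⟩
    length units · 1#                  ≡⟨ ≡.cong (_· 1#) units-length ⟩
    q-1 · 1#                           ≈⟨ [q-1]·1≈-1 ⟩
    - 1#                               ∎

-- The ring of formal power series

module PowerSeries (R : CommutativeRing 0ℓ 0ℓ) (es : List (CommutativeRing.Carrier R)) where
  open CommutativeRing R
  open Series R es
  open IntegerSolver R
  open import Algebra.Properties.CommutativeSemiring.Exp commutativeSemiring
  open import Algebra.Properties.Ring ring using (-0#≈0#)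
  open import Relation.Binary.Reasoning.Setoid setoid

  sumTo-cong< : ∀ n {f g : PS} → (∀ i → i ℕ.< n → f i ≈ g i) → sumTo n f ≈ sumTo n g
  sumTo-cong< zero    eq = refl
  sumTo-cong< (suc n) eq = +-cong (sumTo-cong< n (λ i i<n → eq i (ℕₚ.m<n⇒m<1+n i<n))) (eq n (ℕₚ.n<1+n n))

  sumTo-cong : ∀ n {f g : PS} → (∀ i → f i ≈ g i) → sumTo n f ≈ sumTo n g
  sumTo-cong n eq = sumTo-cong< n (λ i _ → eq i)

  sumTo-front : ∀ n (f : PS) → sumTo (suc n) f ≈ f 0 + sumTo n (f ∘ suc)
  sumTo-front zero    f = +-comm _ _
  sumTo-front (suc n) f = trans (+-congʳ (sumTo-front n f)) (+-assoc _ _ _)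

  sumTo-+ : ∀ n (f g : PS) → sumTo n (λ i → f i + g i) ≈ sumTo n f + sumTo n g
  sumTo-+ zero    f g = sym (+-identityˡ 0#)
  sumTo-+ (suc n) f g = trans (+-congʳ (sumTo-+ n f g))
    (solve 4 (λ a b c d → (a :+ b) :+ (c :+ d) := (a :+ c) :+ (b :+ d)) refl _ _ _ _)

  sumTo-0 : ∀ n → sumTo n (λ _ → 0#) ≈ 0#
  sumTo-0 zero    = refl
  sumTo-0 (suc n) = trans (+-identityʳ _) (sumTo-0 n)

  sumTo-*ˡ : ∀ n c (f : PS) → c * sumTo n f ≈ sumTo n (λ i → c * f i)
  sumTo-*ˡ zero    c f = zeroʳ c
  sumTo-*ˡ (suc n) c f = trans (distribˡ _ _ _) (+-congʳ (sumTo-*ˡ n c f))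

  infix 4 _≋_
  _≋_ : PS → PS → Set
  f ≋ g = ∀ n → f n ≈ g n

  ⊛-local : ∀ n {f f′ g g′ : PS} → (∀ i → i ℕ.≤ n → f i ≈ f′ i) → (∀ i → i ℕ.≤ n → g i ≈ g′ i) → (f ⊛ g) n ≈ (f′ ⊛ g′) n
  ⊛-local n f≈ g≈ = sumTo-cong< (suc n) (λ i i<1+n → *-cong (f≈ i (ℕ.s≤s⁻¹ i<1+n)) (g≈ (n ℕ.∸ i) (ℕₚ.m∸n≤m n i)))

  ⊛-cong : ∀ {f f′ g g′} → f ≋ f′ → g ≋ g′ → f ⊛ g ≋ f′ ⊛ g′
  ⊛-cong f≈ g≈ n = ⊛-local n (λ i _ → f≈ i) (λ i _ → g≈ i)

  ⊛-zero : ∀ f g → (f ⊛ g) 0 ≈ f 0 * g 0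
  ⊛-zero f g = +-identityˡ _

  ⊛-sucˡ : ∀ f g n → (f ⊛ g) (suc n) ≈ f 0 * g (suc n) + ((f ∘ suc) ⊛ g) n
  ⊛-sucˡ f g n = sumTo-front (suc n) (λ i → f i * g (suc n ℕ.∸ i))

  ⊛-sucʳ : ∀ f g n → (f ⊛ g) (suc n) ≈ f (suc n) * g 0 + (f ⊛ (g ∘ suc)) n
  ⊛-sucʳ f g zero = begin
    (f ⊛ g) 1                               ≈⟨ ⊛-sucˡ f g 0 ⟩
    f 0 * g 1 + ((f ∘ suc) ⊛ g) 0           ≈⟨ +-congˡ (⊛-zero (f ∘ suc) g) ⟩
    f 0 * g 1 + f 1 * g 0                   ≈⟨ +-comm _ _ ⟩
    f 1 * g 0 + f 0 * g 1                   ≈⟨ +-congˡ (⊛-zero f (g ∘ suc)) ⟨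
    f 1 * g 0 + (f ⊛ (g ∘ suc)) 0           ∎
  ⊛-sucʳ f g (suc n) = begin
    (f ⊛ g) (suc (suc n))                                                            ≈⟨ ⊛-sucˡ f g (suc n) ⟩
    f 0 * g (suc (suc n)) + ((f ∘ suc) ⊛ g) (suc n)                                  ≈⟨ +-congˡ (⊛-sucʳ (f ∘ suc) g n) ⟩
    f 0 * g (suc (suc n)) + (f (suc (suc n)) * g 0 + ((f ∘ suc) ⊛ (g ∘ suc)) n)
      ≈⟨ solve 3 (λ a b c → a :+ (b :+ c) := b :+ (a :+ c)) refl _ _ _ ⟩
    f (suc (suc n)) * g 0 + (f 0 * g (suc (suc n)) + ((f ∘ suc) ⊛ (g ∘ suc)) n)      ≈⟨ +-congˡ (⊛-sucˡ f (g ∘ suc) n) ⟨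
    f (suc (suc n)) * g 0 + (f ⊛ (g ∘ suc)) (suc n)                                  ∎

  ⊛-comm : ∀ f g → f ⊛ g ≋ g ⊛ f
  ⊛-comm f g zero    = trans (⊛-zero f g) (trans (*-comm _ _) (sym (⊛-zero g f)))
  ⊛-comm f g (suc n) = begin
    (f ⊛ g) (suc n)                          ≈⟨ ⊛-sucˡ f g n ⟩
    f 0 * g (suc n) + ((f ∘ suc) ⊛ g) n      ≈⟨ +-cong (*-comm _ _) (⊛-comm (f ∘ suc) g n) ⟩
    g (suc n) * f 0 + (g ⊛ (f ∘ suc)) n      ≈⟨ ⊛-sucʳ g f n ⟨
    (g ⊛ f) (suc n)                          ∎

  ⊛-distribʳ : ∀ h f g → (f ⊕ g) ⊛ h ≋ (f ⊛ h) ⊕ (g ⊛ h)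
  ⊛-distribʳ h f g n = trans (sumTo-cong (suc n) (λ i → distribʳ _ _ _)) (sumTo-+ (suc n) _ _)

  ⊛-distribˡ : ∀ h f g → h ⊛ (f ⊕ g) ≋ (h ⊛ f) ⊕ (h ⊛ g)
  ⊛-distribˡ h f g n = trans (sumTo-cong (suc n) (λ i → distribˡ _ _ _)) (sumTo-+ (suc n) _ _)

  scale-⊛ : ∀ c f g → (λ i → c * f i) ⊛ g ≋ (λ n → c * (f ⊛ g) n)
  scale-⊛ c f g n = trans (sumTo-cong (suc n) (λ i → *-assoc _ _ _)) (sym (sumTo-*ˡ (suc n) c _))

  -- Induction on the degree for all f at once: by `⊛-sucˡ`, the shifted product of f and g is f 0
  -- times the shifted g plus the product of the shifted f with g.
  ⊛-assoc : ∀ f g h → (f ⊛ g) ⊛ h ≋ f ⊛ (g ⊛ h)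
  ⊛-assoc f g h zero = begin
    ((f ⊛ g) ⊛ h) 0      ≈⟨ trans (⊛-zero (f ⊛ g) h) (*-congʳ (⊛-zero f g)) ⟩
    f 0 * g 0 * h 0      ≈⟨ *-assoc _ _ _ ⟩
    f 0 * (g 0 * h 0)    ≈⟨ trans (⊛-zero f (g ⊛ h)) (*-congˡ (⊛-zero g h)) ⟨
    (f ⊛ (g ⊛ h)) 0      ∎
  ⊛-assoc f g h (suc n) = begin
    ((f ⊛ g) ⊛ h) (suc n)
      ≈⟨ ⊛-sucˡ (f ⊛ g) h n ⟩
    (f ⊛ g) 0 * h (suc n) + (((f ⊛ g) ∘ suc) ⊛ h) n
      ≈⟨ +-cong (*-congʳ (⊛-zero f g)) (⊛-cong {g = h} (⊛-sucˡ f g) (λ _ → refl) n) ⟩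
    f 0 * g 0 * h (suc n) + (((λ i → f 0 * g (suc i)) ⊕ ((f ∘ suc) ⊛ g)) ⊛ h) n
      ≈⟨ +-congˡ (trans (⊛-distribʳ h (λ i → f 0 * g (suc i)) ((f ∘ suc) ⊛ g) n) (+-cong (scale-⊛ (f 0) (g ∘ suc) h n) (⊛-assoc (f ∘ suc) g h n))) ⟩
    f 0 * g 0 * h (suc n) + (f 0 * ((g ∘ suc) ⊛ h) n + ((f ∘ suc) ⊛ (g ⊛ h)) n)
      ≈⟨ solve 5 (λ f g h x y → f :* g :* h :+ (f :* x :+ y) := f :* (g :* h :+ x) :+ y) refl _ _ _ _ _ ⟩
    f 0 * (g 0 * h (suc n) + ((g ∘ suc) ⊛ h) n) + ((f ∘ suc) ⊛ (g ⊛ h)) n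
      ≈⟨ +-congʳ (*-congˡ (⊛-sucˡ g h n)) ⟨
    f 0 * (g ⊛ h) (suc n) + ((f ∘ suc) ⊛ (g ⊛ h)) n
      ≈⟨ ⊛-sucˡ f (g ⊛ h) n ⟨
    (f ⊛ (g ⊛ h)) (suc n) ∎

  zeroPS-⊛ : ∀ f → zeroPS ⊛ f ≋ zeroPS
  zeroPS-⊛ f n = trans (sumTo-cong (suc n) (λ i → zeroˡ _)) (sumTo-0 (suc n))

  const : Carrier → PS
  const c zero    = c
  const c (suc _) = 0#

  const-⊛ : ∀ c f → const c ⊛ f ≋ (λ n → c * f n)
  const-⊛ c f zero    = ⊛-zero (const c) f
  const-⊛ c f (suc n) = trans (⊛-sucˡ (const c) f n) (trans (+-congˡ (zeroPS-⊛ f n)) (+-identityʳ _))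

  onePS≋const : onePS ≋ const 1#
  onePS≋const zero    = refl
  onePS≋const (suc n) = refl

  ⊛-identityˡ : ∀ f → onePS ⊛ f ≋ f
  ⊛-identityˡ f n = trans (⊛-cong {g = f} onePS≋const (λ _ → refl) n) (trans (const-⊛ 1# f n) (*-identityˡ _))

  ring-PS : CommutativeRing 0ℓ 0ℓ
  ring-PS = record
    { Carrier = PS
    ; _≈_ = _≋_
    ; _+_ = _⊕_
    ; _*_ = _⊛_
    ; -_ = λ f n → - f n
    ; 0# = zeroPS
    ; 1# = onePS
    ; isCommutativeRing = record
      { isRing = record
        { +-isAbelianGroup = record
          { isGroup = record
            { isMonoid = record
              { isSemigroup = record
                { isMagma = record
                  { isEquivalence = record
                    { refl = λ _ → refl ; sym = λ p n → sym (p n) ; trans = λ p r n → trans (p n) (r n) }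
                  ; ∙-cong = λ p r n → +-cong (p n) (r n) }
                ; assoc = λ f g h n → +-assoc _ _ _ }
              ; identity = (λ f n → +-identityˡ _) , (λ f n → +-identityʳ _) }
            ; inverse = (λ f n → -‿inverseˡ _) , (λ f n → -‿inverseʳ _)
            ; ⁻¹-cong = λ p n → -‿cong (p n) }
          ; comm = λ f g n → +-comm _ _ }
        ; *-cong = λ {f} {f′} {g} {g′} → ⊛-cong {f} {f′} {g} {g′}
        ; *-assoc = ⊛-assoc
        ; *-identity = ⊛-identityˡ , (λ f n → trans (⊛-comm f onePS n) (⊛-identityˡ f n))
        ; distrib = ⊛-distribˡ , ⊛-distribʳ }
      ; *-comm = ⊛-comm } }

  private
    module P = CommutativeRing ring-PS
  open import Algebra.Properties.CommutativeSemiring.Exp P.commutativeSemiring using () renaming (_^_ to _^P_)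

  powPS≡^ : ∀ f n → powPS f n ≡ f ^P n
  powPS≡^ f zero    = ≡.refl
  powPS≡^ f (suc n) = ≡.cong (f ⊛_) (powPS≡^ f n)

  const-hom : IsHom R ring-PS const
  const-hom = record
    { isSemiringHomomorphism = record
      { isNearSemiringHomomorphism = record
        { +-isMonoidHomomorphism = record
          { isMagmaHomomorphism = record
            { isRelHomomorphism = record { cong = λ { eq zero → eq ; eq (suc n) → refl } }
            ; homo = λ { x y zero → refl ; x y (suc n) → sym (+-identityˡ 0#) } }
          ; ε-homo = λ { zero → refl ; (suc n) → refl } }
        ; *-homo = λ { x y zero → sym (⊛-zero (const x) (const y))
                     ; x y (suc n) → sym (trans (const-⊛ x (const y) (suc n)) (zeroʳ x)) } }
      ; 1#-homo = λ { zero → refl ; (suc n) → refl } }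
    ; -‿homo = λ { x zero → refl ; x (suc n) → sym -0#≈0# } }

  x : PS
  x = shift 1 onePS

  x-⊛-zero : ∀ f → (x ⊛ f) 0 ≈ 0#
  x-⊛-zero f = trans (⊛-zero x f) (zeroˡ _)

  x-⊛-suc : ∀ f n → (x ⊛ f) (suc n) ≈ f n
  x-⊛-suc f n = trans (⊛-sucˡ x f n) (trans (+-cong (zeroˡ _) (⊛-identityˡ f n)) (+-identityˡ _))

  shift-suc : ∀ k f → shift (suc k) f ≋ x ⊛ shift k f
  shift-suc k f zero    = sym (x-⊛-zero (shift k f))
  shift-suc k f (suc n) = sym (x-⊛-suc (shift k f) n)

  shift≋x^ : ∀ k f → shift k f ≋ (x ^P k) ⊛ f
  shift≋x^ zero    f n = sym (⊛-identityˡ f n)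
  shift≋x^ (suc k) f = P.trans (shift-suc k f) (P.trans (P.*-congˡ {x} (shift≋x^ k f)) (P.sym (P.*-assoc x (x ^P k) f)))

  xpow≋x^ : ∀ k → xpow k ≋ x ^P k
  xpow≋x^ k = P.trans (shift≋x^ k onePS) (P.*-identityʳ (x ^P k))

  shift-< : ∀ k f n → n ℕ.< k → shift k f n ≈ 0#
  shift-< (suc k) f zero    _       = refl
  shift-< (suc k) f (suc n) (s≤s p) = shift-< k f n p

  shift-≥ : ∀ k f n → shift k f (k ℕ.+ n) ≈ f n
  shift-≥ zero    f n = refl
  shift-≥ (suc k) f n = shift-≥ k f n

  x^-⊛-< : ∀ k f n → n ℕ.< k → ((x ^P k) ⊛ f) n ≈ 0#
  x^-⊛-< k f n n<k = trans (sym (shift≋x^ k f n)) (shift-< k f n n<k)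

  x^-⊛-≥ : ∀ k f n → ((x ^P k) ⊛ f) (k ℕ.+ n) ≈ f n
  x^-⊛-≥ k f n = trans (sym (shift≋x^ k f (k ℕ.+ n))) (shift-≥ k f n)

  pow-order : ∀ v → v 0 ≈ 0# → ∀ k n → n ℕ.< k → (v ^P k) n ≈ 0#
  pow-order v v0 (suc k) zero    _       = trans (⊛-zero v (v ^P k)) (trans (*-congʳ v0) (zeroˡ _))
  pow-order v v0 (suc k) (suc n) (s≤s p) = begin
    (v ⊛ (v ^P k)) (suc n)                                   ≈⟨ ⊛-sucˡ v (v ^P k) n ⟩
    v 0 * (v ^P k) (suc n) + ((v ∘ suc) ⊛ (v ^P k)) n        ≈⟨ +-cong (trans (*-congʳ v0) (zeroˡ _))
      (⊛-local n {f = v ∘ suc} (λ _ _ → refl) (λ i i≤n → pow-order v v0 k i (ℕₚ.≤-<-trans i≤n p))) ⟩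
    0# + ((v ∘ suc) ⊛ zeroPS) n                              ≈⟨ +-identityˡ _ ⟩
    ((v ∘ suc) ⊛ zeroPS) n                                   ≈⟨ ⊛-comm (v ∘ suc) zeroPS n ⟩
    (zeroPS ⊛ (v ∘ suc)) n                                   ≈⟨ zeroPS-⊛ (v ∘ suc) n ⟩
    0#                                                       ∎

  -- With v = 1 - u, the finite geometric sum satisfies u (1 + v + ... + v^{N-1}) = 1 - v^N. Since
  -- v^k has order at least k, `invPS u` agrees with the sum for N = n + 1 up to degree n
  -- (`stable`), and v^{n+1} does not reach that degree.
  invPS-inverse : ∀ u → u 0 ≈ 1# → u ⊛ invPS u ≋ onePS
  invPS-inverse u u0 n = begin
    (u ⊛ invPS u) n                  ≈⟨ ⊛-local n {f = u} (λ _ _ → refl) (λ i i≤n → stable i i≤n) ⟩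
    (u ⊛ geo (suc n)) n              ≈⟨ geo-sum (suc n) n ⟩
    onePS n - (v ^P suc n) n         ≈⟨ +-congˡ (trans (-‿cong (pow-order v v0 (suc n) n (ℕₚ.n<1+n n))) -0#≈0#) ⟩
    onePS n + 0#                     ≈⟨ +-identityʳ _ ⟩
    onePS n                          ∎
    where
    module PS = IntegerSolver ring-PS
    v : PS
    v = onePS ⊖ u
    v0 : v 0 ≈ 0#
    v0 = trans (+-congˡ (-‿cong u0)) (-‿inverseʳ 1#)
    geo : ℕ → PS
    geo N n = sumTo N (λ k → powPS v k n)
    geo-sum : ∀ N → (u ⊛ geo N) ≋ (onePS ⊖ (v ^P N))
    geo-sum zero    = P.trans (P.zeroʳ u) (P.sym (P.-‿inverseʳ onePS))
    geo-sum (suc N) = P.trans (⊛-distribˡ u (geo N) (powPS v N)) (P.trans (P.+-cong (geo-sum N) (P.reflexive (≡.cong (u ⊛_) (powPS≡^ v N))))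
      (PS.solve 2 (λ u p → (PS.con (pos 1) PS.:- p) PS.:+ u PS.:* p PS.:= PS.con (pos 1) PS.:- (PS.con (pos 1) PS.:- u) PS.:* p) P.refl u (v ^P N)))
    stable : ∀ i {N} → i ℕ.≤ N → invPS u i ≈ geo (suc N) i
    stable i {N} i≤N with ℕₚ.m≤n⇒m<n∨m≡n i≤N
    ... | inj₂ ≡.refl = refl
    stable i {suc N} i≤N | inj₁ (s≤s i≤N′) = trans (stable i i≤N′)
      (sym (trans (+-congˡ (trans (reflexive (≡.cong (λ f → f i) (powPS≡^ v (suc N)))) (pow-order v v0 (suc N) i (s≤s i≤N′)))) (+-identityʳ _)))

  -- This is the expansion of 1 / (a - c x), where i is the inverse of a.
  geometric : ∀ a i c → a * i ≈ 1# → (λ k → c ^ k * i ^ suc k) ⊛ (const a ⊖ (const c ⊛ x)) ≋ onePS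
  geometric a i c ai≈1 = P.trans (⊛-comm g _) coefficients
    where
    g : PS
    g k = c ^ k * i ^ suc k
    expand : (const a ⊖ (const c ⊛ x)) ⊛ g ≋ (λ n → a * g n + - (c * (x ⊛ g) n))
    expand = P.trans (⊛-distribʳ g (const a) (P.- (const c ⊛ x)))
      (P.+-cong (const-⊛ a g) (P.trans (P.sym (-‿distribˡ-* (const c ⊛ x) g))
        (P.-‿cong (P.trans (⊛-assoc (const c) x g) (const-⊛ c (x ⊛ g))))))
      where open import Algebra.Properties.Ring P.ring using (-‿distribˡ-*)
    coefficients : (const a ⊖ (const c ⊛ x)) ⊛ g ≋ onePS
    coefficients zero = begin
      ((const a ⊖ (const c ⊛ x)) ⊛ g) 0                ≈⟨ expand 0 ⟩
      a * (1# * (i * 1#)) + - (c * (x ⊛ g) 0)          ≈⟨ +-congˡ (-‿cong (*-congˡ (x-⊛-zero g))) ⟩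
      a * (1# * (i * 1#)) + - (c * 0#)                 ≈⟨ solve 3 (λ a i c → a :* (con (pos 1) :* (i :* con (pos 1))) :+ :- (c :* con (pos 0)) := a :* i) refl a i c ⟩
      a * i                                            ≈⟨ ai≈1 ⟩
      1#                                               ∎
    coefficients (suc n) = begin
      ((const a ⊖ (const c ⊛ x)) ⊛ g) (suc n)          ≈⟨ expand (suc n) ⟩
      a * (c * c ^ n * (i * i ^ suc n)) + - (c * (x ⊛ g) (suc n))   ≈⟨ +-congˡ (-‿cong (*-congˡ (x-⊛-suc g n))) ⟩
      a * (c * c ^ n * (i * i ^ suc n)) + - (c * (c ^ n * i ^ suc n))
        ≈⟨ solve 5 (λ a c p i r → a :* (c :* p :* (i :* r)) :+ :- (c :* (p :* r)) := (a :* i) :* (c :* p :* r) :- c :* p :* r) refl a c _ i _ ⟩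
      a * i * (c * c ^ n * i ^ suc n) - c * c ^ n * i ^ suc n  ≈⟨ +-congʳ (trans (*-congʳ ai≈1) (*-identityˡ _)) ⟩
      c * c ^ n * i ^ suc n - c * c ^ n * i ^ suc n    ≈⟨ -‿inverseʳ _ ⟩
      0#                                               ∎

-- (k , f) stands for f / X k, as in the Laurent series of the statement.
module Fractions (P : CommutativeRing 0ℓ 0ℓ) (X : ℕ → CommutativeRing.Carrier P)
    (X-0 : CommutativeRing._≈_ P (X 0) (CommutativeRing.1# P))
    (X-+ : ∀ k l → CommutativeRing._≈_ P (X (k ℕ.+ l)) (CommutativeRing._*_ P (X k) (X l)))
    (X-cancel : ∀ k f g → CommutativeRing._≈_ P (CommutativeRing._*_ P (X k) f) (CommutativeRing._*_ P (X k) g) →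
      CommutativeRing._≈_ P f g) where
  open CommutativeRing P
  open IntegerSolver P
  open import Relation.Binary.Reasoning.Setoid setoid

  Frac : Set
  Frac = ℕ × Carrier

  infix 4 _≃_
  _≃_ : Frac → Frac → Set
  (k , f) ≃ (l , g) = X l * f ≈ X k * g

  _+′_ _*′_ _-′_ : Frac → Frac → Frac
  (k , f) +′ (l , g) = k ℕ.+ l , X l * f + X k * g
  (k , f) *′ (l , g) = k ℕ.+ l , f * g
  (k , f) -′ (l , g) = k ℕ.+ l , X l * f - X k * g

  -′_ : Frac → Frac
  -′ (k , f) = k , - f

  -- Eliminating the middle fraction leaves its denominator as a common factor, and `X-cancel`
  -- removes it.
  ≃-trans : ∀ a b c → a ≃ b → b ≃ c → a ≃ c
  ≃-trans (k , f) (l , g) (m , h) p r = X-cancel l _ _ (begin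
    X l * (X m * f)  ≈⟨ solve 3 (λ a b c → a :* (b :* c) := b :* (a :* c)) refl _ _ _ ⟩
    X m * (X l * f)  ≈⟨ *-congˡ p ⟩
    X m * (X k * g)  ≈⟨ solve 3 (λ a b c → a :* (b :* c) := b :* (a :* c)) refl _ _ _ ⟩
    X k * (X m * g)  ≈⟨ *-congˡ r ⟩
    X k * (X l * h)  ≈⟨ solve 3 (λ a b c → a :* (b :* c) := b :* (a :* c)) refl _ _ _ ⟩
    X l * (X k * h)  ∎)

  +′-cong : ∀ a a′ b b′ → a ≃ a′ → b ≃ b′ → (a +′ b) ≃ (a′ +′ b′)
  +′-cong (k , f) (k′ , f′) (l , g) (l′ , g′) p r = begin
    X (k′ ℕ.+ l′) * (X l * f + X k * g)           ≈⟨ *-congʳ (X-+ k′ l′) ⟩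
    X k′ * X l′ * (X l * f + X k * g)             ≈⟨ solve 6 (λ k′ l′ l f k g → k′ :* l′ :* (l :* f :+ k :* g) := l′ :* l :* (k′ :* f) :+ k′ :* k :* (l′ :* g)) refl _ _ _ _ _ _ ⟩
    X l′ * X l * (X k′ * f) + X k′ * X k * (X l′ * g)  ≈⟨ +-cong (*-congˡ p) (*-congˡ r) ⟩
    X l′ * X l * (X k * f′) + X k′ * X k * (X l * g′)  ≈⟨ solve 6 (λ k′ l′ l f k g → l′ :* l :* (k :* f) :+ k′ :* k :* (l :* g) := k :* l :* (l′ :* f :+ k′ :* g)) refl _ _ _ _ _ _ ⟩
    X k * X l * (X l′ * f′ + X k′ * g′)           ≈⟨ *-congʳ (X-+ k l) ⟨
    X (k ℕ.+ l) * (X l′ * f′ + X k′ * g′)         ∎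

  *′-cong : ∀ a a′ b b′ → a ≃ a′ → b ≃ b′ → (a *′ b) ≃ (a′ *′ b′)
  *′-cong (k , f) (k′ , f′) (l , g) (l′ , g′) p r = begin
    X (k′ ℕ.+ l′) * (f * g)        ≈⟨ *-congʳ (X-+ k′ l′) ⟩
    X k′ * X l′ * (f * g)          ≈⟨ solve 4 (λ a b c d → a :* b :* (c :* d) := a :* c :* (b :* d)) refl _ _ _ _ ⟩
    X k′ * f * (X l′ * g)          ≈⟨ *-cong p r ⟩
    X k * f′ * (X l * g′)          ≈⟨ solve 4 (λ a b c d → a :* b :* (c :* d) := a :* c :* (b :* d)) refl _ _ _ _ ⟩
    X k * X l * (f′ * g′)          ≈⟨ *-congʳ (X-+ k l) ⟨
    X (k ℕ.+ l) * (f′ * g′)        ∎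

  ≃-same : ∀ {k l f g} → k ≡ l → f ≈ g → (k , f) ≃ (l , g)
  ≃-same ≡.refl p = *-congˡ p

  X-0* : ∀ f → X 0 * f ≈ f
  X-0* f = trans (*-congʳ X-0) (*-identityˡ f)

  +′-assoc : ∀ a b c → ((a +′ b) +′ c) ≃ (a +′ (b +′ c))
  +′-assoc (k , f) (l , g) (m , h) = ≃-same (ℕₚ.+-assoc k l m) (begin
    X m * (X l * f + X k * g) + X (k ℕ.+ l) * h         ≈⟨ +-congˡ (*-congʳ (X-+ k l)) ⟩
    X m * (X l * f + X k * g) + X k * X l * h           ≈⟨ solve 6 (λ k l m f g h → m :* (l :* f :+ k :* g) :+ k :* l :* h := l :* m :* f :+ k :* (m :* g :+ l :* h)) refl _ _ _ _ _ _ ⟩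
    X l * X m * f + X k * (X m * g + X l * h)           ≈⟨ +-congʳ (*-congʳ (X-+ l m)) ⟨
    X (l ℕ.+ m) * f + X k * (X m * g + X l * h)         ∎)

  distribʳ′ : ∀ a b c → ((b +′ c) *′ a) ≃ ((b *′ a) +′ (c *′ a))
  distribʳ′ (m , h) (k , f) (l , g) = begin
    X (k ℕ.+ m ℕ.+ (l ℕ.+ m)) * ((X l * f + X k * g) * h)
      ≈⟨ *-congʳ (trans (X-+ (k ℕ.+ m) (l ℕ.+ m)) (*-cong (X-+ k m) (X-+ l m))) ⟩
    X k * X m * (X l * X m) * ((X l * f + X k * g) * h)
      ≈⟨ solve 6 (λ k l m f g h → k :* m :* (l :* m) :* ((l :* f :+ k :* g) :* h) := k :* l :* m :* (l :* m :* (f :* h) :+ k :* m :* (g :* h))) refl _ _ _ _ _ _ ⟩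
    X k * X l * X m * (X l * X m * (f * h) + X k * X m * (g * h))
      ≈⟨ *-cong (trans (X-+ (k ℕ.+ l) m) (*-congʳ (X-+ k l))) (+-cong (*-congʳ (X-+ l m)) (*-congʳ (X-+ k m))) ⟨
    X (k ℕ.+ l ℕ.+ m) * (X (l ℕ.+ m) * (f * h) + X (k ℕ.+ m) * (g * h)) ∎

  *′-comm : ∀ a b → (a *′ b) ≃ (b *′ a)
  *′-comm (k , f) (l , g) = ≃-same (ℕₚ.+-comm k l) (*-comm f g)

  +′-comm : ∀ a b → (a +′ b) ≃ (b +′ a)
  +′-comm (k , f) (l , g) = ≃-same (ℕₚ.+-comm k l) (+-comm _ _)

  +′-identityˡ : ∀ a → ((0 , 0#) +′ a) ≃ a
  +′-identityˡ (k , f) = ≃-same ≡.refl (trans (+-cong (zeroʳ _) (X-0* f)) (+-identityˡ f))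

  *′-identityˡ : ∀ a → ((0 , 1#) *′ a) ≃ a
  *′-identityˡ (k , f) = ≃-same ≡.refl (*-identityˡ f)

  -′-inverseˡ : ∀ a → ((-′ a) +′ a) ≃ (0 , 0#)
  -′-inverseˡ (k , f) = trans (X-0* _) (trans (solve 2 (λ x f → x :* :- f :+ x :* f := con (pos 0)) refl _ _) (sym (zeroʳ _)))

  ring-Frac : CommutativeRing 0ℓ 0ℓ
  ring-Frac = record
    { Carrier = Frac
    ; _≈_ = _≃_
    ; _+_ = _+′_
    ; _*_ = _*′_
    ; -_ = -′_
    ; 0# = 0 , 0#
    ; 1# = 0 , 1#
    ; isCommutativeRing = record
      { isRing = record
        { +-isAbelianGroup = record
          { isGroup = record
            { isMonoid = record
              { isSemigroup = record
                { isMagma = record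
                  { isEquivalence = record
                    { refl = refl ; sym = λ p → sym p ; trans = λ {a} {b} {c} → ≃-trans a b c }
                  ; ∙-cong = λ {a} {a′} {b} {b′} → +′-cong a a′ b b′ }
                ; assoc = +′-assoc }
              ; identity = +′-identityˡ , (λ a → ≃-trans (a +′ (0 , 0#)) ((0 , 0#) +′ a) a (+′-comm a (0 , 0#)) (+′-identityˡ a)) }
            ; inverse = -′-inverseˡ , (λ a → ≃-trans (a +′ (-′ a)) ((-′ a) +′ a) (0 , 0#) (+′-comm a (-′ a)) (-′-inverseˡ a))
            ; ⁻¹-cong = λ {a} {b} → neg-cong a b }
          ; comm = +′-comm }
        ; *-cong = λ {a} {a′} {b} {b′} → *′-cong a a′ b b′
        ; *-assoc = λ { (k , f) (l , g) (m , h) → ≃-same (ℕₚ.+-assoc k l m) (*-assoc f g h) }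
        ; *-identity = *′-identityˡ , (λ a → ≃-trans (a *′ (0 , 1#)) ((0 , 1#) *′ a) a (*′-comm a (0 , 1#)) (*′-identityˡ a))
        ; distrib = (λ a b c → ≃-trans (a *′ (b +′ c)) ((b +′ c) *′ a) ((a *′ b) +′ (a *′ c)) (*′-comm a (b +′ c))
                      (≃-trans ((b +′ c) *′ a) ((b *′ a) +′ (c *′ a)) ((a *′ b) +′ (a *′ c)) (distribʳ′ a b c)
                        (+′-cong (b *′ a) (a *′ b) (c *′ a) (a *′ c) (*′-comm b a) (*′-comm c a))))
                    , distribʳ′ }
      ; *-comm = *′-comm } }
    where
    neg-cong : ∀ a b → a ≃ b → (-′ a) ≃ (-′ b)
    neg-cong (k , f) (l , g) p = trans (sym (-‿distribʳ-* _ _)) (trans (-‿cong p) (-‿distribʳ-* _ _))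
      where open import Algebra.Properties.Ring ring using (-‿distribʳ-*)

  embed : Carrier → Frac
  embed f = 0 , f

  embed-hom : IsHom P ring-Frac embed
  embed-hom = record
    { isSemiringHomomorphism = record
      { isNearSemiringHomomorphism = record
        { +-isMonoidHomomorphism = record
          { isMagmaHomomorphism = record
            { isRelHomomorphism = record { cong = λ eq → *-congˡ eq }
            ; homo = λ f g → *-congˡ (sym (+-cong (X-0* f) (X-0* g))) }
          ; ε-homo = refl }
        ; *-homo = λ _ _ → refl }
      ; 1#-homo = refl }
    ; -‿homo = λ _ → refl }

  -′≃+-′ : ∀ a b → (a -′ b) ≃ (a +′ (-′ b))
  -′≃+-′ (k , f) (l , g) = *-congˡ (+-congˡ (-‿distribʳ-* (X k) g))
    where open import Algebra.Properties.Ring ring using (-‿distribʳ-*)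

-- Laurent series and passage to the limit

module LaurentSeries (F : CommutativeRing 0ℓ 0ℓ) (es : List (CommutativeRing.Carrier F)) where
  open CommutativeRing F using (_≈_; refl; sym; trans; +-cong; +-identityʳ)
  open Series F es
  open PowerSeries F es
  private
    module P = CommutativeRing ring-PS
  open import Algebra.Properties.CommutativeSemiring.Exp P.commutativeSemiring using () renaming (_^_ to _^P_; ^-homo-* to ^P-homo-*)

  xpow-+ : ∀ k l → xpow (k ℕ.+ l) ≋ xpow k ⊛ xpow l
  xpow-+ k l = P.trans (xpow≋x^ (k ℕ.+ l)) (P.trans (^P-homo-* x k l) (P.sym (P.*-cong {xpow k} {x ^P k} {xpow l} {x ^P l} (xpow≋x^ k) (xpow≋x^ l))))

  xpow-cancel : ∀ k f g → xpow k ⊛ f ≋ xpow k ⊛ g → f ≋ g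
  xpow-cancel k f g eq n = trans (sym (at f)) (trans (eq (k ℕ.+ n)) (at g))
    where
    at : ∀ f → (xpow k ⊛ f) (k ℕ.+ n) ≈ f n
    at f = trans (P.*-congʳ {f} {xpow k} {x ^P k} (xpow≋x^ k) (k ℕ.+ n)) (x^-⊛-≥ k f n)

  open Fractions ring-PS xpow P.refl xpow-+ xpow-cancel public

  private
    module L = CommutativeRing ring-Frac
  open import Algebra.Properties.CommutativeSemiring.Exp L.commutativeSemiring using () renaming (_^_ to _^Frac_)

  toFrac : Laurent → Frac
  toFrac ⟨ k , f ⟩ = k , f

  toFrac-^ : ∀ z n → toFrac (z ^L n) ≡ toFrac z ^Frac n
  toFrac-^ z zero    = ≡.refl
  toFrac-^ z (suc n) = ≡.cong (toFrac z *′_) (toFrac-^ z n)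

  toFrac-sub : ∀ y z → toFrac (y -L z) L.≈ toFrac y L.- toFrac z
  toFrac-sub y z = -′≃+-′ (toFrac y) (toFrac z)

  ξ*θ≈1 : (embed x *′ toFrac θL) L.≈ L.1#
  ξ*θ≈1 = P.trans (P.*-identityˡ (x ⊛ onePS)) (P.*-congʳ {onePS} {x} {xpow 1} P.refl)

  infix 4 _≈[≤_]_
  _≈[≤_]_ : PS → ℕ → PS → Set
  f ≈[≤ n ] g = ∀ i → i ℕ.≤ n → f i ≈ g i

  ⊛-local≤ : ∀ n {f f′ g g′ : PS} → f ≈[≤ n ] f′ → g ≈[≤ n ] g′ → f ⊛ g ≈[≤ n ] f′ ⊛ g′
  ⊛-local≤ n f≈ g≈ i i≤n = ⊛-local i (λ j j≤i → f≈ j (ℕₚ.≤-trans j≤i i≤n)) (λ j j≤i → g≈ j (ℕₚ.≤-trans j≤i i≤n))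

  -- Multiplying by a power series, in particular by a power of x, preserves agreement up to degree
  -- n. The fixed fractions a and b contribute only such factors once the equation is
  -- cross-multiplied, so its coefficient n can be read off from the n-th approximation.
  limit : (f g : PS) (a b : Frac) →
    (∀ n → ∃ λ fₙ → ∃ λ gₙ → ∃ λ δₙ → (f ≈[≤ n ] fₙ) × (g ≈[≤ n ] gₙ) × (δₙ ≈[≤ n ] zeroPS) ×
      (embed fₙ *′ a) L.≈ ((b *′ embed gₙ) +′ embed δₙ)) →
    (embed f *′ a) L.≈ (b *′ embed g)
  limit f g (k , u) (l , v) approx n with approx n
  ... | fₙ , gₙ , δₙ , f≈ , g≈ , δ≈ , eq = trans (⊛-local≤ n {xpow (l ℕ.+ 0)} (λ _ _ → refl) (⊛-local≤ n {g = u} f≈ (λ _ _ → refl)) n ℕₚ.≤-refl)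
    (trans (reflexive′ (≡.cong (λ m → (xpow m ⊛ (fₙ ⊛ u)) n) (≡.sym (ℕₚ.+-identityʳ (l ℕ.+ 0)))))
    (trans (eq n) (⊛-local≤ n {xpow k} (λ _ _ → refl) numerator n ℕₚ.≤-refl)))
    where
    reflexive′ = CommutativeRing.reflexive F
    numerator : ((onePS ⊛ (v ⊛ gₙ)) ⊕ (xpow (l ℕ.+ 0) ⊛ δₙ)) ≈[≤ n ] (v ⊛ g)
    numerator i i≤n = trans (+-cong
        (trans (P.*-identityˡ (v ⊛ gₙ) i) (⊛-local≤ n {v} (λ _ _ → refl) (λ j j≤n → sym (g≈ j j≤n)) i i≤n))
        (trans (⊛-local≤ n {xpow (l ℕ.+ 0)} (λ _ _ → refl) δ≈ i i≤n) (P.zeroʳ (xpow (l ℕ.+ 0)) i)))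
      (+-identityʳ _)

-- The q-power map on algebras over the finite field

module FqAlgebra (F : CommutativeRing 0ℓ 0ℓ) (q-1 : ℕ) (Fq : FiniteField F (suc q-1)) (0<q-1 : 0 ℕ.< q-1) where
  module F where
    open CommutativeRing F public
    open FiniteField Fq public
    open FiniteFieldProperties F q-1 Fq public
    open import Algebra.Properties.CommutativeSemiring.Exp commutativeSemiring public
    open import Algebra.Properties.Ring ring public using (-‿involutive; -0#≈0#)
    open import Algebra.Properties.Semiring.Mult semiring public using () renaming (_×_ to _·_; ×-congˡ to ·-congˡ; ×-congʳ to ·-congʳ; ×-homo-1 to ·-homo-1; ×-assoc-* to ·-assoc-*; ×-comm-* to ·-comm-*)
    open import Algebra.Properties.Semiring.Sum semiring public using (sum; sum-cong-≋; *-distribˡ-sum)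
    open ListSum F public
    open RingProperties F public

  private
    q : ℕ
    q = suc q-1

  open Series F F.elems using (tuples)

  eval≈sum : ∀ {n} (p : Fin n → F.Carrier) x → F.eval p x F.≈ F.sum (λ k → p k F.* x F.^ toℕ k)
  eval≈sum {zero}  p x = F.refl
  eval≈sum {suc n} p x = F.+-cong (F.sym (F.*-identityʳ _)) (F.trans (F.*-congˡ (eval≈sum (p ∘ Fin.suc) x))
    (F.trans (F.*-distribˡ-sum {n} x _) (F.sum-cong-≋ {n} (λ k →
      solve 3 (λ x p r → x :* (p :* r) := p :* (x :* r)) F.refl x (p (Fin.suc k)) (x F.^ toℕ k)))))
    where open IntegerSolver F

  -- The polynomial (x+1)^q - x^q - 1 has degree below q, and it vanishes on the whole field because
  -- c^q = c there. Its coefficients, the inner binomial coefficients, are therefore zero in the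
  -- field.
  qCk·1≈0 : ∀ (k : Fin q-1) → (q C suc (toℕ k)) F.· F.1# F.≈ F.0#
  qCk·1≈0 k = F.vanishing⇒zero p ℕₚ.≤-refl vanish (Fin.suc k)
    where
    open F
    open import Relation.Binary.Reasoning.Setoid setoid
    open IntegerSolver F
    p : Fin q → Carrier
    p Fin.zero    = 0#
    p (Fin.suc k) = (q C suc (toℕ k)) · 1#
    E : Carrier → Carrier
    E x = sum {q-1} (λ k → (q C suc (toℕ k)) · (x ^ suc (toℕ k) * 1# ^ (q-1 ℕ.∸ toℕ k)))
    expand : ∀ x → E x ≈ x * eval (p ∘ Fin.suc) x
    expand x = sym (trans (*-congˡ (eval≈sum (p ∘ Fin.suc) x)) (trans (*-distribˡ-sum {q-1} x _) (sum-cong-≋ {q-1} (λ k → begin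
      x * ((q C suc (toℕ k)) · 1# * x ^ toℕ k)         ≈⟨ *-congˡ (·-assoc-* (q C suc (toℕ k)) _ _) ⟩
      x * ((q C suc (toℕ k)) · (1# * x ^ toℕ k))       ≈⟨ ·-comm-* (q C suc (toℕ k)) _ _ ⟩
      (q C suc (toℕ k)) · (x * (1# * x ^ toℕ k))       ≈⟨ ·-congʳ (q C suc (toℕ k)) (trans (*-congˡ (*-identityˡ _))
                                                            (trans (sym (*-identityʳ _)) (*-congˡ (sym (1^n≈1 (q-1 ℕ.∸ toℕ k)))))) ⟩
      (q C suc (toℕ k)) · (x ^ suc (toℕ k) * 1# ^ (q-1 ℕ.∸ toℕ k)) ∎))))
    vanish : ∀ x → eval p x ≈ 0#
    vanish x = begin
      0# + x * eval (p ∘ Fin.suc) x  ≈⟨ +-congˡ (expand x) ⟨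
      0# + E x                       ≈⟨ solve 3 (λ e a b → con (pos 0) :+ e := (a :+ (e :+ b)) :- (b :+ a)) refl _ (1# ^ q) (x ^ q) ⟩
      (1# ^ q + (E x + x ^ q)) - (x ^ q + 1# ^ q)   ≈⟨ +-cong (BinomialExpansion.binomial-ends F q-1 x 1#) (-‿cong (+-cong (sym (c^q≈c x)) (sym (1^n≈1 q)))) ⟨
      (x + 1#) ^ q - (x + 1#)        ≈⟨ +-congʳ (c^q≈c (x + 1#)) ⟩
      (x + 1#) - (x + 1#)            ≈⟨ -‿inverseʳ _ ⟩
      0#                             ∎

  -- The coefficient of y ^ k in ∑_c (y + c) ^ (q - 1).
  coeff : Fin q → F.Carrier
  coeff k = F.∑ F.elems (λ c → (q-1 C toℕ k) F.· c F.^ (q-1 ℕ.∸ toℕ k))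

  module PowerSum (B : CommutativeRing 0ℓ 0ℓ) (ι : F.Carrier → CommutativeRing.Carrier B) (ι-hom : IsHom F B ι) where
    open CommutativeRing B
    open ListSum B
    open Hom F B ι-hom
    open IntegerSolver B
    open import Algebra.Properties.CommutativeSemiring.Exp commutativeSemiring
    open import Algebra.Properties.Semiring.Mult semiring using () renaming (_×_ to _·_; ×-congʳ to ·-congʳ; ×-assoc-* to ·-assoc-*)
    open import Algebra.Properties.Semiring.Sum semiring using (sum; sum-cong-≋; sum-replicate-zero; ∑-distrib-+)
    import Algebra.Properties.CommutativeSemiring.Binomial commutativeSemiring as Binomial
    open import Relation.Binary.Reasoning.Setoid setoid

    ∑-sum : {A : Set} (xs : List A) → ∀ {n} (f : A → Fin n → Carrier) → ∑ xs (λ a → sum (f a)) ≈ sum (λ k → ∑ xs (λ a → f a k))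
    ∑-sum []       {n} f = sym (sum-replicate-zero n)
    ∑-sum (x ∷ xs) f = trans (+-congˡ (∑-sum xs f)) (sym (∑-distrib-+ (f x) (λ k → ∑ xs (λ a → f a k))))

    expansion : ∀ y D → ∑ F.elems (λ c → (y + ι c * D) ^ q-1) ≈ sum {q} (λ k → ι (coeff k) * (y ^ toℕ k * D ^ (q-1 ℕ.∸ toℕ k)))
    expansion y D = begin
      ∑ F.elems (λ c → (y + ι c * D) ^ q-1)        ≈⟨ ∑-cong F.elems (λ c → Binomial.theorem q-1 y (ι c * D)) ⟩
      ∑ F.elems (λ c → sum {q} (λ k → (q-1 C toℕ k) · (y ^ toℕ k * (ι c * D) ^ (q-1 ℕ.∸ toℕ k)))) ≈⟨ ∑-sum F.elems {q} (λ c k → (q-1 C toℕ k) · (y ^ toℕ k * (ι c * D) ^ (q-1 ℕ.∸ toℕ k))) ⟩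
      sum {q} (λ k → ∑ F.elems (λ c → (q-1 C toℕ k) · (y ^ toℕ k * (ι c * D) ^ (q-1 ℕ.∸ toℕ k)))) ≈⟨ sum-cong-≋ {q} (λ k → term (toℕ k) (q-1 C toℕ k) (q-1 ℕ.∸ toℕ k)) ⟩
      sum {q} (λ k → ι (coeff k) * (y ^ toℕ k * D ^ (q-1 ℕ.∸ toℕ k))) ∎
      where
      term : ∀ k b m → ∑ F.elems (λ c → b · (y ^ k * (ι c * D) ^ m)) ≈
                       ι (F.∑ F.elems (λ c → b F.· c F.^ m)) * (y ^ k * D ^ m)
      term k b m = sym (begin
        ι (F.∑ F.elems (λ c → b F.· c F.^ m)) * (y ^ k * D ^ m)   ≈⟨ *-congʳ (ι-∑ F.elems _) ⟩
        ∑ F.elems (λ c → ι (b F.· c F.^ m)) * (y ^ k * D ^ m)     ≈⟨ ∑-*ʳ F.elems _ _ ⟩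
        ∑ F.elems (λ c → ι (b F.· c F.^ m) * (y ^ k * D ^ m))     ≈⟨ ∑-cong F.elems (λ c → begin
          ι (b F.· c F.^ m) * (y ^ k * D ^ m)      ≈⟨ *-congʳ (trans (ι-· b _) (·-congʳ b (ι-^ c m))) ⟩
          b · (ι c ^ m) * (y ^ k * D ^ m)          ≈⟨ ·-assoc-* b _ _ ⟩
          b · (ι c ^ m * (y ^ k * D ^ m))          ≈⟨ ·-congʳ b (solve 3 (λ c y d → c :* (y :* d) := y :* (c :* d)) refl _ _ _) ⟩
          b · (y ^ k * (ι c ^ m * D ^ m))          ≈⟨ ·-congʳ b (*-congˡ (^-distrib-* (ι c) D m)) ⟨
          b · (y ^ k * (ι c * D) ^ m)              ∎) ⟩
        ∑ F.elems (λ c → b · (y ^ k * (ι c * D) ^ m)) ∎)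

  coeff-zero : coeff Fin.zero F.≈ F.- F.1#
  coeff-zero = F.trans (F.∑-cong F.elems (λ c → F.·-homo-1 _)) (F.∑c^[q-1] 0<q-1)

  -- A translation by x only permutes the summands of ∑ (x + c)^{q-1}, so this polynomial in x takes
  -- a constant value on the field. Its degree is below q, hence it equals its constant term.
  coeff-suc : ∀ k → coeff (Fin.suc k) F.≈ F.0#
  coeff-suc k = vanishing⇒zero p ℕₚ.≤-refl vanish (Fin.suc k)
    where
    open F
    open import Relation.Binary.Reasoning.Setoid setoid
    open IntegerSolver F
    p : Fin q → Carrier
    p Fin.zero    = 0#
    p (Fin.suc k) = coeff (Fin.suc k)
    total : ∀ x → eval coeff x ≈ - 1#
    total x = begin
      eval coeff x                        ≈⟨ eval≈sum coeff x ⟩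
      sum {q} (λ k → coeff k * x ^ toℕ k)     ≈⟨ sum-cong-≋ {q} (λ k → *-congˡ {coeff k} (sym (trans (*-congˡ (1^n≈1 (q-1 ℕ.∸ toℕ k))) (*-identityʳ (x ^ toℕ k))))) ⟩
      sum {q} (λ k → coeff k * (x ^ toℕ k * 1# ^ (q-1 ℕ.∸ toℕ k))) ≈⟨ PowerSum.expansion F (λ x → x) (id-hom F) x 1# ⟨
      ∑ elems (λ c → (x + c * 1#) ^ q-1)  ≈⟨ ∑-cong elems (λ c → ^-congˡ q-1 (+-congˡ {x} (*-identityʳ c))) ⟩
      ∑ elems (λ c → (x + c) ^ q-1)       ≈⟨ ∑-elems-↭ (x +_) (_^ q-1) (λ {a} {b} → +-cancelˡ x a b) (^-congˡ q-1) ⟩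
      ∑ elems (_^ q-1)                    ≈⟨ ∑c^[q-1] 0<q-1 ⟩
      - 1#                                ∎
      where open import Algebra.Properties.Ring ring using (+-cancelˡ)
    vanish : ∀ x → eval p x ≈ 0#
    vanish x = begin
      0# + x * eval (coeff ∘ Fin.suc) x                        ≈⟨ solve 2 (λ a b → con (pos 0) :+ a := (b :+ a) :- b) refl _ (coeff Fin.zero) ⟩
      eval coeff x - coeff Fin.zero                            ≈⟨ +-cong (total x) (-‿cong coeff-zero) ⟩
      - 1# - (- 1#)                                            ≈⟨ -‿inverseʳ _ ⟩
      0#                                                       ∎

  module Frobenius (B : CommutativeRing 0ℓ 0ℓ) (ι : F.Carrier → CommutativeRing.Carrier B) (ι-hom : IsHom F B ι) where
    open CommutativeRing B
    open ListSum B
    open Hom F B ι-hom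
    open IntegerSolver B
    open RingProperties B
    open import Algebra.Properties.CommutativeSemiring.Exp commutativeSemiring
    open import Algebra.Properties.Ring ring using (+-cancelˡ)
    open import Algebra.Properties.Semiring.Mult semiring using () renaming (_×_ to _·_; ×-congʳ to ·-congʳ; ×-assoc-* to ·-assoc-*)
    open import Algebra.Properties.Semiring.Sum semiring using (sum; sum-cong-≋; sum-replicate-zero)
    open import Relation.Binary.Reasoning.Setoid setoid

    φ : Carrier → Carrier
    φ x = x ^ q

    φ-cong : ∀ {x y} → x ≈ y → φ x ≈ φ y
    φ-cong = ^-congˡ q

    φ-* : ∀ x y → φ (x * y) ≈ φ x * φ y
    φ-* x y = ^-distrib-* x y q

    φ-+ : ∀ x y → φ (x + y) ≈ φ x + φ y
    φ-+ x y = begin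
      (x + y) ^ q                  ≈⟨ BinomialExpansion.binomial-ends B q-1 x y ⟩
      y ^ q + (sum {q-1} (λ k → (q C suc (toℕ k)) · (x ^ suc (toℕ k) * y ^ (q-1 ℕ.∸ toℕ k))) + x ^ q)
        ≈⟨ +-congˡ (+-congʳ (trans (sum-cong-≋ {q-1} (λ k → begin
          (q C suc (toℕ k)) · m k                ≈⟨ ·-congʳ (q C suc (toℕ k)) (*-identityˡ _) ⟨
          (q C suc (toℕ k)) · (1# * m k)         ≈⟨ ·-assoc-* (q C suc (toℕ k)) 1# (m k) ⟨
          (q C suc (toℕ k)) · 1# * m k           ≈⟨ *-congʳ (·-congʳ (q C suc (toℕ k)) ι-1) ⟨
          (q C suc (toℕ k)) · ι F.1# * m k       ≈⟨ *-congʳ (ι-· (q C suc (toℕ k)) F.1#) ⟨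
          ι ((q C suc (toℕ k)) F.· F.1#) * m k   ≈⟨ *-congʳ (trans (ι-cong (qCk·1≈0 k)) ι-0) ⟩
          0# * m k                               ≈⟨ zeroˡ _ ⟩
          0#                                     ∎)) (sum-replicate-zero q-1))) ⟩
      y ^ q + (0# + x ^ q)         ≈⟨ solve 2 (λ x y → y :+ (con (pos 0) :+ x) := x :+ y) refl _ _ ⟩
      x ^ q + y ^ q                ∎
      where
      m : Fin q-1 → Carrier
      m k = x ^ suc (toℕ k) * y ^ (q-1 ℕ.∸ toℕ k)

    φ-0 : φ 0# ≈ 0#
    φ-0 = zeroˡ _

    φ-1 : φ 1# ≈ 1#
    φ-1 = 1^n≈1 q

    φ-neg : ∀ x → φ (- x) ≈ - φ x
    φ-neg x = +-cancelˡ (φ x) _ _ (begin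
      φ x + φ (- x)  ≈⟨ φ-+ x (- x) ⟨
      φ (x - x)      ≈⟨ φ-cong (-‿inverseʳ x) ⟩
      φ 0#           ≈⟨ φ-0 ⟩
      0#             ≈⟨ -‿inverseʳ _ ⟨
      φ x - φ x      ∎)

    φ-sub : ∀ x y → φ (x - y) ≈ φ x - φ y
    φ-sub x y = trans (φ-+ x (- y)) (+-congˡ (φ-neg y))

    φ-∑ : {A : Set} (xs : List A) (f : A → Carrier) → φ (∑ xs f) ≈ ∑ xs (φ ∘ f)
    φ-∑ []       f = φ-0
    φ-∑ (x ∷ xs) f = trans (φ-+ _ _) (+-congˡ (φ-∑ xs f))

    φ-ι : ∀ c → φ (ι c) ≈ ι c
    φ-ι c = trans (sym (ι-^ c q)) (ι-cong (F.c^q≈c c))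

    ∑-const-elems : ∀ x → ∑ F.elems (λ _ → x) ≈ 0#
    ∑-const-elems x = begin
      ∑ F.elems (λ _ → x)              ≈⟨ ∑-cong F.elems (λ _ → *-identityˡ x) ⟨
      ∑ F.elems (λ _ → 1# * x)         ≈⟨ ∑-*ʳ F.elems (λ _ → 1#) x ⟨
      ∑ F.elems (λ _ → 1#) * x         ≈⟨ *-congʳ (∑-const F.elems 1#) ⟩
      length F.elems · 1# * x          ≡⟨ ≡.cong (λ n → n · 1# * x) F.card ⟩
      q · 1# * x                       ≈⟨ *-congʳ (·-congʳ q ι-1) ⟨
      q · ι F.1# * x                   ≈⟨ *-congʳ (ι-· q F.1#) ⟨
      ι (q F.· F.1#) * x               ≈⟨ *-congʳ (trans (ι-cong F.q·1≈0) ι-0) ⟩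
      0# * x                           ≈⟨ zeroˡ x ⟩
      0#                               ∎

    ∑-[y+cD]^[q-1] : ∀ y D → ∑ F.elems (λ c → (y + ι c * D) ^ q-1) ≈ - (D ^ q-1)
    ∑-[y+cD]^[q-1] y D = begin
      ∑ F.elems (λ c → (y + ι c * D) ^ q-1)
        ≈⟨ PowerSum.expansion B ι ι-hom y D ⟩
      ι (coeff Fin.zero) * (1# * D ^ q-1) + sum {q-1} (λ k → ι (coeff (Fin.suc k)) * _)
        ≈⟨ +-cong (*-congʳ (trans (ι-cong coeff-zero) (trans (ι-neg F.1#) (-‿cong ι-1))))
             (trans (sum-cong-≋ {q-1} (λ k → trans (*-congʳ (trans (ι-cong (coeff-suc k)) ι-0)) (zeroˡ _))) (sum-replicate-zero q-1)) ⟩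
      - 1# * (1# * D ^ q-1) + 0#
        ≈⟨ solve 1 (λ d → :- con (pos 1) :* (con (pos 1) :* d) :+ con (pos 0) := :- d) refl _ ⟩
      - (D ^ q-1) ∎

    -- The element -1 is a unit of the field, so its power q-1 is 1 whatever the parity of q.
    neg-^[q-1] : ∀ y → (- y) ^ q-1 ≈ y ^ q-1
    neg-^[q-1] y = begin
      (- y) ^ q-1                       ≈⟨ ^-congˡ q-1 (trans (*-congʳ (trans (ι-neg F.1#) (-‿cong ι-1))) (solve 1 (λ y → :- con (pos 1) :* y := :- y) refl y)) ⟨
      (ι (F.- F.1#) * y) ^ q-1          ≈⟨ ^-distrib-* _ y q-1 ⟩
      ι (F.- F.1#) ^ q-1 * y ^ q-1      ≈⟨ *-congʳ (ι-^ (F.- F.1#) q-1) ⟨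
      ι ((F.- F.1#) F.^ q-1) * y ^ q-1  ≈⟨ *-congʳ (trans (ι-cong (F.unit^[q-1]≈1 -1≉0)) ι-1) ⟩
      1# * y ^ q-1                      ≈⟨ *-identityˡ _ ⟩
      y ^ q-1                           ∎
      where
      -1≉0 : F.- F.1# F.≉ F.0#
      -1≉0 eq = F.nontrivial (F.trans (F.sym (F.-‿involutive F.1#)) (F.trans (F.-‿cong eq) F.-0#≈0#))

    -- Each c^{q-1} is idempotent, which reduces every positive multiple of q-1 to q-1 itself.
    ∑-ι^[[q-1]m] : ∀ m → ∑ F.elems (λ c → ι c ^ (q-1 ℕ.* suc m)) ≈ - 1#
    ∑-ι^[[q-1]m] m = begin
      ∑ F.elems (λ c → ι c ^ (q-1 ℕ.* suc m))        ≈⟨ ∑-cong F.elems (λ c → ι-^ c (q-1 ℕ.* suc m)) ⟨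
      ∑ F.elems (λ c → ι (c F.^ (q-1 ℕ.* suc m)))    ≈⟨ ι-∑ F.elems _ ⟨
      ι (F.∑ F.elems (λ c → c F.^ (q-1 ℕ.* suc m)))  ≈⟨ ι-cong (F.trans (F.∑-cong F.elems (reduce 0<q-1 m)) (F.∑c^[q-1] 0<q-1)) ⟩
      ι (F.- F.1#)                                   ≈⟨ trans (ι-neg F.1#) (-‿cong ι-1) ⟩
      - 1#                                           ∎
      where
      module S = IntegerSolver F
      idem : 0 ℕ.< q-1 → ∀ c → c F.^ q-1 F.* c F.^ q-1 F.≈ c F.^ q-1
      idem (s≤s {n = q-2} _) c = F.trans (S.solve 3 (λ c p r → (c S.:* p) S.:* r S.:= (c S.:* r) S.:* p) F.refl c (c F.^ q-2) (c F.^ q-1))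
        (F.*-congʳ (F.c^q≈c c))
      reduce : 0 ℕ.< q-1 → ∀ m c → c F.^ (q-1 ℕ.* suc m) F.≈ c F.^ q-1
      reduce lt zero    c = F.reflexive (≡.cong (c F.^_) (ℕₚ.*-identityʳ q-1))
      reduce lt (suc m) c = F.trans (F.reflexive (≡.cong (c F.^_) (ℕₚ.*-suc q-1 (suc m)))) (F.trans (F.^-homo-* c q-1 (q-1 ℕ.* suc m))
        (F.trans (F.*-congˡ (reduce lt m c)) (idem lt c)))

    -- Here `G c` stands for E / t with t = D - c y. From t^q = D^q - c y^q follows c D (y^q -
    -- D^{q-1} y) = t (D^q - D t^{q-1}), so multiplying a summand by D removes its denominator. In
    -- the sum over c the constant D^q drops out and the powers t^{q-1} add up to - y^{q-1}; finally
    -- D is cancelled.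
    ∑-scaled-inverses : ∀ D y E (D⁻¹ : Carrier) (G : F.Carrier → Carrier) → D * D⁻¹ ≈ 1# → (∀ c → G c * (D - ι c * y) ≈ E) →
      ∑ F.elems (λ c → ι c * G c) * (φ y - D ^ q-1 * y) ≈ E * y ^ q-1
    ∑-scaled-inverses D y E D⁻¹ G DD⁻¹≈1 Gt≈E = begin
      H * (φ y - D ^ q-1 * y)
        ≈⟨ *-identityʳ _ ⟨
      H * (φ y - D ^ q-1 * y) * 1#
        ≈⟨ *-congˡ DD⁻¹≈1 ⟨
      H * (φ y - D ^ q-1 * y) * (D * D⁻¹)
        ≈⟨ solve 3 (λ H D i → H :* (D :* i) := (H :* D) :* i) refl _ D D⁻¹ ⟩
      H * (φ y - D ^ q-1 * y) * D * D⁻¹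
        ≈⟨ *-congʳ (trans (*-assoc _ _ _) (∑-*ʳ F.elems _ _)) ⟩
      ∑ F.elems (λ c → ι c * G c * ((φ y - D ^ q-1 * y) * D)) * D⁻¹
        ≈⟨ *-congʳ (∑-cong F.elems each) ⟩
      ∑ F.elems (λ c → E * (φ D + - D * t c ^ q-1)) * D⁻¹
        ≈⟨ *-congʳ (∑-*ˡ F.elems _ E) ⟨
      E * ∑ F.elems (λ c → φ D + - D * t c ^ q-1) * D⁻¹
        ≈⟨ *-congʳ (*-congˡ (trans (∑-+ F.elems _ _) (+-cong (∑-const-elems _) (sym (∑-*ˡ F.elems _ (- D)))))) ⟩
      E * (0# + - D * ∑ F.elems (λ c → t c ^ q-1)) * D⁻¹
        ≈⟨ *-congʳ (*-congˡ (+-congˡ (*-congˡ (trans (∑-[y+cD]^[q-1] D (- y)) (-‿cong (neg-^[q-1] y)))))) ⟩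
      E * (0# + - D * - (y ^ q-1)) * D⁻¹
        ≈⟨ solve 4 (λ E D p i → E :* (con (pos 0) :+ :- D :* :- p) :* i := E :* p :* (D :* i)) refl E D _ D⁻¹ ⟩
      E * y ^ q-1 * (D * D⁻¹)
        ≈⟨ trans (*-congˡ DD⁻¹≈1) (*-identityʳ _) ⟩
      E * y ^ q-1 ∎
      where
      H = ∑ F.elems (λ c → ι c * G c)
      -- Written as D + c (-y) rather than D - c y to match `∑-[y+cD]^[q-1]`.
      t : F.Carrier → Carrier
      t c = D + ι c * - y
      t-φ : ∀ c → φ D - ι c * φ y ≈ t c * t c ^ q-1
      t-φ c = sym (trans (φ-+ _ _) (trans (+-congˡ (trans (φ-* _ _) (*-cong (φ-ι c) (φ-neg y))))
        (solve 3 (λ D c y → D :+ c :* :- y := D :- c :* y) refl _ _ _)))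
      each : ∀ c → ι c * G c * ((φ y - D ^ q-1 * y) * D) ≈ E * (φ D + - D * t c ^ q-1)
      each c = begin
        ι c * G c * ((y * y ^ q-1 - D ^ q-1 * y) * D)
          ≈⟨ solve 6 (λ c G y Y D P → c :* G :* ((y :* Y :- P :* y) :* D) :=
               c :* G :* y :* ((D :- c :* y) :* Y) :- c :* G :* y :* (D :* P :- c :* (y :* Y))) refl (ι c) (G c) y (y ^ q-1) D (D ^ q-1) ⟩
        ι c * G c * y * ((D - ι c * y) * y ^ q-1) - ι c * G c * y * (φ D - ι c * φ y)
          ≈⟨ +-congˡ (-‿cong (*-congˡ (t-φ c))) ⟩
        ι c * G c * y * ((D - ι c * y) * y ^ q-1) - ι c * G c * y * ((D + ι c * - y) * t c ^ q-1)
          ≈⟨ solve 6 (λ c G y Y D T → c :* G :* y :* ((D :- c :* y) :* Y) :- c :* G :* y :* ((D :+ c :* :- y) :* T) :=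
               (G :* (D :- c :* y)) :* (c :* (y :* Y) :+ (D :+ c :* :- y) :* T :- D :* T)) refl (ι c) (G c) y (y ^ q-1) D (t c ^ q-1) ⟩
        G c * (D - ι c * y) * (ι c * φ y + t c * t c ^ q-1 - D * t c ^ q-1)
          ≈⟨ *-cong (Gt≈E c) (+-congʳ (+-congˡ (sym (t-φ c)))) ⟩
        E * (ι c * φ y + (φ D - ι c * φ y) - D * t c ^ q-1)
          ≈⟨ solve 5 (λ E a D′ D T → E :* (a :+ (D′ :- a) :- D :* T) := E :* (D′ :+ :- D :* T)) refl E _ _ D _ ⟩
        E * (φ D + - D * t c ^ q-1) ∎

  -- Carlitz's additive polynomials and their logarithmic derivatives

  module Bracket (B : CommutativeRing 0ℓ 0ℓ) (ι : F.Carrier → CommutativeRing.Carrier B) (ι-hom : IsHom F B ι)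
      (θ : CommutativeRing.Carrier B) where
    open CommutativeRing B
    open Frobenius B ι ι-hom
    open IntegerSolver B
    open import Algebra.Properties.CommutativeSemiring.Exp commutativeSemiring
    open import Relation.Binary.Reasoning.Setoid setoid

    br : ℕ → Carrier
    br k = θ ^ (q ℕ.^ k) - θ

    br-zero : br 0 ≈ 0#
    br-zero = trans (+-congʳ (*-identityʳ θ)) (-‿inverseʳ θ)

    br-one : br 1 ≈ φ θ - θ
    br-one = +-congʳ (reflexive (≡.cong (θ ^_) (ℕₚ.*-identityʳ q)))

    br-suc : ∀ k → br (suc k) ≈ φ (br k) + br 1
    br-suc k = begin
      θ ^ (q ℕ.* q ℕ.^ k) - θ            ≡⟨ ≡.cong (λ n → θ ^ n - θ) (ℕₚ.*-comm q (q ℕ.^ k)) ⟩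
      θ ^ (q ℕ.^ k ℕ.* q) - θ            ≈⟨ +-congʳ (^-assocʳ θ (q ℕ.^ k) q) ⟨
      φ (θ ^ (q ℕ.^ k)) - θ              ≈⟨ solve 3 (λ a b c → a :- b := (a :- c) :+ (c :- b)) refl _ θ (φ θ) ⟩
      (φ (θ ^ (q ℕ.^ k)) - φ θ) + (φ θ - θ) ≈⟨ +-cong (φ-sub _ _) br-one ⟨
      φ (br k) + br 1                    ∎

    -- The monic polynomial encoded by `cs` is `θ ^ length cs + low cs`.
    low : List F.Carrier → Carrier
    low []       = 0#
    low (c ∷ cs) = ι c * θ ^ length cs + low cs

    -- `D` enters through its recursion only, so the same development applies to the image of `D` in
    -- a ring of power series.
    module Carlitz (D : ℕ → Carrier) (D-zero : D 0 ≈ 1#) (D-suc : ∀ d → D (suc d) ≈ br (suc d) * φ (D d)) where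
      open ListSum B
      open Hom F B ι-hom

      e : ℕ → Carrier → Carrier
      e zero    Z = Z
      e (suc d) Z = φ (e d Z) - D d ^ q-1 * e d Z

      ε : ℕ → Carrier
      ε zero    = 1#
      ε (suc d) = - (D d ^ q-1 * ε d)

      e-cong : ∀ d {Y Z} → Y ≈ Z → e d Y ≈ e d Z
      e-cong zero    eq = eq
      e-cong (suc d) eq = +-cong (φ-cong (e-cong d eq)) (-‿cong (*-congˡ (e-cong d eq)))

      e-+ : ∀ d Y Z → e d (Y + Z) ≈ e d Y + e d Z
      e-+ zero    Y Z = refl
      e-+ (suc d) Y Z = begin
        φ (e d (Y + Z)) - D d ^ q-1 * e d (Y + Z)
          ≈⟨ +-cong (trans (φ-cong (e-+ d Y Z)) (φ-+ _ _)) (-‿cong (*-congˡ (e-+ d Y Z))) ⟩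
        (φ (e d Y) + φ (e d Z)) - D d ^ q-1 * (e d Y + e d Z)
          ≈⟨ solve 5 (λ a b D y z → (a :+ b) :- D :* (y :+ z) := (a :- D :* y) :+ (b :- D :* z)) refl _ _ _ _ _ ⟩
        e (suc d) Y + e (suc d) Z ∎

      e-ι : ∀ d c Z → e d (ι c * Z) ≈ ι c * e d Z
      e-ι zero    c Z = refl
      e-ι (suc d) c Z = begin
        φ (e d (ι c * Z)) - D d ^ q-1 * e d (ι c * Z)
          ≈⟨ +-cong (trans (φ-cong (e-ι d c Z)) (trans (φ-* _ _) (*-congʳ (φ-ι c)))) (-‿cong (*-congˡ (e-ι d c Z))) ⟩
        ι c * φ (e d Z) - D d ^ q-1 * (ι c * e d Z)
          ≈⟨ solve 4 (λ c p D y → c :* p :- D :* (c :* y) := c :* (p :- D :* y)) refl _ _ _ _ ⟩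
        ι c * e (suc d) Z ∎

      e-neg : ∀ d Z → e d (- Z) ≈ - e d Z
      e-neg d Z = begin
        e d (- Z)                ≈⟨ e-cong d (trans (*-congʳ neg1) (solve 1 (λ z → :- con (pos 1) :* z := :- z) refl Z)) ⟨
        e d (ι (F.- F.1#) * Z)   ≈⟨ e-ι d _ Z ⟩
        ι (F.- F.1#) * e d Z     ≈⟨ trans (*-congʳ neg1) (solve 1 (λ z → :- con (pos 1) :* z := :- z) refl _) ⟩
        - e d Z                  ∎
        where
        neg1 : ι (F.- F.1#) ≈ - 1#
        neg1 = trans (ι-neg _) (-‿cong ι-1)

      -- Carlitz's recursion. In the inductive step, `top` rewrites D_{d+1}^{q-1} [d+1] as [d+1]^q
      -- D_d^{q(q-1)}, so that the terms without θ combine to [d+1]^q e_{d+1}(Z)^q. Together with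
      -- the [1] e_{d+1}(Z)^q left over from θ^q - θ this gives the factor [d+1]^q + [1] = [d+2].
      e-θ : ∀ d Z → e (suc d) (θ * Z) ≈ θ * e (suc d) Z + br (suc d) * φ (e d Z)
      e-θ zero Z = begin
        φ (θ * Z) - D 0 ^ q-1 * (θ * Z)               ≈⟨ +-congʳ (φ-* θ Z) ⟩
        φ θ * φ Z - D 0 ^ q-1 * (θ * Z)               ≈⟨ solve 5 (λ t t′ z z′ D → t′ :* z′ :- D :* (t :* z) :=
                                                             t :* (z′ :- D :* z) :+ (t′ :- t) :* z′) refl θ (φ θ) Z (φ Z) _ ⟩
        θ * e 1 Z + (φ θ - θ) * φ Z                   ≈⟨ +-congˡ (*-congʳ br-one) ⟨
        θ * e 1 Z + br 1 * φ Z                        ∎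
      e-θ (suc d) Z = begin
        φ (e (suc d) (θ * Z)) - D (suc d) ^ q-1 * e (suc d) (θ * Z)
          ≈⟨ +-cong (φ-cong (e-θ d Z)) (-‿cong (*-congˡ (e-θ d Z))) ⟩
        φ (θ * E + b * φ y) - D (suc d) ^ q-1 * (θ * E + b * φ y)
          ≈⟨ +-congʳ (trans (φ-+ _ _) (+-cong (φ-* _ _) (φ-* _ _))) ⟩
        (φ θ * φ E + φ b * φ (φ y)) - D (suc d) ^ q-1 * (θ * E + b * φ y)
          ≈⟨ solve 8 (λ t t′ E E′ b b′y″ D y′ → (t′ :* E′ :+ b′y″) :- D :* (t :* E :+ b :* y′) :=
               t :* (E′ :- D :* E) :+ (t′ :- t) :* E′ :+ (b′y″ :- (D :* b) :* y′)) refl θ (φ θ) E (φ E) b _ _ (φ y) ⟩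
        θ * e (suc (suc d)) Z + (φ θ - θ) * φ E + (φ b * φ (φ y) - (D (suc d) ^ q-1 * b) * φ y)
          ≈⟨ +-cong (+-congˡ (*-congʳ (sym br-one))) (+-congˡ (-‿cong (*-congʳ top))) ⟩
        θ * e (suc (suc d)) Z + br 1 * φ E + (φ b * φ (φ y) - (φ b * φ (D d ^ q-1)) * φ y)
          ≈⟨ +-congˡ (trans (solve 4 (λ b y″ D y′ → b :* y″ :- (b :* D) :* y′ := b :* (y″ :- D :* y′)) refl _ _ _ _)
               (*-congˡ (sym (trans (φ-sub _ _) (+-congˡ (-‿cong (φ-* _ _))))))) ⟩
        θ * e (suc (suc d)) Z + br 1 * φ E + φ b * φ E
          ≈⟨ solve 4 (λ x c b E → x :+ c :* E :+ b :* E := x :+ (b :+ c) :* E) refl _ _ _ _ ⟩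
        θ * e (suc (suc d)) Z + (φ b + br 1) * φ E
          ≈⟨ +-congˡ (*-congʳ (br-suc (suc d))) ⟨
        θ * e (suc (suc d)) Z + br (suc (suc d)) * φ E ∎
        where
        E = e (suc d) Z
        b = br (suc d)
        y = e d Z
        top : D (suc d) ^ q-1 * b ≈ φ b * φ (D d ^ q-1)
        top = begin
          D (suc d) ^ q-1 * b                 ≈⟨ *-congʳ (trans (^-congˡ q-1 (D-suc d)) (^-distrib-* _ _ q-1)) ⟩
          b ^ q-1 * φ (D d) ^ q-1 * b         ≈⟨ solve 3 (λ p D b → p :* D :* b := (b :* p) :* D) refl _ _ _ ⟩
          φ b * φ (D d) ^ q-1                 ≈⟨ *-congˡ (trans (^-assocʳ (D d) q q-1) (trans (reflexive (≡.cong (D d ^_) (ℕₚ.*-comm q q-1)))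
                                                   (sym (^-assocʳ (D d) q-1 q)))) ⟩
          φ b * φ (D d ^ q-1)                 ∎

      -- In e_{d+1}(θ θ^d) the first term of `e-θ` disappears: e_d(θ^d) = D_d is a root of Y^q -
      -- D_d^{q-1} Y.
      e-θ^d : ∀ d → e d (θ ^ d) ≈ D d
      e-θ^d zero    = sym D-zero
      e-θ^d (suc d) = begin
        e (suc d) (θ * θ ^ d)                                    ≈⟨ e-θ d (θ ^ d) ⟩
        θ * e (suc d) (θ ^ d) + br (suc d) * φ (e d (θ ^ d))     ≈⟨ +-cong (*-congˡ vanish) (*-congˡ (φ-cong (e-θ^d d))) ⟩
        θ * 0# + br (suc d) * φ (D d)                            ≈⟨ trans (+-congʳ (zeroʳ θ)) (+-identityˡ _) ⟩
        br (suc d) * φ (D d)                                     ≈⟨ D-suc d ⟨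
        D (suc d)                                                ∎
        where
        vanish : e (suc d) (θ ^ d) ≈ 0#
        vanish = begin
          φ (e d (θ ^ d)) - D d ^ q-1 * e d (θ ^ d)  ≈⟨ +-cong (φ-cong (e-θ^d d)) (-‿cong (*-congˡ (e-θ^d d))) ⟩
          D d * D d ^ q-1 - D d ^ q-1 * D d          ≈⟨ solve 2 (λ a b → a :* b :- b :* a := con (pos 0)) refl _ _ ⟩
          0#                                         ∎

      -- e_{d+1}(Z) is the product of e_d(Z) + c D_d over all c; splitting off one factor avoids the product.
      e-factor : ∀ d c Z → let t = e d Z + ι c * D d in e (suc d) Z ≈ t * (t ^ q-1 - D d ^ q-1)
      e-factor d c Z = begin
        φ y - D d ^ q-1 * y                                     ≈⟨ solve 5 (λ φy P y c D → φy :- P :* y := (φy :+ c :* (D :* P)) :- P :* (y :+ c :* D)) refl (φ y) (D d ^ q-1) y (ι c) (D d) ⟩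
        (φ y + ι c * φ (D d)) - D d ^ q-1 * (y + ι c * D d)     ≈⟨ +-congʳ (trans (φ-+ _ _) (+-congˡ (trans (φ-* _ _) (*-congʳ (φ-ι c))))) ⟨
        φ t - D d ^ q-1 * t                                     ≈⟨ solve 3 (λ t p D → t :* p :- D :* t := t :* (p :- D)) refl t _ _ ⟩
        t * (t ^ q-1 - D d ^ q-1)                               ∎
        where
        y = e d Z
        t = y + ι c * D d

      -- The logarithmic derivative of e_d, by induction on d. Fixing the leading entry c replaces Z
      -- by Z + c θ^d, where e_d takes the value t = e_d(Z) + c D_d. By `e-factor` the quotient
      -- e_{d+1}(Z) / t is t^{q-1} - D_d^{q-1}, and these add up to - D_d^{q-1} over all c.
      ∑-inverses : ∀ d Z (v : List F.Carrier → Carrier) → (∀ cs → length cs ≡ d → v cs * (Z + low cs) ≈ 1#) →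
        ∑ (tuples d) v * e d Z ≈ ε d
      ∑-inverses zero    Z v inv = trans (*-cong (+-identityʳ _) (sym (+-identityʳ Z))) (inv [] ≡.refl)
      ∑-inverses (suc d) Z v inv = begin
        ∑ (tuples (suc d)) v * e (suc d) Z
          ≈⟨ *-congʳ (∑-concatMap (λ c → map (c ∷_) (tuples d)) F.elems v) ⟩
        ∑ F.elems (λ c → ∑ (map (c ∷_) (tuples d)) v) * e (suc d) Z
          ≈⟨ ∑-*ʳ F.elems _ _ ⟩
        ∑ F.elems (λ c → ∑ (map (c ∷_) (tuples d)) v * e (suc d) Z)
          ≈⟨ ∑-cong F.elems each ⟩
        ∑ F.elems (λ c → ε d * (t c ^ q-1 + - (D d ^ q-1)))
          ≈⟨ ∑-*ˡ F.elems _ (ε d) ⟨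
        ε d * ∑ F.elems (λ c → t c ^ q-1 + - (D d ^ q-1))
          ≈⟨ *-congˡ (trans (∑-+ F.elems _ _) (+-cong (∑-[y+cD]^[q-1] y (D d)) (∑-const-elems _))) ⟩
        ε d * (- (D d ^ q-1) + 0#)
          ≈⟨ solve 2 (λ ε p → ε :* (:- p :+ con (pos 0)) := :- (p :* ε)) refl _ _ ⟩
        ε (suc d) ∎
        where
        y = e d Z
        t : F.Carrier → Carrier
        t c = y + ι c * D d
        each : ∀ c → ∑ (map (c ∷_) (tuples d)) v * e (suc d) Z ≈ ε d * (t c ^ q-1 + - (D d ^ q-1))
        each c = begin
          ∑ (map (c ∷_) (tuples d)) v * e (suc d) Z
            ≈⟨ *-cong (reflexive (∑-map (c ∷_) (tuples d) v)) (e-factor d c Z) ⟩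
          ∑ (tuples d) (v ∘ (c ∷_)) * (t c * (t c ^ q-1 - D d ^ q-1))
            ≈⟨ *-assoc _ _ _ ⟨
          ∑ (tuples d) (v ∘ (c ∷_)) * t c * (t c ^ q-1 - D d ^ q-1)
            ≈⟨ *-congʳ (*-congˡ (trans (e-+ d Z _) (+-congˡ (trans (e-ι d c _) (*-congˡ (e-θ^d d)))))) ⟨
          ∑ (tuples d) (v ∘ (c ∷_)) * e d (Z + ι c * θ ^ d) * (t c ^ q-1 - D d ^ q-1)
            ≈⟨ *-congʳ (∑-inverses d (Z + ι c * θ ^ d) (v ∘ (c ∷_)) (λ { cs ≡.refl →
                 trans (*-congˡ (+-assoc _ _ _)) (inv (c ∷ cs) ≡.refl) })) ⟩
          ε d * (t c ^ q-1 - D d ^ q-1) ∎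

      -- `β d` and `γ d` are the coefficients of z^q and z^{q²} in e_d(z).
      β : ℕ → Carrier
      β zero    = 0#
      β (suc d) = φ (ε d) - D d ^ q-1 * β d

      γ : ℕ → Carrier
      γ zero    = 0#
      γ (suc d) = φ (β d) - D d ^ q-1 * γ d

      e-expansion : ∀ d z → ∃ λ ρ → e d z ≈ ε d * z + β d * φ z + γ d * φ (φ z) + φ (φ (φ z)) * ρ
      e-expansion zero    z = 0# , solve 4 (λ z a b c → z := con (pos 1) :* z :+ con (pos 0) :* a :+ con (pos 0) :* b :+ c :* con (pos 0))
        refl z (φ z) (φ (φ z)) (φ (φ (φ z)))
      e-expansion (suc d) z with e-expansion d z
      ... | ρ , eq = φ (γ d) + z₃ ^ q-1 * φ ρ - D d ^ q-1 * ρ , (begin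
        φ (e d z) - D d ^ q-1 * e d z
          ≈⟨ +-cong (trans (φ-cong eq) expand) (-‿cong (*-congˡ eq)) ⟩
        (φ (ε d) * φ z + φ (β d) * φ (φ z) + φ (γ d) * z₃ + (z₃ * z₃ ^ q-1) * φ ρ)
          - D d ^ q-1 * (ε d * z + β d * φ z + γ d * φ (φ z) + z₃ * ρ)
          ≈⟨ solve 14 (λ ε β γ ε′ β′ γ′ z z₁ z₂ z₃ P D ρ ρ′ →
               (ε′ :* z₁ :+ β′ :* z₂ :+ γ′ :* z₃ :+ (z₃ :* P) :* ρ′) :- D :* (ε :* z :+ β :* z₁ :+ γ :* z₂ :+ z₃ :* ρ) :=
               (:- (D :* ε)) :* z :+ (ε′ :- D :* β) :* z₁ :+ (β′ :- D :* γ) :* z₂ :+ z₃ :* (γ′ :+ P :* ρ′ :- D :* ρ)) refl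
               (ε d) (β d) (γ d) (φ (ε d)) (φ (β d)) (φ (γ d)) z (φ z) (φ (φ z)) z₃ (z₃ ^ q-1) (D d ^ q-1) ρ (φ ρ) ⟩
        ε (suc d) * z + β (suc d) * φ z + γ (suc d) * φ (φ z) + z₃ * (φ (γ d) + z₃ ^ q-1 * φ ρ - D d ^ q-1 * ρ) ∎)
        where
        z₃ = φ (φ (φ z))
        expand : φ (ε d * z + β d * φ z + γ d * φ (φ z) + φ (φ (φ z)) * ρ) ≈
          φ (ε d) * φ z + φ (β d) * φ (φ z) + φ (γ d) * φ (φ (φ z)) + φ (φ (φ (φ z))) * φ ρ
        expand = trans (φ-+ _ _) (+-cong (trans (φ-+ _ _) (+-cong (trans (φ-+ _ _) (+-cong (φ-* _ _) (φ-* _ _))) (φ-* _ _))) (φ-* _ _))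

  module CarlitzConstants (R : CommutativeRing 0ℓ 0ℓ) (ι : F.Carrier → CommutativeRing.Carrier R) (ι-hom : IsHom F R ι)
      (θ : CommutativeRing.Carrier R) where
    open CommutativeRing R
    open Frobenius R ι ι-hom
    open Bracket R ι ι-hom θ
    open import Algebra.Properties.CommutativeSemiring.Exp commutativeSemiring

    D : ℕ → Carrier
    D zero    = 1#
    D (suc d) = br (suc d) * φ (D d)

    open Carlitz D refl (λ _ → refl) using (ε; β; γ) public

    -- Used with A the power series over R and `h` the constants: it compares the quantities
    -- computed in R with those computed in A.
    module Extension (A : CommutativeRing 0ℓ 0ℓ) (h : Carrier → CommutativeRing.Carrier A) (h-hom : IsHom R A h) where
      private
        module A = CommutativeRing A
      open Hom R A h-hom renaming (ι-cong to h-cong; ι-+ to h-+; ι-* to h-*; ι-neg to h-neg; ι-0 to h-0; ι-1 to h-1; ι-^ to h-^) public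
      open import Algebra.Properties.CommutativeSemiring.Exp A.commutativeSemiring using () renaming (_^_ to _^A_; ^-assocʳ to ^A-assocʳ) public
      open import Relation.Binary.Reasoning.Setoid A.setoid

      ι′-hom : IsHom F A (h ∘ ι)
      ι′-hom = ∘-hom F R A ι-hom h-hom

      module φA = Frobenius A (h ∘ ι) ι′-hom
      module BA = Bracket A (h ∘ ι) ι′-hom (h θ)

      h-sub : ∀ x y → h (x - y) A.≈ h x A.- h y
      h-sub x y = A.trans (h-+ _ _) (A.+-congˡ (h-neg y))

      h-br : ∀ k → h (br k) A.≈ BA.br k
      h-br k = A.trans (h-sub _ _) (A.+-congʳ (h-^ θ (q ℕ.^ k)))

      module CA = BA.Carlitz (h ∘ D) h-1 (λ d → A.trans (h-* _ _) (A.*-cong (h-br (suc d)) (h-^ (D d) q)))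

      h-low : ∀ cs → h (low cs) A.≈ BA.low cs
      h-low []       = h-0
      h-low (c ∷ cs) = A.trans (h-+ _ _) (A.+-cong (A.trans (h-* _ _) (A.*-congˡ (h-^ θ (length cs)))) (h-low cs))

      h-ε : ∀ d → h (ε d) A.≈ CA.ε d
      h-ε zero    = h-1
      h-ε (suc d) = A.trans (h-neg _) (A.-‿cong (A.trans (h-* _ _) (A.*-cong (h-^ (D d) q-1) (h-ε d))))

      h-β : ∀ d → h (β d) A.≈ CA.β d
      h-β zero    = h-0
      h-β (suc d) = A.trans (h-sub _ _) (A.+-cong (A.trans (h-^ (ε d) q) (φA.φ-cong (h-ε d)))
        (A.-‿cong (A.trans (h-* _ _) (A.*-cong (h-^ (D d) q-1) (h-β d)))))

      h-γ : ∀ d → h (γ d) A.≈ CA.γ d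
      h-γ zero    = h-0
      h-γ (suc d) = A.trans (h-sub _ _) (A.+-cong (A.trans (h-^ (β d) q) (φA.φ-cong (h-β d)))
        (A.-‿cong (A.trans (h-* _ _) (A.*-cong (h-^ (D d) q-1) (h-γ d)))))

      open ListSum A using () renaming (∑ to ∑A)
      private
        module S = IntegerSolver A

      -- Take Z = θ^d - c z in `∑-inverses`: then Z plus the lower part is a - c z, and additivity
      -- gives e_d(Z) = D_d - c e_d(z).
      generating : ∀ d c z (v : List F.Carrier → A.Carrier) →
        (∀ cs → length cs ≡ d → v cs A.* (h (θ ^ d + low cs) A.- h (ι c) A.* z) A.≈ A.1#) →
        ∑A (tuples d) v A.* (h (D d) A.- h (ι c) A.* CA.e d z) A.≈ h (ε d)
      generating d c z v inv = begin
        ∑A (tuples d) v A.* (h (D d) A.- h (ι c) A.* CA.e d z)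
          ≈⟨ A.*-congˡ (A.trans (CA.e-+ d _ _) (A.+-cong (CA.e-θ^d d) (A.trans (CA.e-neg d _) (A.-‿cong (CA.e-ι d c z))))) ⟨
        ∑A (tuples d) v A.* CA.e d (h θ ^A d A.- h (ι c) A.* z)
          ≈⟨ CA.∑-inverses d _ v (λ cs len → A.trans (A.*-congˡ (rearrange cs)) (inv cs len)) ⟩
        CA.ε d
          ≈⟨ h-ε d ⟨
        h (ε d) ∎
        where
        rearrange : ∀ cs → (h θ ^A d A.- h (ι c) A.* z) A.+ BA.low cs A.≈ h (θ ^ d + low cs) A.- h (ι c) A.* z
        rearrange cs = A.trans (S.solve 3 (λ a b l → (a S.:- b) S.:+ l S.:= (a S.:+ l) S.:- b) A.refl _ _ _)
          (A.+-congʳ (A.sym (A.trans (h-+ _ _) (A.+-cong (h-^ θ d) (h-low cs)))))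

      *-e-expansion : ∀ d z f → ∃ λ g → f A.* CA.e d z A.≈
        h (ε d) A.* (z A.* f) A.+ h (β d) A.* (z ^A q A.* f) A.+ h (γ d) A.* (z ^A (q ℕ.* q) A.* f) A.+ z ^A (q ℕ.* q ℕ.* q) A.* g
      *-e-expansion d z f with ρ , eq ← CA.e-expansion d z = ρ A.* f , (begin
        f A.* CA.e d z
          ≈⟨ A.*-congˡ eq ⟩
        f A.* (CA.ε d A.* z A.+ CA.β d A.* φA.φ z A.+ CA.γ d A.* φA.φ (φA.φ z) A.+ φA.φ (φA.φ (φA.φ z)) A.* ρ)
          ≈⟨ A.*-congˡ (A.+-cong (A.+-cong (A.+-cong (A.*-congʳ (A.sym (h-ε d))) (A.*-congʳ (A.sym (h-β d))))
               (A.*-cong (A.sym (h-γ d)) (^A-assocʳ z q q)))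
               (A.*-congʳ (A.trans (φA.φ-cong (^A-assocʳ z q q)) (^A-assocʳ z (q ℕ.* q) q)))) ⟩
        f A.* (h (ε d) A.* z A.+ h (β d) A.* z ^A q A.+ h (γ d) A.* z ^A (q ℕ.* q) A.+ z ^A (q ℕ.* q ℕ.* q) A.* ρ)
          ≈⟨ S.solve 9 (λ f a b c x y₁ y₂ y₃ ρ → f S.:* (a S.:* x S.:+ b S.:* y₁ S.:+ c S.:* y₂ S.:+ y₃ S.:* ρ) S.:=
               a S.:* (x S.:* f) S.:+ b S.:* (y₁ S.:* f) S.:+ c S.:* (y₂ S.:* f) S.:+ y₃ S.:* (ρ S.:* f)) A.refl
               f (h (ε d)) (h (β d)) (h (γ d)) z (z ^A q) (z ^A (q ℕ.* q)) (z ^A (q ℕ.* q ℕ.* q)) ρ ⟩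
        h (ε d) A.* (z A.* f) A.+ h (β d) A.* (z ^A q A.* f) A.+ h (γ d) A.* (z ^A (q ℕ.* q) A.* f) A.+ z ^A (q ℕ.* q ℕ.* q) A.* (ρ A.* f) ∎)

      expand-difference : ∀ g a b c → g A.* (a A.- b A.* c) A.≈ a A.* g A.- b A.* (g A.* c)
      expand-difference = S.solve 4 (λ g a b c → g S.:* (a S.:- b S.:* c) S.:= a S.:* g S.:- b S.:* (g S.:* c)) A.refl

      -- For z a power series variable, Φ d = 1 + ∑ S_{<d}(k) z ^ k over the positive multiples k of q - 1.
      module _ (z : A.Carrier) (G : ℕ → F.Carrier → A.Carrier) (D⁻¹ : ℕ → Carrier) (D-inverse : ∀ d → D d * D⁻¹ d ≈ 1#)
          (G-inverse : ∀ d c → G d c A.* (h (D d) A.- h (ι c) A.* CA.e d z) A.≈ h (ε d)) where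
        -- Since c / (a - c z) = 1 / (a/c - z) for c nonzero, this is the sum of 1 / (b - z) over
        -- all b of degree d, with any leading coefficient.
        H : ℕ → A.Carrier
        H d = ∑A F.elems (λ c → h (ι c) A.* G d c)

        Φ : ℕ → A.Carrier
        Φ zero    = A.1#
        Φ (suc d) = Φ d A.- z A.* H d

        -- By the meaning of `H`, the series Φ_d is z times the sum of 1 / (z - b) over all b of
        -- degree below d, with b = 0 giving the initial 1. This is z times the logarithmic
        -- derivative of e_d; `∑-scaled-inverses` carries out the induction step.
        Φ-e : ∀ d → Φ d A.* CA.e d z A.≈ h (ε d) A.* z
        Φ-e zero    = A.*-congʳ (A.sym h-1)
        Φ-e (suc d) = begin
          (Φ d A.- z A.* H d) A.* (φA.φ y A.- P A.* y)
            ≈⟨ S.solve 6 (λ f z H y Y P → (f S.:- z S.:* H) S.:* (y S.:* Y S.:- P S.:* y) S.:=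
                 (f S.:* y) S.:* (Y S.:- P) S.:- z S.:* (H S.:* (y S.:* Y S.:- P S.:* y))) A.refl (Φ d) z (H d) y (y ^A q-1) P ⟩
          (Φ d A.* y) A.* (y ^A q-1 A.- P) A.- z A.* (H d A.* (φA.φ y A.- P A.* y))
            ≈⟨ A.+-cong (A.*-congʳ (Φ-e d)) (A.-‿cong (A.*-congˡ
                 (φA.∑-scaled-inverses (h (D d)) y (h (ε d)) (h (D⁻¹ d)) (G d)
                   (A.trans (A.sym (h-* _ _)) (A.trans (h-cong (D-inverse d)) h-1)) (G-inverse d)))) ⟩
          (h (ε d) A.* z) A.* (y ^A q-1 A.- P) A.- z A.* (h (ε d) A.* y ^A q-1)
            ≈⟨ S.solve 4 (λ E z Y P → (E S.:* z) S.:* (Y S.:- P) S.:- z S.:* (E S.:* Y) S.:= (S.:- (P S.:* E)) S.:* z) A.refl _ _ _ _ ⟩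
          (A.- (P A.* h (ε d))) A.* z
            ≈⟨ A.*-congʳ (A.trans (h-neg _) (A.-‿cong (A.trans (h-* _ _) (A.*-congʳ (h-^ (D d) q-1))))) ⟨
          h (ε (suc d)) A.* z ∎
          where
          y = CA.e d z
          P = h (D d) ^A q-1

  -- The power sums S_d and S_{<d}

  module PowerSums (R : CommutativeRing 0ℓ 0ℓ) (ι : F.Carrier → CommutativeRing.Carrier R) (ι-hom : IsHom F R ι)
      (θ : CommutativeRing.Carrier R) where
    open CommutativeRing R
    open Bracket R ι ι-hom θ
    open import Algebra.Properties.CommutativeSemiring.Exp commutativeSemiring

    module WithInverses (br⁻¹ : ℕ → Carrier) (br-inverse : ∀ k → br (suc k) * br⁻¹ (suc k) ≈ 1#)
         (inv : List F.Carrier → Carrier) (inv-inverse : ∀ cs → (θ ^ length cs + low cs) * inv cs ≈ 1#) where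
      open Hom F R ι-hom
      open Frobenius R ι ι-hom
      open CarlitzConstants R ι ι-hom θ
      open ListSum R
      open IntegerSolver R
      open RingProperties R
      -- The list parameter enters `Series` only through `tuples`; for arithmetic with series over R
      -- the empty list will do. The tuples below are those of the finite field.
      open PowerSeries R []
      open Series R [] using (PS; sumTo; _⊛_; _⊖_)
      open Extension ring-PS const const-hom
      open import Relation.Binary.Reasoning.Setoid setoid
      private
        module A = CommutativeRing ring-PS
        module ∑A = ListSum ring-PS

      D⁻¹ : ℕ → Carrier
      D⁻¹ zero    = 1#
      D⁻¹ (suc d) = br⁻¹ (suc d) * φ (D⁻¹ d)

      D-inverse : ∀ d → D d * D⁻¹ d ≈ 1#
      D-inverse zero    = *-identityˡ 1#
      D-inverse (suc d) = begin
        br (suc d) * φ (D d) * (br⁻¹ (suc d) * φ (D⁻¹ d))     ≈⟨ solve 4 (λ a b c d → a :* b :* (c :* d) := a :* c :* (b :* d)) refl _ _ _ _ ⟩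
        br (suc d) * br⁻¹ (suc d) * (φ (D d) * φ (D⁻¹ d))     ≈⟨ *-cong (br-inverse d) (trans (sym (φ-* _ _)) (trans (φ-cong (D-inverse d)) φ-1)) ⟩
        1# * 1#                                               ≈⟨ *-identityˡ 1# ⟩
        1#                                                    ∎

      ℓ : ℕ → Carrier
      ℓ zero    = 1#
      ℓ (suc d) = - (br (suc d) * ℓ d)

      ε-ℓ : ∀ d → ε d * ℓ d ≈ D d
      ε-ℓ zero    = *-identityˡ 1#
      ε-ℓ (suc d) = begin
        - (D d ^ q-1 * ε d) * - (br (suc d) * ℓ d)      ≈⟨ solve 4 (λ P E b l → :- (P :* E) :* :- (b :* l) := b :* ((E :* l) :* P)) refl _ _ _ _ ⟩
        br (suc d) * (ε d * ℓ d * D d ^ q-1)            ≈⟨ *-congˡ (*-congʳ (ε-ℓ d)) ⟩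
        br (suc d) * (D d * D d ^ q-1)                  ∎

      ε⁻¹ : ℕ → Carrier
      ε⁻¹ d = ℓ d * D⁻¹ d

      ε-inverse : ∀ d → ε d * ε⁻¹ d ≈ 1#
      ε-inverse d = trans (sym (*-assoc _ _ _)) (trans (*-congʳ (ε-ℓ d)) (D-inverse d))

      S : ℕ → ℕ → Carrier
      S d s = ∑ (tuples d) (λ cs → inv cs ^ s)

      S-frobenius : ∀ d s → S d (s ℕ.* q) ≈ φ (S d s)
      S-frobenius d s = trans (∑-cong (tuples d) (λ cs → sym (^-assocʳ (inv cs) s q))) (sym (φ-∑ (tuples d) _))

      ∑A-coefficient : {X : Set} (xs : List X) (v : X → PS) (k : ℕ) → ∑A.∑ xs v k ≡ ∑ xs (λ a → v a k)
      ∑A-coefficient []       v k = ≡.refl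
      ∑A-coefficient (a ∷ xs) v k = ≡.cong (_ +_) (∑A-coefficient xs v k)

      -- The expansion of ∑_a 1 / (a - c z) over monic a of degree d.
      G : ℕ → F.Carrier → PS
      G d c = ∑A.∑ (tuples d) (λ cs k → ι c ^ k * inv cs ^ suc k)

      G-coefficient : ∀ d c k → G d c k ≈ ι c ^ k * S d (suc k)
      G-coefficient d c k = trans (reflexive (∑A-coefficient (tuples d) _ k)) (sym (∑-*ˡ (tuples d) _ (ι c ^ k)))

      G-inverse : ∀ d c → (G d c ⊛ (const (D d) ⊖ (const (ι c) ⊛ CA.e d x))) ≋ const (ε d)
      G-inverse d c = generating d c x (λ cs k → ι c ^ k * inv cs ^ suc k)
        (λ { cs ≡.refl → geometric (θ ^ length cs + low cs) (inv cs) (ι c) (inv-inverse cs) })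

      -- The remainder starts at x^{q³}. The specialisations below gain one term each as the degree
      -- passes q and q².
      e-coefficient : ∀ d f → ∃ λ g → ∀ n → (f ⊛ CA.e d x) n ≈
        ε d * (x ⊛ f) n + β d * ((x ^A q) ⊛ f) n + γ d * ((x ^A (q ℕ.* q)) ⊛ f) n + ((x ^A (q ℕ.* q ℕ.* q)) ⊛ g) n
      e-coefficient d f = proj₁ (*-e-expansion d x f) , λ n → trans (proj₂ (*-e-expansion d x f) n)
        (+-congʳ (+-cong (+-cong (const-⊛ (ε d) (x ⊛ f) n) (const-⊛ (β d) ((x ^A q) ⊛ f) n)) (const-⊛ (γ d) ((x ^A (q ℕ.* q)) ⊛ f) n)))

      private
        q≤qq : q ℕ.≤ q ℕ.* q
        q≤qq = ℕₚ.m≤m*n q q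
        qq≤qqq : q ℕ.* q ℕ.≤ q ℕ.* q ℕ.* q
        qq≤qqq = ℕₚ.m≤m*n (q ℕ.* q) q

      e-coefficient-0 : ∀ d f → (f ⊛ CA.e d x) 0 ≈ 0#
      e-coefficient-0 d f =
        let g , eq = e-coefficient d f in trans (eq 0) (trans (+-cong (+-cong (+-cong (*-congˡ (x-⊛-zero f)) (*-congˡ (x^-⊛-< q f 0 (s≤s z≤n))))
        (*-congˡ (x^-⊛-< (q ℕ.* q) f 0 (s≤s z≤n)))) (x^-⊛-< (q ℕ.* q ℕ.* q) g 0 (s≤s z≤n)))
        (solve 3 (λ a b c → a :* con (pos 0) :+ b :* con (pos 0) :+ c :* con (pos 0) :+ con (pos 0) := con (pos 0)) refl _ _ _))

      e-coefficient-<q : ∀ d f k → suc k ℕ.< q → (f ⊛ CA.e d x) (suc k) ≈ ε d * f k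
      e-coefficient-<q d f k lt =
        let g , eq = e-coefficient d f in trans (eq (suc k)) (trans (+-cong (+-cong (+-cong (*-congˡ (x-⊛-suc f k)) (*-congˡ (x^-⊛-< q f (suc k) lt)))
        (*-congˡ (x^-⊛-< (q ℕ.* q) f (suc k) lt₂))) (x^-⊛-< (q ℕ.* q ℕ.* q) g (suc k) (ℕₚ.<-≤-trans lt₂ qq≤qqq)))
        (solve 4 (λ a f b c → a :* f :+ b :* con (pos 0) :+ c :* con (pos 0) :+ con (pos 0) := a :* f) refl _ _ _ _))
        where lt₂ = ℕₚ.<-≤-trans lt q≤qq

      private
        x^-⊛-at : ∀ k f {n} m → n ≡ k ℕ.+ m → ((x ^A k) ⊛ f) n ≈ f m
        x^-⊛-at k f m ≡.refl = x^-⊛-≥ k f m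

      e-coefficient-<qq : ∀ d f k m → suc k ≡ q ℕ.+ m → suc k ℕ.< q ℕ.* q → (f ⊛ CA.e d x) (suc k) ≈ ε d * f k + β d * f m
      e-coefficient-<qq d f k m eq₁ lt =
        let g , eq = e-coefficient d f in trans (eq (suc k)) (trans (+-cong (+-cong (+-cong (*-congˡ (x-⊛-suc f k)) (*-congˡ (x^-⊛-at q f m eq₁)))
        (*-congˡ (x^-⊛-< (q ℕ.* q) f (suc k) lt))) (x^-⊛-< (q ℕ.* q ℕ.* q) g (suc k) (ℕₚ.<-≤-trans lt qq≤qqq)))
        (solve 3 (λ a b c → a :+ b :+ c :* con (pos 0) :+ con (pos 0) := a :+ b) refl _ _ _))

      e-coefficient-<qqq : ∀ d f k m m′ → suc k ≡ q ℕ.+ m → suc k ≡ q ℕ.* q ℕ.+ m′ → suc k ℕ.< q ℕ.* q ℕ.* q →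
        (f ⊛ CA.e d x) (suc k) ≈ ε d * f k + β d * f m + γ d * f m′
      e-coefficient-<qqq d f k m m′ eq₁ eq₂ lt =
        let g , eq = e-coefficient d f in trans (eq (suc k)) (trans (+-cong (+-cong (+-cong (*-congˡ (x-⊛-suc f k)) (*-congˡ (x^-⊛-at q f m eq₁)))
        (*-congˡ (x^-⊛-at (q ℕ.* q) f m′ eq₂))) (x^-⊛-< (q ℕ.* q ℕ.* q) g (suc k) lt))
        (+-identityʳ _))

      G-1≈S : ∀ d n → G d F.1# n ≈ S d (suc n)
      G-1≈S d n = trans (G-coefficient d F.1# n) (trans (*-congʳ (trans (^-congˡ n ι-1) (1^n≈1 n))) (*-identityˡ _))

      G-1-coefficient : ∀ d n → D d * S d (suc n) - (G d F.1# ⊛ CA.e d x) n ≈ const (ε d) n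
      G-1-coefficient d n = begin
        D d * S d (suc n) - (g ⊛ e) n                      ≈⟨ +-cong (*-congˡ (G-1≈S d n)) (-‿cong (*-identityˡ _)) ⟨
        D d * g n - 1# * (g ⊛ e) n                         ≈⟨ +-congˡ (-‿cong (*-congʳ ι-1)) ⟨
        D d * g n - ι F.1# * (g ⊛ e) n                     ≈⟨ +-cong (const-⊛ (D d) g n) (-‿cong (const-⊛ (ι F.1#) (g ⊛ e) n)) ⟨
        (const (D d) ⊛ g) n - (const (ι F.1#) ⊛ (g ⊛ e)) n
          ≈⟨ expand-difference g (const (D d)) (const (ι F.1#)) e n ⟨
        (g ⊛ (const (D d) ⊖ (const (ι F.1#) ⊛ e))) n       ≈⟨ G-inverse d F.1# n ⟩
        const (ε d) n                                      ∎
        where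
        g e : PS
        g = G d F.1#
        e = CA.e d x

      S-1-D : ∀ d → D d * S d 1 ≈ ε d
      S-1-D d = begin
        D d * S d 1                                  ≈⟨ +-identityʳ _ ⟨
        D d * S d 1 + 0#                             ≈⟨ +-congˡ (trans (-‿cong (e-coefficient-0 d (G d F.1#))) -0#≈0#) ⟨
        D d * S d 1 - (G d F.1# ⊛ CA.e d x) 0        ≈⟨ G-1-coefficient d 0 ⟩
        ε d                                          ∎
        where open import Algebra.Properties.Ring ring using (-0#≈0#)

      -- The first power sum serves as the inverse of ℓ_d: it equals ε_d / D_d by the constant
      -- coefficient of the generating series, and ε_d ℓ_d = D_d.
      ℓ⁻¹ : ℕ → Carrier
      ℓ⁻¹ d = S d 1

      ℓ⁻¹-ℓ : ∀ d → ℓ⁻¹ d * ℓ d ≈ 1#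
      ℓ⁻¹-ℓ d = unit-cancelˡ (D-inverse d) (begin
        D d * (ℓ⁻¹ d * ℓ d)  ≈⟨ *-assoc _ _ _ ⟨
        D d * ℓ⁻¹ d * ℓ d    ≈⟨ *-congʳ (S-1-D d) ⟩
        ε d * ℓ d           ≈⟨ ε-ℓ d ⟩
        D d                 ≈⟨ *-identityʳ _ ⟨
        D d * 1#            ∎)

      -- In degrees below q, multiplication by e_d(x) amounts to multiplication by ε_d x, so
      -- consecutive power sums differ by the factor ε_d / D_d = 1/ℓ_d. The bound still admits the
      -- exponent q.
      S-power : ∀ d k → k ℕ.< q → S d (suc k) ≈ ℓ⁻¹ d ^ suc k
      S-power d zero    _  = sym (*-identityʳ _)
      S-power d (suc k) lt = unit-cancelˡ (D-inverse d) (begin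
        D d * S d (suc (suc k))                                                ≈⟨ solve 2 (λ a b → a := a :- b :+ b) refl _ _ ⟩
        D d * S d (suc (suc k)) - (G d F.1# ⊛ CA.e d x) (suc k) + (G d F.1# ⊛ CA.e d x) (suc k)
          ≈⟨ +-cong (G-1-coefficient d (suc k)) (e-coefficient-<q d (G d F.1#) k lt) ⟩
        0# + ε d * G d F.1# k                                                  ≈⟨ +-identityˡ _ ⟩
        ε d * G d F.1# k                                                       ≈⟨ *-cong (sym (S-1-D d)) (G-1≈S d k) ⟩
        D d * ℓ⁻¹ d * S d (suc k)                                               ≈⟨ trans (*-assoc _ _ _) (*-congˡ (*-congˡ (S-power d k (ℕₚ.<-trans (ℕₚ.n<1+n k) lt)))) ⟩
        D d * (ℓ⁻¹ d * ℓ⁻¹ d ^ suc k)                                            ∎)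
      T : ℕ → ℕ → Carrier
      T d s = sumTo d (λ j → S j s)

      T-frobenius : ∀ d s → T d (s ℕ.* q) ≈ φ (T d s)
      T-frobenius zero    s = sym φ-0
      T-frobenius (suc d) s = trans (+-cong (T-frobenius d s) (S-frobenius d s)) (sym (φ-+ _ _))

      private
        Ψ : ℕ → PS
        Ψ = Φ x G D⁻¹ D-inverse G-inverse

      Ψ-0 : ∀ d → Ψ d 0 ≈ 1#
      Ψ-0 zero    = refl
      Ψ-0 (suc d) = trans (+-cong (Ψ-0 d) (trans (-‿cong (x-⊛-zero (∑A.∑ F.elems (λ c → const (ι c) ⊛ G d c)))) -0#≈0#)) (+-identityʳ _)
        where open import Algebra.Properties.Ring ring using (-0#≈0#)

      Ψ-suc : ∀ d k → ∑ F.elems (λ c → ι c ^ suc k) ≈ - 1# → Ψ d (suc k) ≈ T d (suc k)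
      Ψ-suc zero    k _  = refl
      Ψ-suc (suc d) k eq = +-cong (Ψ-suc d k eq) (begin
        - (x ⊛ ∑A.∑ F.elems (λ c → const (ι c) ⊛ G d c)) (suc k)   ≈⟨ -‿cong (x-⊛-suc (∑A.∑ F.elems (λ c → const (ι c) ⊛ G d c)) k) ⟩
        - ∑A.∑ F.elems (λ c → const (ι c) ⊛ G d c) k                ≡⟨ ≡.cong -_ (∑A-coefficient F.elems _ k) ⟩
        - ∑ F.elems (λ c → (const (ι c) ⊛ G d c) k)                 ≈⟨ -‿cong (∑-cong F.elems (λ c → trans (const-⊛ (ι c) (G d c) k)
             (trans (*-congˡ (G-coefficient d c k)) (sym (*-assoc _ _ _))))) ⟩
        - ∑ F.elems (λ c → ι c ^ suc k * S d (suc k))               ≈⟨ -‿cong (∑-*ʳ F.elems _ _) ⟨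
        - (∑ F.elems (λ c → ι c ^ suc k) * S d (suc k))             ≈⟨ -‿cong (*-congʳ eq) ⟩
        - (- 1# * S d (suc k))                                      ≈⟨ solve 1 (λ s → :- (:- con (pos 1) :* s) := s) refl _ ⟩
        S d (suc k)                                                 ∎)

      -- Multiples of q-1 play the role of even numbers: at a positive one the sum of c^k over the
      -- field is -1, which cancels the sign in the recursion of `Φ`.
      Ψ-even : ∀ d m → 0 ℕ.< m → Ψ d (q-1 ℕ.* m) ≈ T d (q-1 ℕ.* m)
      Ψ-even d (suc m) _ = ≡.subst (λ n → Ψ d n ≈ T d n) (ℕₚ.suc-pred _ {{nz}})
        (Ψ-suc d (ℕ.pred (q-1 ℕ.* suc m)) (trans (∑-cong F.elems (λ c → reflexive (≡.cong (ι c ^_) (ℕₚ.suc-pred _ {{nz}})))) (∑-ι^[[q-1]m] m)))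
        where
        nz : ℕ.NonZero (q-1 ℕ.* suc m)
        nz = ℕ.>-nonZero (ℕₚ.*-mono-< {0} {q-1} {0} {suc m} 0<q-1 (s≤s z≤n))

      Ψ-e-suc : ∀ d k → 0 ℕ.< k → (Ψ d ⊛ CA.e d x) (suc k) ≈ 0#
      Ψ-e-suc d (suc k) _ = trans (Φ-e x G D⁻¹ D-inverse G-inverse d (suc (suc k)))
        (trans (const-⊛ (ε d) x (suc (suc k))) (zeroʳ _))

      B Γ : ℕ → Carrier
      B d = β d * ε⁻¹ d
      Γ d = γ d * ε⁻¹ d

      private
        0<[q-1]* : ∀ m → 0 ℕ.< q-1 ℕ.* suc m
        0<[q-1]* m = ℕₚ.*-mono-< {0} {q-1} {0} {suc m} 0<q-1 (s≤s z≤n)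

      -- The product of `Ψ d` with e_d(x) is ε_d x, so its coefficient in degree (q-1)(m+1) + 1 = q
      -- + (q-1)m is zero. As m < q, this degree is below q² and only the first two terms of e_d
      -- take part.
      Ψ-step : ∀ d m → m ℕ.< q → Ψ d (q-1 ℕ.* suc m) ≈ - B d * Ψ d (q-1 ℕ.* m)
      Ψ-step d m m<q = unit-cancelˡ (ε-inverse d) (begin
        ε d * f k                           ≈⟨ solve 2 (λ a b → a := (a :+ b) :- b) refl _ _ ⟩
        (ε d * f k + β d * f k′) - β d * f k′   ≈⟨ +-congʳ (trans (sym (e-coefficient-<qq d f k k′ index bound)) (Ψ-e-suc d k (0<[q-1]* m))) ⟩
        0# - β d * f k′                     ≈⟨ +-congˡ (-‿cong (trans (*-congʳ (*-identityʳ _)) refl)) ⟨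
        0# - β d * 1# * f k′                ≈⟨ +-congˡ (-‿cong (*-congʳ (*-congˡ (ε-inverse d)))) ⟨
        0# - β d * (ε d * ε⁻¹ d) * f k′     ≈⟨ solve 4 (λ b e i f → con (pos 0) :- b :* (e :* i) :* f := e :* (:- (b :* i) :* f)) refl (β d) (ε d) (ε⁻¹ d) (f k′) ⟩
        ε d * (- B d * f k′)                ∎)
        where
        f = Ψ d
        k = q-1 ℕ.* suc m
        k′ = q-1 ℕ.* m
        index : suc k ≡ q ℕ.+ k′
        index = ≡.cong suc (ℕₚ.*-suc q-1 m)
        bound : suc k ℕ.< q ℕ.* q
        bound = ≡.subst (ℕ._< q ℕ.* q) (≡.sym index) (ℕₚ.+-monoʳ-< q (ℕₚ.*-monoʳ-< q-1 {{ℕ.>-nonZero 0<q-1}} m<q))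

      Ψ-power : ∀ d m → m ℕ.≤ q → Ψ d (q-1 ℕ.* m) ≈ (- B d) ^ m
      Ψ-power d zero    _   = trans (reflexive (≡.cong (Ψ d) (ℕₚ.*-zeroʳ q-1))) (Ψ-0 d)
      Ψ-power d (suc m) m<q = trans (Ψ-step d m m<q) (*-congˡ (Ψ-power d m (ℕₚ.<⇒≤ m<q)))

      T-power : ∀ d m → 0 ℕ.< m → m ℕ.≤ q → T d (q-1 ℕ.* m) ≈ (- B d) ^ m
      T-power d m 0<m m≤q = trans (sym (Ψ-even d m 0<m)) (Ψ-power d m m≤q)

      -- With k = (q-1)(q²+1) the degree k + 1 lies below q³, so three terms of e_d take part and
      -- their combination is zero. The two earlier coefficients have indices k + 1 - q = (q-1)q²
      -- and k + 1 - q² = (q-1)²q; both are reduced by Frobenius to the range of `T-power`.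
      T-formula : ∀ d → T d (q-1 ℕ.* suc (q ℕ.* q)) ≈ φ (B d ^ q-1) * (B d * φ (B d) - Γ d)
      T-formula d = unit-cancelˡ (ε-inverse d) (begin
        ε d * T d k                                    ≈⟨ *-congˡ (Ψ-even d (suc (q ℕ.* q)) (s≤s z≤n)) ⟨
        ε d * f k                                      ≈⟨ solve 3 (λ a b c → a := (a :+ b :+ c) :- (b :+ c)) refl _ _ _ ⟩
        (ε d * f k + β d * f k₁ + γ d * f k₂) - (β d * f k₁ + γ d * f k₂)
          ≈⟨ +-cong (trans (sym (e-coefficient-<qqq d f k k₁ k₂ index₁ index₂ bound)) (Ψ-e-suc d k (0<[q-1]* (q ℕ.* q))))
               (-‿cong (+-cong (*-congˡ first) (*-congˡ second))) ⟩
        0# - (β d * - φ (φ (B d)) + γ d * φ (B d ^ q-1))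
          ≈⟨ solve 4 (λ b c p r → con (pos 0) :- (b :* :- p :+ c :* r) := con (pos 1) :* (b :* p :- c :* r)) refl _ _ _ _ ⟩
        1# * (β d * φ (φ (B d)) - γ d * φ (B d ^ q-1))
          ≈⟨ *-cong (sym (ε-inverse d)) (+-congʳ (*-congˡ (φ-* (B d) (B d ^ q-1)))) ⟩
        ε d * ε⁻¹ d * (β d * (φ (B d) * φ (B d ^ q-1)) - γ d * φ (B d ^ q-1))
          ≈⟨ solve 6 (λ e i b c p r → e :* i :* (b :* (p :* r) :- c :* r) := e :* (r :* ((b :* i) :* p :- c :* i))) refl _ _ _ _ _ _ ⟩
        ε d * (φ (B d ^ q-1) * (B d * φ (B d) - Γ d)) ∎)
        where
        f = Ψ d
        k k₁ k₂ : ℕ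
        k = q-1 ℕ.* suc (q ℕ.* q)
        k₁ = q-1 ℕ.* (q ℕ.* q)
        k₂ = q-1 ℕ.* (q-1 ℕ.* q)
        index₁ : suc k ≡ q ℕ.+ k₁
        index₁ = ≡.cong suc (ℕₚ.*-suc q-1 (q ℕ.* q))
        index₂ : suc k ≡ q ℕ.* q ℕ.+ k₂
        index₂ = ℕS.solve 1 (λ n → let q = ℕS.con 1 ℕS.:+ n in
          ℕS.con 1 ℕS.:+ n ℕS.:* (ℕS.con 1 ℕS.:+ q ℕS.:* q) ℕS.:= q ℕS.:* q ℕS.:+ n ℕS.:* (n ℕS.:* q)) ≡.refl q-1
          where module ℕS = ℕSolver.+-*-Solver
        bound : suc k ℕ.< q ℕ.* q ℕ.* q
        bound = ≡.subst₂ ℕ._<_ (≡.sym index₂) (ℕS.solve 1 (λ n → let q = ℕS.con 1 ℕS.:+ n in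
            q ℕS.:* q ℕS.:+ n ℕS.:* (q ℕS.:* q) ℕS.:= q ℕS.:* q ℕS.:* q) ≡.refl q-1)
          (ℕₚ.+-monoʳ-< (q ℕ.* q) (ℕₚ.*-monoʳ-< q-1 {{ℕ.>-nonZero 0<q-1}} (ℕₚ.*-monoˡ-< q (ℕₚ.n<1+n q-1))))
          where module ℕS = ℕSolver.+-*-Solver
        first : f k₁ ≈ - φ (φ (B d))
        first = begin
          f (q-1 ℕ.* (q ℕ.* q))       ≈⟨ Ψ-even d (q ℕ.* q) (s≤s z≤n) ⟩
          T d (q-1 ℕ.* (q ℕ.* q))     ≡⟨ ≡.cong (T d) (≡.sym (ℕₚ.*-assoc q-1 q q)) ⟩
          T d (q-1 ℕ.* q ℕ.* q)       ≈⟨ trans (T-frobenius d (q-1 ℕ.* q)) (φ-cong (T-frobenius d q-1)) ⟩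
          φ (φ (T d q-1))             ≡⟨ ≡.cong (λ n → φ (φ (T d n))) (≡.sym (ℕₚ.*-identityʳ q-1)) ⟩
          φ (φ (T d (q-1 ℕ.* 1)))     ≈⟨ φ-cong (φ-cong (trans (T-power d 1 (s≤s z≤n) (s≤s z≤n)) (*-identityʳ _))) ⟩
          φ (φ (- B d))               ≈⟨ trans (φ-cong (φ-neg _)) (φ-neg _) ⟩
          - φ (φ (B d))               ∎
        second : f k₂ ≈ φ (B d ^ q-1)
        second = begin
          f (q-1 ℕ.* (q-1 ℕ.* q))       ≈⟨ Ψ-even d (q-1 ℕ.* q) (ℕₚ.*-mono-< {0} {q-1} {0} {q} 0<q-1 (s≤s z≤n)) ⟩
          T d (q-1 ℕ.* (q-1 ℕ.* q))     ≡⟨ ≡.cong (T d) (≡.sym (ℕₚ.*-assoc q-1 q-1 q)) ⟩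
          T d (q-1 ℕ.* q-1 ℕ.* q)       ≈⟨ T-frobenius d (q-1 ℕ.* q-1) ⟩
          φ (T d (q-1 ℕ.* q-1))         ≈⟨ φ-cong (T-power d q-1 0<q-1 (ℕₚ.n≤1+n q-1)) ⟩
          φ ((- B d) ^ q-1)             ≈⟨ φ-cong (neg-^[q-1] (B d)) ⟩
          φ (B d ^ q-1)                 ∎

      -- Closed forms of the Carlitz coefficients and the telescoping sums

      br-ℓ⁻¹ : ∀ d → br (suc d) * ℓ⁻¹ (suc d) ≈ - ℓ⁻¹ d
      br-ℓ⁻¹ d = begin
        br (suc d) * ℓ⁻¹ (suc d)                              ≈⟨ *-identityˡ _ ⟨
        1# * (br (suc d) * ℓ⁻¹ (suc d))                       ≈⟨ *-congʳ (ℓ⁻¹-ℓ d) ⟨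
        ℓ⁻¹ d * ℓ d * (br (suc d) * ℓ⁻¹ (suc d))               ≈⟨ solve 4 (λ m l b n → m :* l :* (b :* n) := :- (m :* (n :* :- (b :* l)))) refl _ _ _ _ ⟩
        - (ℓ⁻¹ d * (ℓ⁻¹ (suc d) * ℓ (suc d)))                  ≈⟨ -‿cong (trans (*-congˡ (ℓ⁻¹-ℓ (suc d))) (*-identityʳ _)) ⟩
        - ℓ⁻¹ d                                               ∎

      br-2 : br 2 ≈ φ (br 1) + br 1
      br-2 = br-suc 1

      br-+2 : ∀ e → br (suc (suc e)) ≈ φ (φ (br e)) + br 2
      br-+2 e = begin
        br (suc (suc e))                       ≈⟨ br-suc (suc e) ⟩
        φ (br (suc e)) + br 1                  ≈⟨ +-congʳ (trans (φ-cong (br-suc e)) (φ-+ _ _)) ⟩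
        φ (φ (br e)) + φ (br 1) + br 1         ≈⟨ trans (+-assoc _ _ _) (+-congˡ (sym br-2)) ⟩
        φ (φ (br e)) + br 2                    ∎

      br-+3 : ∀ e → br (suc (suc (suc e))) ≈ φ (φ (φ (br e))) + br 3
      br-+3 e = begin
        br (suc (suc (suc e)))                      ≈⟨ br-suc (suc (suc e)) ⟩
        φ (br (suc (suc e))) + br 1                 ≈⟨ +-congʳ (trans (φ-cong (br-+2 e)) (φ-+ _ _)) ⟩
        φ (φ (φ (br e))) + φ (br 2) + br 1          ≈⟨ trans (+-assoc _ _ _) (+-congˡ (sym (br-suc 2))) ⟩
        φ (φ (φ (br e))) + br 3                     ∎

      φ-ℓ-suc : ∀ d → φ (ℓ (suc d)) ≈ - (φ (br (suc d)) * φ (ℓ d))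
      φ-ℓ-suc d = trans (φ-neg _) (-‿cong (φ-* _ _))

      -- Carlitz's coefficient of z^{q^i} in e_d is D_d / (D_i ℓ_{d-i}^{q^i}); here i = 1 and D_1 =
      -- [1]. This form uses [d] ℓ_{d-1} = - ℓ_d, so that [0] = 0 covers d = 0. It is proved
      -- together with `β-suc`, each step of which needs the previous coefficient in this form.
      β-ℓ : ∀ d → β d * br 1 * φ (ℓ d) ≈ - (φ (br d) * D d)
      β-suc : ∀ d → β (suc d) * br 1 * φ (ℓ d) ≈ D (suc d)

      β-suc d = begin
        (φ (ε d) - D d ^ q-1 * β d) * br 1 * φ (ℓ d)
          ≈⟨ solve 5 (λ e P b a l → (e :- P :* b) :* a :* l := a :* (e :* l) :- P :* (b :* a :* l)) refl _ _ _ _ _ ⟩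
        br 1 * (φ (ε d) * φ (ℓ d)) - D d ^ q-1 * (β d * br 1 * φ (ℓ d))
          ≈⟨ +-cong (*-congˡ (trans (sym (φ-* _ _)) (φ-cong (ε-ℓ d)))) (-‿cong (*-congˡ (β-ℓ d))) ⟩
        br 1 * (D d * D d ^ q-1) - D d ^ q-1 * - (φ (br d) * D d)
          ≈⟨ solve 4 (λ a D P b → a :* (D :* P) :- P :* :- (b :* D) := (b :+ a) :* (D :* P)) refl _ _ _ _ ⟩
        (φ (br d) + br 1) * φ (D d)
          ≈⟨ *-congʳ (br-suc d) ⟨
        br (suc d) * φ (D d) ∎

      β-ℓ zero    = begin
        0# * br 1 * φ 1#          ≈⟨ trans (*-congʳ (zeroˡ _)) (zeroˡ _) ⟩
        0#                        ≈⟨ solve 1 (λ d → con (pos 0) := :- (con (pos 0) :* d)) refl (D 0) ⟩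
        - (0# * D 0)              ≈⟨ -‿cong (*-congʳ (trans (φ-cong br-zero) φ-0)) ⟨
        - (φ (br 0) * D 0)        ∎
      β-ℓ (suc d) = begin
        β (suc d) * br 1 * φ (ℓ (suc d))                    ≈⟨ *-congˡ (φ-ℓ-suc d) ⟩
        β (suc d) * br 1 * - (φ (br (suc d)) * φ (ℓ d))     ≈⟨ solve 3 (λ x b l → x :* :- (b :* l) := :- (b :* (x :* l))) refl _ _ _ ⟩
        - (φ (br (suc d)) * (β (suc d) * br 1 * φ (ℓ d)))   ≈⟨ -‿cong (*-congˡ (β-suc d)) ⟩
        - (φ (br (suc d)) * D (suc d))                      ∎

      -- The same closed form for i = 2, where D_2 = [2] [1]^q. The factor [d]^{q²} again makes the
      -- initial case, with γ_1 = 0, part of the formula.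
      γ-suc : ∀ d → γ (suc d) * (br 2 * φ (br 1)) * φ (φ (ℓ d)) ≈ - (φ (φ (br d)) * D (suc d))
      γ-suc zero = begin
        (φ 0# - D 0 ^ q-1 * 0#) * (br 2 * φ (br 1)) * φ (φ 1#)    ≈⟨ *-congʳ (*-congʳ (+-congʳ φ-0)) ⟩
        (0# - D 0 ^ q-1 * 0#) * (br 2 * φ (br 1)) * φ (φ 1#)
          ≈⟨ solve 4 (λ P b l d → (con (pos 0) :- P :* con (pos 0)) :* b :* l := :- (con (pos 0) :* d)) refl _ _ _ (D 1) ⟩
        - (0# * D 1)                                              ≈⟨ -‿cong (*-congʳ (trans (φ-cong (trans (φ-cong br-zero) φ-0)) φ-0)) ⟨
        - (φ (φ (br 0)) * D 1)                                    ∎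
      γ-suc (suc d) = begin
        (φ (β (suc d)) - P * γ (suc d)) * (br 2 * φ (br 1)) * φ (φ (ℓ (suc d)))
          ≈⟨ *-congˡ (trans (φ-cong (φ-ℓ-suc d)) (trans (φ-neg _) (-‿cong (φ-* _ _)))) ⟩
        (φ (β (suc d)) - P * γ (suc d)) * (br 2 * φ (br 1)) * - (φ (φ (br (suc d))) * φ (φ (ℓ d)))
          ≈⟨ solve 7 (λ b P g b₂ b₁ r l → (b :- P :* g) :* (b₂ :* b₁) :* :- (r :* l) :=
               :- (r :* (b₂ :* (b :* b₁ :* l) :- P :* (g :* (b₂ :* b₁) :* l)))) refl _ _ _ _ _ _ _ ⟩
        - (φ (φ (br (suc d))) * (br 2 * (φ (β (suc d)) * φ (br 1) * φ (φ (ℓ d))) - P * (γ (suc d) * (br 2 * φ (br 1)) * φ (φ (ℓ d)))))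
          ≈⟨ -‿cong (*-congˡ (+-cong (*-congˡ (trans (sym (trans (φ-* _ _) (*-congʳ (φ-* _ _)))) (φ-cong (β-suc d)))) (-‿cong (*-congˡ (γ-suc d))))) ⟩
        - (φ (φ (br (suc d))) * (br 2 * (D (suc d) * P) - P * - (φ (φ (br d)) * D (suc d))))
          ≈⟨ -‿cong (*-congˡ (solve 4 (λ b D P c → b :* (D :* P) :- P :* :- (c :* D) := (c :+ b) :* (D :* P)) refl _ _ _ _)) ⟩
        - (φ (φ (br (suc d))) * ((φ (φ (br d)) + br 2) * φ (D (suc d))))
          ≈⟨ -‿cong (*-congˡ (*-congʳ (br-+2 d))) ⟨
        - (φ (φ (br (suc d))) * D (suc (suc d))) ∎
        where P = D (suc d) ^ q-1

      private
        φ-ℓ⁻¹-ℓ : ∀ d → φ (ℓ⁻¹ d) * φ (ℓ d) ≈ 1#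
        φ-ℓ⁻¹-ℓ d = trans (sym (φ-* _ _)) (trans (φ-cong (ℓ⁻¹-ℓ d)) φ-1)

        D-ε⁻¹ : ∀ d → D d * ε⁻¹ d ≈ ℓ d
        D-ε⁻¹ d = begin
          D d * (ℓ d * D⁻¹ d)    ≈⟨ solve 3 (λ D l i → D :* (l :* i) := l :* (D :* i)) refl _ _ _ ⟩
          ℓ d * (D d * D⁻¹ d)    ≈⟨ trans (*-congˡ (D-inverse d)) (*-identityʳ _) ⟩
          ℓ d                    ∎

      B-suc : ∀ e → br 1 * B (suc e) ≈ ℓ (suc e) * φ (ℓ⁻¹ e)
      B-suc e = begin
        br 1 * (β (suc e) * ε⁻¹ (suc e))
          ≈⟨ trans (*-congˡ (φ-ℓ⁻¹-ℓ e)) (*-identityʳ _) ⟨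
        br 1 * (β (suc e) * ε⁻¹ (suc e)) * (φ (ℓ⁻¹ e) * φ (ℓ e))
          ≈⟨ solve 5 (λ a b i m l → a :* (b :* i) :* (m :* l) := (b :* a :* l) :* i :* m) refl _ _ _ _ _ ⟩
        β (suc e) * br 1 * φ (ℓ e) * ε⁻¹ (suc e) * φ (ℓ⁻¹ e)
          ≈⟨ *-congʳ (trans (*-congʳ (β-suc e)) (D-ε⁻¹ (suc e))) ⟩
        ℓ (suc e) * φ (ℓ⁻¹ e) ∎

      Γ-suc : ∀ e → br 2 * φ (br 1) * Γ (suc e) ≈ - (φ (φ (br e)) * (ℓ (suc e) * φ (φ (ℓ⁻¹ e))))
      Γ-suc e = begin
        br 2 * φ (br 1) * (γ (suc e) * ε⁻¹ (suc e))
          ≈⟨ trans (*-congˡ (trans (sym (φ-* _ _)) (trans (φ-cong (φ-ℓ⁻¹-ℓ e)) φ-1))) (*-identityʳ _) ⟨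
        br 2 * φ (br 1) * (γ (suc e) * ε⁻¹ (suc e)) * (φ (φ (ℓ⁻¹ e)) * φ (φ (ℓ e)))
          ≈⟨ solve 5 (λ a b i m l → a :* (b :* i) :* (m :* l) := (b :* a :* l) :* i :* m) refl _ _ _ _ _ ⟩
        γ (suc e) * (br 2 * φ (br 1)) * φ (φ (ℓ e)) * ε⁻¹ (suc e) * φ (φ (ℓ⁻¹ e))
          ≈⟨ *-congʳ (*-congʳ (γ-suc e)) ⟩
        - (φ (φ (br e)) * D (suc e)) * ε⁻¹ (suc e) * φ (φ (ℓ⁻¹ e))
          ≈⟨ solve 4 (λ b D i m → :- (b :* D) :* i :* m := :- (b :* ((D :* i) :* m))) refl _ _ _ _ ⟩
        - (φ (φ (br e)) * (D (suc e) * ε⁻¹ (suc e) * φ (φ (ℓ⁻¹ e))))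
          ≈⟨ -‿cong (*-congˡ (*-congʳ (D-ε⁻¹ (suc e)))) ⟩
        - (φ (φ (br e)) * (ℓ (suc e) * φ (φ (ℓ⁻¹ e)))) ∎

      -- After multiplication by [1]^q the closed forms apply, and ℓ_{e+1}^q / ℓ_e^q = - [e+1]^q = -
      -- ([e]^{q²} + [1]^q) by `φLm`. With [2] = [1]^q + [1] everything collapses: [2] ([e]^{q²} +
      -- [1]^q) - [1] [e]^{q²} = [1]^q ([e]^{q²} + [2]) = [1]^q [e+2].
      BB-Γ : ∀ e → br 1 * br 2 * (B (suc e) * φ (B (suc e)) - Γ (suc e)) ≈ ℓ (suc (suc e)) * φ (φ (ℓ⁻¹ e))
      BB-Γ e = unit-cancelˡ (trans (sym (φ-* _ _)) (trans (φ-cong (br-inverse 0)) φ-1)) (begin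
        φ a * (a * b * (B (suc e) * φ (B (suc e)) - Γ (suc e)))
          ≈⟨ solve 6 (λ a′ a b B B′ Γ → a′ :* (a :* b :* (B :* B′ :- Γ)) := b :* (a :* B) :* (a′ :* B′) :- a :* (b :* a′ :* Γ)) refl _ _ _ _ _ _ ⟩
        b * (a * B (suc e)) * (φ a * φ (B (suc e))) - a * (b * φ a * Γ (suc e))
          ≈⟨ +-cong (*-cong (*-congˡ (B-suc e)) (trans (sym (φ-* _ _)) (trans (φ-cong (B-suc e)) (φ-* _ _)))) (-‿cong (*-congˡ (Γ-suc e))) ⟩
        b * (L * φ m) * (φ L * φ (φ m)) - a * - (φ (φ (br e)) * (L * φ (φ m)))
          ≈⟨ solve 7 (λ b L m₁ L₁ m₂ a c → b :* (L :* m₁) :* (L₁ :* m₂) :- a :* :- (c :* (L :* m₂)) := (b :* (L₁ :* m₁) :+ a :* c) :* (L :* m₂)) refl _ _ _ _ _ _ _ ⟩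
        (b * (φ L * φ m) + a * φ (φ (br e))) * (L * φ (φ m))
          ≈⟨ *-congʳ (+-cong (*-cong br-2 (trans (sym (φ-* _ _)) (φLm e))) refl) ⟩
        ((φ a + a) * - (φ (φ (br e)) + φ a) + a * φ (φ (br e))) * (L * φ (φ m))
          ≈⟨ solve 5 (λ a′ a c L m → ((a′ :+ a) :* :- (c :+ a′) :+ a :* c) :* (L :* m) := a′ :* (:- ((c :+ (a′ :+ a)) :* L) :* m)) refl _ _ _ _ _ ⟩
        φ a * (- ((φ (φ (br e)) + (φ a + a)) * L) * φ (φ m))
          ≈⟨ *-congˡ (*-congʳ (-‿cong (*-congʳ (trans (br-+2 e) (+-congˡ br-2))))) ⟨
        φ a * (ℓ (suc (suc e)) * φ (φ m)) ∎)
        where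
        a = br 1
        b = br 2
        L = ℓ (suc e)
        m = ℓ⁻¹ e
        φLm : ∀ e → φ (ℓ (suc e) * ℓ⁻¹ e) ≈ - (φ (φ (br e)) + φ (br 1))
        φLm e = begin
          φ (- (br (suc e) * ℓ e) * ℓ⁻¹ e)       ≈⟨ φ-cong (solve 3 (λ b l m → :- (b :* l) :* m := :- (b :* (m :* l))) refl _ _ _) ⟩
          φ (- (br (suc e) * (ℓ⁻¹ e * ℓ e)))     ≈⟨ φ-cong (-‿cong (trans (*-congˡ (ℓ⁻¹-ℓ e)) (*-identityʳ _))) ⟩
          φ (- br (suc e))                      ≈⟨ φ-neg _ ⟩
          - φ (br (suc e))                      ≈⟨ -‿cong (trans (φ-cong (br-suc e)) (φ-+ _ _)) ⟩
          - (φ (φ (br e)) + φ (br 1))           ∎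

      S₂ T₃ : ℕ → Carrier
      S₂ d = S d (q-1 ℕ.* q)
      T₃ d = T d (q-1 ℕ.* suc (q ℕ.* q))

      S₂-formula : ∀ d → S₂ d ≈ φ (ℓ⁻¹ d ^ q-1)
      S₂-formula d = trans (S-frobenius d q-1) (φ-cong (≡.subst (λ n → S d n ≈ ℓ⁻¹ d ^ n) (ℕₚ.suc-pred q-1 {{nz}})
        (S-power d (ℕ.pred q-1) (ℕₚ.<-trans (ℕₚ.≤-reflexive (ℕₚ.suc-pred q-1 {{nz}})) (ℕₚ.n<1+n q-1)))))
        where
        nz = ℕ.>-nonZero 0<q-1

      -- This is [2] [1]^{q²-q+1}, arranged by use: [2] [1] clears the denominators in `BB-Γ`, and
      -- [1]^{q(q-1)} those of B^{q(q-1)}.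
      K : Carrier
      K = br 2 * (br 1 * φ (br 1 ^ q-1))

      -- By `B-suc`, [1] B_{e+1} / ℓ_{e+1} = 1 / ℓ_e^q. Hence the three powers with exponent q(q-1)
      -- multiply to (1 / ℓ_e^{q²})^{q-1}, which raises the 1 / ℓ_e^{q²} of `BB-Γ` to 1 / ℓ_e^{q³}.
      K-term : ∀ e → K * (S₂ (suc e) * T₃ (suc e)) ≈ ℓ (suc (suc e)) * φ (φ (φ (ℓ⁻¹ e)))
      K-term e = begin
        b * (a * φ (a ^ q-1)) * (S₂ (suc e) * T₃ (suc e))
          ≈⟨ *-congˡ (*-cong (S₂-formula (suc e)) (T-formula (suc e))) ⟩
        b * (a * φ (a ^ q-1)) * (φ (p ^ q-1) * (φ (B (suc e) ^ q-1) * X))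
          ≈⟨ solve 6 (λ b a A p B X → b :* (a :* A) :* (p :* (B :* X)) := (a :* b :* X) :* (A :* B :* p)) refl _ _ _ _ _ _ ⟩
        (a * b * X) * (φ (a ^ q-1) * φ (B (suc e) ^ q-1) * φ (p ^ q-1))
          ≈⟨ *-cong (BB-Γ e) (trans (sym (trans (φ-* _ _) (*-congʳ (φ-* _ _)))) (φ-cong powers)) ⟩
        ℓ (suc (suc e)) * φ (φ (ℓ⁻¹ e)) * φ (φ (ℓ⁻¹ e) ^ q-1)
          ≈⟨ trans (*-assoc _ _ _) (*-congˡ (sym (φ-* _ _))) ⟩
        ℓ (suc (suc e)) * φ (φ (φ (ℓ⁻¹ e))) ∎
        where
        a = br 1
        b = br 2
        p = ℓ⁻¹ (suc e)
        X = B (suc e) * φ (B (suc e)) - Γ (suc e)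
        powers : a ^ q-1 * B (suc e) ^ q-1 * p ^ q-1 ≈ φ (ℓ⁻¹ e) ^ q-1
        powers = begin
          a ^ q-1 * B (suc e) ^ q-1 * p ^ q-1     ≈⟨ trans (^-distrib-* _ _ q-1) (*-congʳ (^-distrib-* _ _ q-1)) ⟨
          (a * B (suc e) * p) ^ q-1               ≈⟨ ^-congˡ q-1 (begin
            a * B (suc e) * p                     ≈⟨ *-congʳ (B-suc e) ⟩
            ℓ (suc e) * φ (ℓ⁻¹ e) * p              ≈⟨ solve 3 (λ l f p → l :* f :* p := (p :* l) :* f) refl _ _ _ ⟩
            p * ℓ (suc e) * φ (ℓ⁻¹ e)              ≈⟨ trans (*-congʳ (ℓ⁻¹-ℓ (suc e))) (*-identityˡ _) ⟩
            φ (ℓ⁻¹ e)                              ∎) ⟩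
          φ (ℓ⁻¹ e) ^ q-1                          ∎

      G₂ : ℕ → Carrier
      G₂ d = sumTo d (λ e → S₂ e * T₃ e)

      private
        φ³ℓ⁻¹ : ℕ → Carrier
        φ³ℓ⁻¹ e = φ (φ (φ (ℓ⁻¹ e)))

        φ³-br-ℓ⁻¹ : ∀ e → φ (φ (φ (br (suc e)))) * φ³ℓ⁻¹ (suc e) ≈ - φ³ℓ⁻¹ e
        φ³-br-ℓ⁻¹ e = begin
          φ (φ (φ (br (suc e)))) * φ³ℓ⁻¹ (suc e)      ≈⟨ trans (φ-cong (trans (φ-cong (φ-* _ _)) (φ-* _ _))) (φ-* _ _) ⟨
          φ (φ (φ (br (suc e) * ℓ⁻¹ (suc e))))       ≈⟨ φ-cong (φ-cong (φ-cong (br-ℓ⁻¹ e))) ⟩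
          φ (φ (φ (- ℓ⁻¹ e)))                        ≈⟨ trans (φ-cong (trans (φ-cong (φ-neg _)) (φ-neg _))) (φ-neg _) ⟩
          - φ³ℓ⁻¹ e                                   ∎

      -- The closed form in two guises, for the mutual induction. Adding the next term to this one
      -- uses [e]^{q³} + [3] = [e+3] and gives `KG₂-suc-suc`; that becomes this one at e + 1 through
      -- [e+3] ℓ_{e+2} = - ℓ_{e+3} and 1/ℓ_e = - [e+1] / ℓ_{e+1}. At e = 0 both sides vanish: `T₃ 0`
      -- is an empty sum and [0] = 0.
      KG₂-suc : ∀ e → br 3 * (K * G₂ (suc e)) ≈ φ (φ (φ (br e))) * (ℓ (suc (suc e)) * φ³ℓ⁻¹ e)
      KG₂-suc-suc : ∀ e → br 3 * (K * G₂ (suc (suc e))) ≈ br (suc (suc (suc e))) * (ℓ (suc (suc e)) * φ³ℓ⁻¹ e)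

      KG₂-suc-suc e = begin
        br 3 * (K * (G₂ (suc e) + S₂ (suc e) * T₃ (suc e)))
          ≈⟨ solve 4 (λ b K G t → b :* (K :* (G :+ t)) := b :* (K :* G) :+ b :* (K :* t)) refl _ _ _ _ ⟩
        br 3 * (K * G₂ (suc e)) + br 3 * (K * (S₂ (suc e) * T₃ (suc e)))
          ≈⟨ +-cong (KG₂-suc e) (*-congˡ (K-term e)) ⟩
        φ (φ (φ (br e))) * (ℓ (suc (suc e)) * φ³ℓ⁻¹ e) + br 3 * (ℓ (suc (suc e)) * φ³ℓ⁻¹ e)
          ≈⟨ distribʳ _ _ _ ⟨
        (φ (φ (φ (br e))) + br 3) * (ℓ (suc (suc e)) * φ³ℓ⁻¹ e)
          ≈⟨ *-congʳ (br-+3 e) ⟨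
        br (suc (suc (suc e))) * (ℓ (suc (suc e)) * φ³ℓ⁻¹ e) ∎

      KG₂-suc zero    = begin
        br 3 * (K * (0# + S₂ 0 * 0#))          ≈⟨ solve 4 (λ b K s y → b :* (K :* (con (pos 0) :+ s :* con (pos 0))) := con (pos 0) :* y) refl _ _ _ _ ⟩
        0# * (ℓ 2 * φ³ℓ⁻¹ 0)                     ≈⟨ *-congʳ (trans (φ-cong (trans (φ-cong (trans (φ-cong br-zero) φ-0)) φ-0)) φ-0) ⟨
        φ (φ (φ (br 0))) * (ℓ 2 * φ³ℓ⁻¹ 0)       ∎
      KG₂-suc (suc e) = begin
        br 3 * (K * G₂ (suc (suc e)))                                                ≈⟨ KG₂-suc-suc e ⟩
        br (suc (suc (suc e))) * (ℓ (suc (suc e)) * φ³ℓ⁻¹ e)                           ≈⟨ solve 3 (λ b l f → b :* (l :* f) := :- (b :* l) :* :- f) refl _ _ _ ⟩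
        ℓ (suc (suc (suc e))) * - φ³ℓ⁻¹ e                                              ≈⟨ *-congˡ (φ³-br-ℓ⁻¹ e) ⟨
        ℓ (suc (suc (suc e))) * (φ (φ (φ (br (suc e)))) * φ³ℓ⁻¹ (suc e))               ≈⟨ solve 3 (λ l b f → l :* (b :* f) := b :* (l :* f)) refl _ _ _ ⟩
        φ (φ (φ (br (suc e)))) * (ℓ (suc (suc (suc e))) * φ³ℓ⁻¹ (suc e))               ∎

      Z : ℕ → Carrier
      Z N = sumTo N (λ d → S d 1 * G₂ d)

      ζ : ℕ → Carrier
      ζ N = sumTo N (λ d → S d (q ℕ.* q ℕ.* q))

      S-q³ : ∀ d → S d (q ℕ.* q ℕ.* q) ≈ φ³ℓ⁻¹ d
      S-q³ d = trans (S-frobenius d (q ℕ.* q)) (φ-cong (trans (S-frobenius d q) (φ-cong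
        (trans (reflexive (≡.cong (S d) (≡.sym (ℕₚ.*-identityˡ q)))) (S-frobenius d 1)))))

      -- The first power sum 1/ℓ_{e+2} cancels the ℓ_{e+2} of the inner closed form, so nothing but
      -- a multiple of S_e(q³) remains.
      K-outer : ∀ e → br 3 * (K * (S (suc (suc e)) 1 * G₂ (suc (suc e)))) ≈ br (suc (suc (suc e))) * φ³ℓ⁻¹ e
      K-outer e = begin
        br 3 * (K * (ℓ⁻¹ (suc (suc e)) * G₂ (suc (suc e))))               ≈⟨ solve 4 (λ b K l G → b :* (K :* (l :* G)) := l :* (b :* (K :* G))) refl _ _ _ _ ⟩
        ℓ⁻¹ (suc (suc e)) * (br 3 * (K * G₂ (suc (suc e))))               ≈⟨ *-congˡ (KG₂-suc-suc e) ⟩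
        ℓ⁻¹ (suc (suc e)) * (br (suc (suc (suc e))) * (ℓ (suc (suc e)) * φ³ℓ⁻¹ e))
          ≈⟨ solve 4 (λ m b l f → m :* (b :* (l :* f)) := (m :* l) :* (b :* f)) refl _ _ _ _ ⟩
        ℓ⁻¹ (suc (suc e)) * ℓ (suc (suc e)) * (br (suc (suc (suc e))) * φ³ℓ⁻¹ e)  ≈⟨ trans (*-congʳ (ℓ⁻¹-ℓ (suc (suc e)))) (*-identityˡ _) ⟩
        br (suc (suc (suc e))) * φ³ℓ⁻¹ e                                   ∎

      -- The outer terms d = 0 and d = 1 vanish because their inner sums do, so d = e + 2 with e ≤
      -- N. Such a term is [3] S_e(q³) + ([e] / ℓ_e)^{q³}, whose second part is - S_{e-1}(q³) for e
      -- ≥ 1 and zero for e = 0.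
      K-Z : ∀ N → br 3 * (K * Z (suc (suc (suc N)))) ≈ br 3 * ζ (suc N) - ζ N
      K-Z zero = begin
        br 3 * (K * (0# + S 0 1 * 0# + S 1 1 * (0# + S₂ 0 * 0#) + S 2 1 * G₂ 2))
          ≈⟨ solve 6 (λ b K s t r y → b :* (K :* (con (pos 0) :+ s :* con (pos 0) :+ t :* (con (pos 0) :+ r :* con (pos 0)) :+ y)) := b :* (K :* y)) refl _ _ _ _ _ _ ⟩
        br 3 * (K * (S 2 1 * G₂ 2))       ≈⟨ K-outer 0 ⟩
        br 3 * φ³ℓ⁻¹ 0                      ≈⟨ *-congˡ (S-q³ 0) ⟨
        br 3 * S 0 (q ℕ.* q ℕ.* q)        ≈⟨ solve 2 (λ b s → b :* s := b :* (con (pos 0) :+ s) :- con (pos 0)) refl _ _ ⟩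
        br 3 * (0# + S 0 (q ℕ.* q ℕ.* q)) - 0# ∎
      K-Z (suc N) = begin
        br 3 * (K * (Z (suc (suc (suc N))) + y))
          ≈⟨ solve 4 (λ b K G t → b :* (K :* (G :+ t)) := b :* (K :* G) :+ b :* (K :* t)) refl _ _ _ _ ⟩
        br 3 * (K * Z (suc (suc (suc N)))) + br 3 * (K * y)
          ≈⟨ +-cong (K-Z N) (trans (K-outer (suc N)) (*-congʳ (br-+3 (suc N)))) ⟩
        (br 3 * ζ (suc N) - ζ N) + (φ (φ (φ (br (suc N)))) + br 3) * φ³ℓ⁻¹ (suc N)
          ≈⟨ +-congˡ (trans (distribʳ _ _ _) (+-cong (trans (φ³-br-ℓ⁻¹ N) (-‿cong (sym (S-q³ N)))) (*-congˡ (sym (S-q³ (suc N)))))) ⟩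
        (br 3 * ζ (suc N) - ζ N) + (- s N + br 3 * s (suc N))
          ≈⟨ solve 5 (λ b z z′ s s′ → (b :* z :- z′) :+ (:- s :+ b :* s′) := b :* (z :+ s′) :- (z′ :+ s)) refl _ _ _ _ _ ⟩
        br 3 * (ζ (suc N) + s (suc N)) - (ζ N + s N) ∎
        where
        y = S (suc (suc (suc N))) 1 * G₂ (suc (suc (suc N)))
        s : ℕ → Carrier
        s d = S d (q ℕ.* q ℕ.* q)

  -- The power sums of the statement and their truncated identity

  open Series F F.elems using (PS; listPS; invPS; onePS; zeroPS; _⊛_; _⊕_; _⊖_; powPS; shift; sumPS; Zpart; zetaPS)
    renaming (S to SPS; sumTo to sumToF)
  open PowerSeries F F.elems

  tuples-length : ∀ d → All (λ cs → length cs ≡ d) (tuples d)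
  tuples-length zero    = ≡.refl ∷ []
  tuples-length (suc d) = Allₚ.concat⁺ (Allₚ.map⁺ (All.universal (λ c → Allₚ.map⁺ (All.map (≡.cong suc) (tuples-length d))) F.elems))

  listPS-∷ : ∀ c cs → listPS (c ∷ cs) ≋ const c ⊕ (x ⊛ listPS cs)
  listPS-∷ c cs zero    = F.sym (F.trans (F.+-congˡ (x-⊛-zero (listPS cs))) (F.+-identityʳ c))
  listPS-∷ c cs (suc n) = F.sym (F.trans (F.+-congˡ (x-⊛-suc (listPS cs) n)) (F.+-identityˡ _))

  S-low : ∀ d s i → i ℕ.< d → 0 ℕ.< s → SPS d s i F.≈ F.0#
  S-low d (suc s) i i<d _ = shift-< (d ℕ.* suc s) _ i (ℕₚ.<-≤-trans i<d (ℕₚ.m≤m*n d (suc s)))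

  -- The summand with d = N is a multiple of S_N(s), whose order is at least N s ≥ N > i.
  Zpart-stable : ∀ s ss N i → 0 ℕ.< s → i ℕ.< N → Zpart (s ∷ ss) N i F.≈ zetaPS (s ∷ ss) i
  Zpart-stable s ss (suc N) i 0<s (s≤s i≤N) = [ earlier , (λ { ≡.refl → F.refl }) ]′ (ℕₚ.m≤n⇒m<n∨m≡n i≤N)
    where
    earlier : i ℕ.< N → Zpart (s ∷ ss) (suc N) i F.≈ zetaPS (s ∷ ss) i
    earlier i<N = F.trans (F.+-cong (Zpart-stable s ss N i 0<s i<N)
      (F.trans (⊛-local i {SPS N s} {zeroPS} {Zpart ss N} (λ j j≤i → S-low N s j (ℕₚ.≤-<-trans j≤i i<N) 0<s) (λ _ _ → F.refl)) (zeroPS-⊛ (Zpart ss N) i)))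
      (F.+-identityʳ _)

  exponent₂ : q ℕ.* (q ℕ.∸ 1) ≡ q-1 ℕ.* q
  exponent₂ = ℕₚ.*-comm q q-1

  q^2≡qq : q ℕ.^ 2 ≡ q ℕ.* q
  q^2≡qq = ≡.cong (q ℕ.*_) (ℕₚ.*-identityʳ q)

  q^3≡qqq : q ℕ.^ 3 ≡ q ℕ.* q ℕ.* q
  q^3≡qqq = ≡.trans (≡.cong (q ℕ.*_) q^2≡qq) (≡.sym (ℕₚ.*-assoc q q q))

  exponent₃ : (q ℕ.^ 3 ℕ.∸ q ℕ.^ 2) ℕ.+ q ℕ.∸ 1 ≡ q-1 ℕ.* suc (q ℕ.* q)
  exponent₃ = begin
    (q ℕ.^ 3 ℕ.∸ q ℕ.^ 2) ℕ.+ q ℕ.∸ 1      ≡⟨ ≡.cong (λ n → n ℕ.+ q ℕ.∸ 1) (ℕₚ.m+n∸m≡n (q ℕ.^ 2) (q-1 ℕ.* q ℕ.^ 2)) ⟩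
    q-1 ℕ.* q ℕ.^ 2 ℕ.+ q ℕ.∸ 1            ≡⟨ ≡.cong (ℕ._∸ 1) (ℕₚ.+-suc (q-1 ℕ.* q ℕ.^ 2) q-1) ⟩
    q-1 ℕ.* q ℕ.^ 2 ℕ.+ q-1                ≡⟨ ℕₚ.+-comm _ q-1 ⟩
    q-1 ℕ.+ q-1 ℕ.* q ℕ.^ 2                ≡⟨ ≡.cong (λ n → q-1 ℕ.+ q-1 ℕ.* n) q^2≡qq ⟩
    q-1 ℕ.+ q-1 ℕ.* (q ℕ.* q)              ≡⟨ ≡.sym (ℕₚ.*-suc q-1 (q ℕ.* q)) ⟩
    q-1 ℕ.* suc (q ℕ.* q)                  ∎
    where open ≡.≡-Reasoning

  exponent-K : (q ℕ.^ 2 ℕ.∸ q) ℕ.+ 1 ≡ suc (q-1 ℕ.* q)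
  exponent-K = ≡.trans (≡.cong (λ n → n ℕ.∸ q ℕ.+ 1) q^2≡qq) (≡.trans (≡.cong (ℕ._+ 1) (ℕₚ.m+n∸m≡n q (q-1 ℕ.* q))) (ℕₚ.+-comm _ 1))

  s₂ s₃ : ℕ
  s₂ = q ℕ.* (q ℕ.∸ 1)
  s₃ = (q ℕ.^ 3 ℕ.∸ q ℕ.^ 2) ℕ.+ q ℕ.∸ 1

  ss : List ℕ
  ss = 1 ∷ s₂ ∷ s₃ ∷ []

  -- `R` is any ring to which power series map so that x becomes invertible with inverse θ; it is
  -- later the ring of Laurent series.
  module Truncated (R : CommutativeRing 0ℓ 0ℓ) (j : PS → CommutativeRing.Carrier R) (j-hom : IsHom ring-PS R j)
      (θ : CommutativeRing.Carrier R) (jx*θ≈1 : CommutativeRing._≈_ R (CommutativeRing._*_ R (j x) θ) (CommutativeRing.1# R)) where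
    open CommutativeRing R
    open IntegerSolver R
    open ListSum R
    open Hom ring-PS R j-hom using () renaming (ι-cong to j-cong; ι-+ to j-+; ι-* to j-*; ι-neg to j-neg; ι-0 to j-0; ι-1 to j-1; ι-^ to j-^)
    open import Algebra.Properties.CommutativeSemiring.Exp commutativeSemiring
    open import Relation.Binary.Reasoning.Setoid setoid

    ι : F.Carrier → Carrier
    ι = j ∘ const

    ι-hom : IsHom F R ι
    ι-hom = ∘-hom F ring-PS R const-hom j-hom

    open Bracket R ι ι-hom θ

    ξ : Carrier
    ξ = j x

    ξ^*θ^ : ∀ n → ξ ^ n * θ ^ n ≈ 1#
    ξ^*θ^ zero    = *-identityˡ 1#
    ξ^*θ^ (suc n) = trans (solve 4 (λ a b c d → a :* b :* (c :* d) := a :* c :* (b :* d)) refl _ _ _ _)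
      (trans (*-cong jx*θ≈1 (ξ^*θ^ n)) (*-identityˡ 1#))

    unit-inverse : ∀ u → u 0 F.≈ F.1# → j u * j (invPS u) ≈ 1#
    unit-inverse u u0≈1 = trans (sym (j-* _ _)) (trans (j-cong (invPS-inverse u u0≈1)) j-1)

    θ-u : ∀ n u → u 0 F.≈ F.1# → θ ^ n * j u * (ξ ^ n * j (invPS u)) ≈ 1#
    θ-u n u u0≈1 = trans (solve 4 (λ a b c d → a :* b :* (c :* d) := c :* a :* (b :* d)) refl _ _ _ _)
      (trans (*-cong (ξ^*θ^ n) (unit-inverse u u0≈1)) (*-identityˡ 1#))

    -- From [k] = θ^Q (1 - x^{Q-1}) with Q = q^k: for k ≥ 1 the second factor has constant term 1,
    -- so `invPS` inverts it.
    bracket-unit : ℕ → PS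
    bracket-unit n = onePS ⊖ powPS x n

    br⁻¹ : ℕ → Carrier
    br⁻¹ k = ξ ^ (q ℕ.^ k) * j (invPS (bracket-unit (ℕ.pred (q ℕ.^ k))))

    br-inverse : ∀ k → br (suc k) * br⁻¹ (suc k) ≈ 1#
    br-inverse k = trans (*-congʳ (lemma (q ℕ.^ suc k) {{nz}})) (θ-u (q ℕ.^ suc k) (bracket-unit (ℕ.pred (q ℕ.^ suc k))) (constant (ℕ.pred (q ℕ.^ suc k)) positive))
      where
      nz : ℕ.NonZero (q ℕ.^ suc k)
      nz = ℕₚ.m^n≢0 q (suc k)
      1<q^ : 1 ℕ.< q ℕ.^ suc k
      1<q^ = ℕₚ.<-≤-trans (s≤s 0<q-1) (ℕₚ.m≤m*n q (q ℕ.^ k) {{ℕₚ.m^n≢0 q k}})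
      positive : 0 ℕ.< ℕ.pred (q ℕ.^ suc k)
      positive = ℕₚ.suc[m]≤n⇒m≤pred[n] 1<q^
      constant : ∀ n → 0 ℕ.< n → bracket-unit n 0 F.≈ F.1#
      constant (suc n) _ = F.trans (F.+-congˡ (F.trans (F.-‿cong (x-⊛-zero (powPS x n))) F.-0#≈0#)) (F.+-identityʳ _)
      lemma : ∀ Q .{{_ : ℕ.NonZero Q}} → θ ^ Q - θ ≈ θ ^ Q * j (bracket-unit (ℕ.pred Q))
      lemma (suc n) = sym (begin
        θ * θ ^ n * j (onePS ⊖ powPS x n)         ≈⟨ *-congˡ (trans (j-+ _ _) (+-cong j-1 (trans (j-neg _) (-‿cong (trans (reflexive (≡.cong j (powPS≡^ x n))) (j-^ x n)))))) ⟩
        θ * θ ^ n * (1# - ξ ^ n)                  ≈⟨ solve 3 (λ t p r → t :* p :* (con (pos 1) :- r) := t :* p :- t :* (r :* p)) refl _ _ _ ⟩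
        θ * θ ^ n - θ * (ξ ^ n * θ ^ n)           ≈⟨ +-congˡ (-‿cong (trans (*-congˡ (ξ^*θ^ n)) (*-identityʳ θ))) ⟩
        θ * θ ^ n - θ                             ∎)

    -- The inverse of a monic a = θ^d u_a as x^d / u_a, the same normal form as in the definition of
    -- the power sums.
    inv : List F.Carrier → Carrier
    inv cs = ξ ^ length cs * j (invPS (listPS (F.1# ∷ cs)))

    low-list : ∀ cs → θ ^ length cs * j (x ⊛ listPS cs) ≈ low cs
    low-list []       = trans (*-congˡ (trans (j-cong (CommutativeRing.zeroʳ ring-PS x)) j-0)) (zeroʳ _)
    low-list (c ∷ cs) = begin
      θ * θ ^ length cs * j (x ⊛ listPS (c ∷ cs))              ≈⟨ *-congˡ (trans (j-* _ _) (*-congˡ (trans (j-cong (listPS-∷ c cs)) (j-+ _ _)))) ⟩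
      θ * θ ^ length cs * (ξ * (ι c + j (x ⊛ listPS cs)))      ≈⟨ solve 5 (λ t p x c l → t :* p :* (x :* (c :+ l)) := (x :* t) :* (c :* p :+ p :* l)) refl _ _ _ _ _ ⟩
      ξ * θ * (ι c * θ ^ length cs + θ ^ length cs * j (x ⊛ listPS cs))  ≈⟨ trans (*-congʳ jx*θ≈1) (*-identityˡ _) ⟩
      ι c * θ ^ length cs + θ ^ length cs * j (x ⊛ listPS cs)  ≈⟨ +-congˡ (low-list cs) ⟩
      ι c * θ ^ length cs + low cs                             ∎

    inv-inverse : ∀ cs → (θ ^ length cs + low cs) * inv cs ≈ 1#
    inv-inverse cs = trans (*-congʳ monic) (θ-u (length cs) (listPS (F.1# ∷ cs)) F.refl)
      where
      monic : θ ^ length cs + low cs ≈ θ ^ length cs * j (listPS (F.1# ∷ cs))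
      monic = sym (begin
        θ ^ length cs * j (listPS (F.1# ∷ cs))                       ≈⟨ *-congˡ (trans (j-cong (listPS-∷ F.1# cs)) (trans (j-+ _ _) (+-congʳ (Hom.ι-1 F R ι-hom)))) ⟩
        θ ^ length cs * (1# + j (x ⊛ listPS cs))                     ≈⟨ trans (distribˡ _ _ _) (+-cong (*-identityʳ _) (low-list cs)) ⟩
        θ ^ length cs + low cs                                       ∎)

    open PowerSums.WithInverses R ι ι-hom θ br⁻¹ br-inverse inv inv-inverse using (S; K; Z; ζ; K-Z)
    open Series R [] using (sumTo)
    open PowerSeries R [] using () renaming (sumTo-cong to sumToR-cong)

    j-sumPS : {X : Set} (xs : List X) (f : X → PS) → j (sumPS (map f xs)) ≈ ∑ xs (j ∘ f)
    j-sumPS []       f = j-0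
    j-sumPS (a ∷ xs) f = trans (j-+ _ _) (+-congˡ (j-sumPS xs f))

    j-S : ∀ d s → j (SPS d s) ≈ S d s
    j-S d s = begin
      j (shift (d ℕ.* s) (sumPS (map u^ (tuples d))))                ≈⟨ j-cong (shift≋x^ (d ℕ.* s) (sumPS (map u^ (tuples d)))) ⟩
      j (_ ⊛ sumPS (map u^ (tuples d)))                              ≈⟨ trans (j-* _ _) (*-cong (j-^ x (d ℕ.* s)) (j-sumPS (tuples d) u^)) ⟩
      ξ ^ (d ℕ.* s) * ∑ (tuples d) (j ∘ u^)                          ≈⟨ ∑-*ˡ (tuples d) _ _ ⟩
      ∑ (tuples d) (λ cs → ξ ^ (d ℕ.* s) * j (u^ cs))                ≈⟨ ∑-cong-All (tuples d) (All.map term (tuples-length d)) ⟩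
      ∑ (tuples d) (λ cs → inv cs ^ s)                               ∎
      where
      u^ : List F.Carrier → PS
      u^ cs = powPS (invPS (listPS (F.1# ∷ cs))) s
      term : ∀ {cs} → length cs ≡ d → ξ ^ (d ℕ.* s) * j (u^ cs) ≈ inv cs ^ s
      term {cs} ≡.refl = trans (*-cong (sym (^-assocʳ ξ (length cs) s))
        (trans (reflexive (≡.cong j (powPS≡^ (invPS (listPS (F.1# ∷ cs))) s))) (j-^ _ s))) (sym (^-distrib-* _ _ s))

    j-sumTo : ∀ b (f : ℕ → PS) → j (λ n → sumToF b (λ d → f d n)) ≈ sumTo b (j ∘ f)
    j-sumTo zero    f = j-0
    j-sumTo (suc b) f = trans (j-+ _ _) (+-congʳ (j-sumTo b f))

    j-Zpart : ∀ s ss b → j (Zpart (s ∷ ss) b) ≈ sumTo b (λ d → S d s * j (Zpart ss d))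
    j-Zpart s ss b = trans (j-sumTo b (λ d → SPS d s ⊛ Zpart ss d)) (sumToR-cong b (λ d → trans (j-* _ _) (*-congʳ (j-S d s))))

    j-Zpart₁ : ∀ s b → j (Zpart (s ∷ []) b) ≈ sumTo b (λ d → S d s)
    j-Zpart₁ s b = trans (j-Zpart s [] b) (sumToR-cong b (λ d → trans (*-congˡ j-1) (*-identityʳ _)))

    j-Z : ∀ N → j (Zpart ss N) ≈ Z N
    j-Z N = trans (j-Zpart 1 (s₂ ∷ s₃ ∷ []) N) (sumToR-cong N (λ d → *-congˡ (trans (j-Zpart s₂ (s₃ ∷ []) d) (sumToR-cong d (λ e →
      *-cong (reflexive (≡.cong (S e) exponent₂)) (trans (j-Zpart₁ s₃ e) (sumToR-cong e (λ f → reflexive (≡.cong (S f) exponent₃)))))))))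

    j-ζ : ∀ N → j (Zpart (q ℕ.^ 3 ∷ []) N) ≈ ζ N
    j-ζ N = trans (j-Zpart₁ (q ℕ.^ 3) N) (sumToR-cong N (λ d → reflexive (≡.cong (S d) q^3≡qqq)))

    -- The numerator [3] - 1 arises here: in [3] ζ_{≤N} - ζ_{<N} the second sum is the first without
    -- its last term, so S_N(q³) remains as the error.
    truncated : ∀ N → j (Zpart ss (suc (suc (suc N)))) * (br 3 * br 2 * br 1 ^ ((q ℕ.^ 2 ℕ.∸ q) ℕ.+ 1)) ≈
      (br 3 - 1#) * j (Zpart (q ℕ.^ 3 ∷ []) (suc N)) + j (SPS N (q ℕ.^ 3))
    truncated N = begin
      j (Zpart ss (suc (suc (suc N)))) * (br 3 * br 2 * br 1 ^ ((q ℕ.^ 2 ℕ.∸ q) ℕ.+ 1))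
        ≈⟨ *-cong (j-Z (suc (suc (suc N)))) (*-congˡ (trans (reflexive (≡.cong (br 1 ^_) exponent-K)) (*-congˡ (sym (^-assocʳ (br 1) q-1 q))))) ⟩
      Z (suc (suc (suc N))) * (br 3 * br 2 * (br 1 * (br 1 ^ q-1) ^ q))
        ≈⟨ solve 4 (λ Z b₃ b₂ b₁ → Z :* (b₃ :* b₂ :* b₁) := b₃ :* (b₂ :* b₁ :* Z)) refl _ _ _ _ ⟩
      br 3 * (K * Z (suc (suc (suc N))))
        ≈⟨ K-Z N ⟩
      br 3 * ζ (suc N) - ζ N
        ≈⟨ solve 3 (λ b z s → b :* (z :+ s) :- z := (b :- con (pos 1)) :* (z :+ s) :+ s) refl _ _ _ ⟩
      (br 3 - 1#) * ζ (suc N) + S N (q ℕ.* q ℕ.* q)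
        ≈⟨ +-cong (*-congˡ (j-ζ (suc N))) (trans (j-S N (q ℕ.^ 3)) (reflexive (≡.cong (S N) q^3≡qqq))) ⟨
      (br 3 - 1#) * j (Zpart (q ℕ.^ 3 ∷ []) (suc N)) + j (SPS N (q ℕ.^ 3)) ∎

-- The identity of Laurent series as a limit

open import Data.Nat using (_<_; _+_; _*_; _∸_; _^_)

theorem4p7 : (q : ℕ) → 2 < q → (F : CommutativeRing 0ℓ 0ℓ) → (Fq : FiniteField F q) →
  let open Series F (FiniteField.elems Fq) in
  (ζA (1 ∷ q * (q ∸ 1) ∷ (q ^ 3 ∸ q ^ 2) + q ∸ 1 ∷ [])
     *L ((bracket q 3 *L bracket q 2) *L (bracket q 1 ^L ((q ^ 2 ∸ q) + 1))))
  ≈L ((bracket q 3 -L oneL) *L ζA (q ^ 3 ∷ []))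
theorem4p7 (suc q-1) (s≤s 1<q-1) F Fq = limit (zetaPS ss) (zetaPS (q ℕ.^ 3 ∷ [])) (toFrac denominatorL) (toFrac numeratorL)
  -- The choice N = n + 1 in `truncated` makes the error S_N(q³) vanish up to degree n; the bounds N
  -- + 3 and N + 1 of the partial sums then exceed n as well.
  (λ n → f n , g n , S (suc n) (q ℕ.^ 3)
    , (λ i i≤n → F.sym (Zpart-stable 1 (s₂ ∷ s₃ ∷ []) (3 ℕ.+ suc n) i (s≤s z≤n) (ℕₚ.≤-trans (s≤s i≤n) (ℕₚ.m≤n+m (suc n) 3))))
    , (λ i i≤n → F.sym (Zpart-stable (q ℕ.^ 3) [] (suc (suc n)) i 0<q³ (ℕₚ.≤-trans (s≤s i≤n) (ℕₚ.n≤1+n (suc n)))))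
    , (λ i i≤n → S-low (suc n) (q ℕ.^ 3) i (s≤s i≤n) 0<q³)
    , approximation n)
  where
  q : ℕ
  q = suc q-1
  open Series F (FiniteField.elems Fq)
  open LaurentSeries F (FiniteField.elems Fq)
  open FqAlgebra F q-1 Fq (ℕₚ.<-trans (s≤s z≤n) 1<q-1)
  open Truncated ring-Frac embed embed-hom (toFrac θL) ξ*θ≈1 using (truncated; ι; ι-hom)
  open Bracket ring-Frac ι ι-hom (toFrac θL) using (br)
  module L = CommutativeRing ring-Frac
  open import Algebra.Properties.CommutativeSemiring.Exp L.commutativeSemiring using (^-congˡ) renaming (_^_ to _^Frac_)
  0<q³ : 0 ℕ.< q ℕ.^ 3
  0<q³ = ℕₚ.m^n>0 q 3
  m : ℕ
  m = (q ℕ.^ 2 ℕ.∸ q) ℕ.+ 1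
  denominatorL numeratorL : Laurent
  denominatorL = (bracket q 3 *L bracket q 2) *L (bracket q 1 ^L m)
  numeratorL = bracket q 3 -L oneL
  denominator numerator : Frac
  denominator = (br 3 *′ br 2) *′ (br 1 ^Frac m)
  numerator = br 3 L.- L.1#
  bracket≈br : ∀ k → toFrac (bracket q k) L.≈ br k
  bracket≈br k = L.trans {toFrac (bracket q k)} {toFrac (θL ^L (q ℕ.^ k)) L.- toFrac θL} {br k}
    (toFrac-sub (θL ^L (q ℕ.^ k)) θL) (L.reflexive (≡.cong (L._- toFrac θL) (toFrac-^ θL (q ℕ.^ k))))
  denominatorL≈ : toFrac denominatorL L.≈ denominator
  denominatorL≈ = L.*-cong {toFrac (bracket q 3) *′ toFrac (bracket q 2)} {br 3 *′ br 2} {toFrac (bracket q 1 ^L m)} {br 1 ^Frac m}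
    (L.*-cong {toFrac (bracket q 3)} {br 3} {toFrac (bracket q 2)} {br 2} (bracket≈br 3) (bracket≈br 2))
    (L.trans {toFrac (bracket q 1 ^L m)} {toFrac (bracket q 1) ^Frac m} {br 1 ^Frac m}
      (L.reflexive (toFrac-^ (bracket q 1) m)) (^-congˡ m {toFrac (bracket q 1)} {br 1} (bracket≈br 1)))
  numeratorL≈ : toFrac numeratorL L.≈ numerator
  numeratorL≈ = L.trans {toFrac numeratorL} {toFrac (bracket q 3) L.- L.1#} {numerator} (toFrac-sub (bracket q 3) oneL)
    (L.+-congʳ {L.- L.1#} {toFrac (bracket q 3)} {br 3} (bracket≈br 3))
  f g : ℕ → PS
  f n = Zpart ss (3 ℕ.+ suc n)
  g n = Zpart (q ℕ.^ 3 ∷ []) (suc (suc n))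
  approximation : ∀ n → (embed (f n) *′ toFrac denominatorL) L.≈ ((toFrac numeratorL *′ embed (g n)) +′ embed (S (suc n) (q ℕ.^ 3)))
  approximation n = begin
    embed (f n) *′ toFrac denominatorL
      ≈⟨ L.*-congˡ {embed (f n)} {toFrac denominatorL} {denominator} denominatorL≈ ⟩
    embed (f n) *′ denominator
      ≈⟨ truncated (suc n) ⟩
    (numerator *′ embed (g n)) +′ embed (S (suc n) (q ℕ.^ 3))
      ≈⟨ L.+-congʳ {embed (S (suc n) (q ℕ.^ 3))} {toFrac numeratorL *′ embed (g n)} {numerator *′ embed (g n)}
           (L.*-congʳ {embed (g n)} {toFrac numeratorL} {numerator} numeratorL≈) ⟨
    (toFrac numeratorL *′ embed (g n)) +′ embed (S (suc n) (q ℕ.^ 3)) ∎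
    where open import Relation.Binary.Reasoning.Setoid L.setoid
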